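{- For every integer $t\geq 2$, the limit $\lim_{s\to\infty}\sqrt[s]{A_{321}(K_{s,t}^\alpha)}$ exists and \[4^{t-2}(3+2\sqrt 2)\leq\lim_{s\to\infty}\sqrt[s]{A_{321}(K_{s,t}^\alpha)}\leq\frac{(2t-1)^{2t-1}}{(t-1)^{t-1}t^t}.\]
   Context: $K^\alpha_{s,t}$ is the poset on $[st]$ whose order is generated by the covering relations $i\lessdot i+1$ for $1\le i\le s-1$ and $i\lessdot i+s$ for $1\le i\le st-s$ (the comb $K_{s,t}$ with elements $e_{i,j}$, covers $e_{i,1}\lessdot e_{i+1,1}$, $e_{i,j}\lessdot e_{i,j+1}$, and $e_{i,j}$ labeled $(j-1)s+i$). A linear extension is a permutation of $[st]$ in which $x$ precedes $y$ whenever $x<y$ in the poset. $A_{321}(P)$ is the number of linear extensions of $P$ avoiding the pattern $321$. -}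

module Defs where

open import Algebra.Bundles using (RawMonoid)
import Algebra.Definitions.RawMonoid as RawMonoidOps
import Algebra.Definitions.RawSemiring as RawSemiringOps
open import Data.Fin as Fin using (Fin; toℕ)
open import Data.Fin.Properties as Fin using (any?; all?)
open import Data.Integer using (+_)
open import Data.List using (List; []; _∷_; allFin; cartesianProductWith; filter; length)
open import Data.Nat as ℕ using (ℕ; zero; suc; NonZero)
import Data.Nat.Properties as ℕ
open import Data.Product using (∃₂; ∃-syntax; _×_; _,_; proj₂)
open import Data.Rational as ℚ using (ℚ; 0ℚ; 1ℚ)
import Data.Rational.Properties as ℚ
open import Data.Sum using (_⊎_)
open import Data.Vec using (Vec; []; _∷_; lookup)
open import Data.Vec.Relation.Unary.AllPairs using (allPairs?)
open import Data.Vec.Relation.Unary.Unique.Propositional using (Unique)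
open import Data.Vec.Relation.Unary.Unique.Propositional.Properties using (lookup-injective)
open import Level using (0ℓ)
open import Relation.Binary.Construct.Closure.Transitive using (TransClosure; [_]; _∷_)
open import Relation.Binary.Core using (Rel)
import Relation.Binary.Definitions as B
open import Relation.Binary.Definitions using (tri<; tri≈; tri>)
open import Relation.Binary.PropositionalEquality
  using (_≡_; refl; sym; trans; cong; subst; module ≡-Reasoning)
open import Relation.Nullary using (¬_; yes; no; contradiction)
open import Relation.Nullary.Decidable using (map′; _×-dec_; _→-dec_; _⊎-dec_; ¬?)
open import Relation.Unary using (Pred; Decidable; _∈_; _∉_; _⊆_)

------------------------------------------------------------------------
-- Permutations as words, linear extensions, and 321-avoidance

-- The word π(1) π(2) … π(n); the letter k of [n] is the element of
-- Fin n with toℕ equal to k ∸ 1.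
Word : ℕ → Set
Word n = Vec (Fin n) n

Precedes : ∀ {n} → Word n → Rel (Fin n) 0ℓ
Precedes w x y = ∃₂ λ i j → i Fin.< j × lookup w i ≡ x × lookup w j ≡ y

-- A word of length n in n letters is a permutation iff no letter repeats.
record IsLinearExtension {n} (_≺_ : Rel (Fin n) 0ℓ) (w : Word n) : Set where
  constructor mkLinearExtension
  field
    isPermutation : Unique w
    respects      : ∀ x y → x ≺ y → Precedes w x y

Contains321 : ∀ {n} → Word n → Set
Contains321 w = ∃[ i ] ∃[ j ] ∃[ k ]
  (i Fin.< j × j Fin.< k ×
   lookup w k Fin.< lookup w j × lookup w j Fin.< lookup w i)

Avoids321 : ∀ {n} → Word n → Set
Avoids321 w = ¬ Contains321 w

avoids321? : ∀ {n} → Decidable (Avoids321 {n})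
avoids321? w = ¬? (any? λ i → any? λ j → any? λ k →
  (i Fin.<? j) ×-dec (j Fin.<? k) ×-dec
  (lookup w k Fin.<? lookup w j) ×-dec (lookup w j Fin.<? lookup w i))

precedes? : ∀ {n} (w : Word n) → B.Decidable (Precedes w)
precedes? w x y = any? λ i → any? λ j →
  (i Fin.<? j) ×-dec (lookup w i Fin.≟ x) ×-dec (lookup w j Fin.≟ y)

precedes-trans : ∀ {n} {w : Word n} → Unique w → B.Transitive (Precedes w)
precedes-trans {w = w} u (i , j , i<j , wi , wj) (j′ , k , j′<k , wj′ , wk)
  with refl ← lookup-injective u j j′ (trans wj (sym wj′))
  = i , k , ℕ.<-trans i<j j′<k , wi , wk

-- For permutations it suffices to check the covering relations, so being
-- a linear extension of the order they generate is decidable.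
isLinearExtension? : ∀ {n} {_⋖_ : Rel (Fin n) 0ℓ} → B.Decidable _⋖_ →
                     Decidable (IsLinearExtension (TransClosure _⋖_))
isLinearExtension? {n} {_⋖_} _⋖?_ w with allPairs? (λ x y → ¬? (x Fin.≟ y)) w
... | no ¬u = no λ e → ¬u (IsLinearExtension.isPermutation e)
... | yes u = map′ (λ h → mkLinearExtension u (extend h))
                   (λ e x y x⋖y → IsLinearExtension.respects e x y [ x⋖y ])
                   (all? λ x → all? λ y → (x ⋖? y) →-dec precedes? w x y)
  where
  extend : (∀ x y → x ⋖ y → Precedes w x y) →
           ∀ x y → TransClosure _⋖_ x y → Precedes w x y
  extend h x y [ x⋖y ]     = h x y x⋖y
  extend h x y (x⋖z ∷ z≺y) = precedes-trans u (h x _ x⋖z) (extend h _ y z≺y)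

vectors : ∀ {a} {A : Set a} → List A → ∀ k → List (Vec A k)
vectors xs zero    = [] ∷ []
vectors xs (suc k) = cartesianProductWith _∷_ xs (vectors xs k)

words : ∀ n → List (Word n)
words n = vectors (allFin n) n

-- The argument decides the covering relations generating the order.
A₃₂₁ : ∀ {n} {_⋖_ : Rel (Fin n) 0ℓ} → B.Decidable _⋖_ → ℕ
A₃₂₁ {n} _⋖?_ =
  length (filter (λ w → isLinearExtension? _⋖?_ w ×-dec avoids321? w) (words n))

-- With i = suc (toℕ x), the first alternative is i ⋖ i + 1 for
-- 1 ≤ i ≤ s - 1, the second is i ⋖ i + s for 1 ≤ i ≤ st - s.
Kᵅ-cover : ∀ s t → Rel (Fin (s ℕ.* t)) 0ℓ
Kᵅ-cover s t x y =
  (suc (toℕ x) ℕ.< s × toℕ y ≡ suc (toℕ x)) ⊎ toℕ y ≡ toℕ x ℕ.+ s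

Kᵅ : ∀ s t → B.Decidable (Kᵅ-cover s t)
Kᵅ s t x y =
  ((suc (toℕ x) ℕ.<? s) ×-dec (toℕ y ℕ.≟ suc (toℕ x))) ⊎-dec
  (toℕ y ℕ.≟ toℕ x ℕ.+ s)

------------------------------------------------------------------------
-- Real numbers as Dedekind cuts

-- A cut is given by its lower class, as is usual classically.  Under
-- excluded middle these are the real numbers; without it, only the
-- lower reals.
record ℝ : Set₁ where
  field
    lower     : Pred ℚ 0ℓ
    inhabited : ∃[ q ] q ∈ lower
    proper    : ∃[ q ] q ∉ lower
    closed    : ∀ {p q} → p ℚ.< q → q ∈ lower → p ∈ lower
    rounded   : ∀ {p} → p ∈ lower → ∃[ q ] (p ℚ.< q × q ∈ lower)

open ℝ

infix 4 _≤_ _<_ _≈_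

_≤_ : Rel ℝ 0ℓ
x ≤ y = lower x ⊆ lower y

_<_ : Rel ℝ 0ℓ
x < y = ∃[ q ] (q ∈ lower y × q ∉ lower x)

_≈_ : Rel ℝ 0ℓ
x ≈ y = x ≤ y × y ≤ x

∈∉⇒< : ∀ x {p q} → p ∈ lower x → q ∉ lower x → p ℚ.< q
∈∉⇒< x {p} {q} p∈x q∉x with ℚ.<-cmp p q
... | tri< p<q _ _  = p<q
... | tri≈ _ refl _ = contradiction p∈x q∉x
... | tri> _ _ q<p  = contradiction (closed x q<p p∈x) q∉x

private
  p-1<p : ∀ p → p ℚ.- 1ℚ ℚ.< p
  p-1<p p = subst (p ℚ.- 1ℚ ℚ.<_) (ℚ.+-identityʳ p)
    (ℚ.+-monoʳ-< p (ℚ.negative⁻¹ (ℚ.- 1ℚ)))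

  p+[q-p]≡q : ∀ p q → p ℚ.+ (q ℚ.- p) ≡ q
  p+[q-p]≡q p q = begin
    p ℚ.+ (q ℚ.- p)     ≡⟨ cong (p ℚ.+_) (ℚ.+-comm q (ℚ.- p)) ⟩
    p ℚ.+ (ℚ.- p ℚ.+ q) ≡⟨ ℚ.+-assoc p (ℚ.- p) q ⟨
    (p ℚ.- p) ℚ.+ q     ≡⟨ cong (ℚ._+ q) (ℚ.+-inverseʳ p) ⟩
    0ℚ ℚ.+ q            ≡⟨ ℚ.+-identityˡ q ⟩
    q                   ∎
    where open ≡-Reasoning

fromℚ : ℚ → ℝ
fromℚ r = record
  { lower     = ℚ._< r
  ; inhabited = r ℚ.- 1ℚ , p-1<p r
  ; proper    = r , ℚ.<-irrefl refl
  ; closed    = ℚ.<-trans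
  ; rounded   = ℚ.<-dense
  }

fromℕ : ℕ → ℝ
fromℕ n = fromℚ (+ n ℚ./ 1)

0ℝ : ℝ
0ℝ = fromℕ 0

infixl 6 _+_

_+_ : ℝ → ℝ → ℝ
x + y = record
  { lower     = λ r → ∃₂ λ p q → p ∈ lower x × q ∈ lower y × r ≡ p ℚ.+ q
  ; inhabited = _ , _ , _ , proj₂ (inhabited x) , proj₂ (inhabited y) , refl
  ; proper    = let b , b∉x = proper x ; c , c∉y = proper y in
      b ℚ.+ c , λ (p , q , p∈x , q∈y , b+c≡p+q) →
        ℚ.<-irrefl (sym b+c≡p+q)
          (ℚ.+-mono-< (∈∉⇒< x p∈x b∉x) (∈∉⇒< y q∈y c∉y))
  ; closed    = λ { {r} r<p+q (p , q , p∈x , q∈y , refl) →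
      p , r ℚ.- p , p∈x , closed y (r-p<q r<p+q) q∈y , sym (p+[q-p]≡q p r) }
  ; rounded   = λ { (p , q , p∈x , q∈y , refl) →
      let p′ , p<p′ , p′∈x = rounded x p∈x in
      p′ ℚ.+ q , ℚ.+-monoˡ-< q p<p′ , p′ , q , p′∈x , q∈y , refl }
  }
  where
  r-p<q : ∀ {r p q} → r ℚ.< p ℚ.+ q → r ℚ.- p ℚ.< q
  r-p<q {r} {p} {q} r<p+q = subst (r ℚ.- p ℚ.<_)
    (trans (ℚ.+-assoc p q (ℚ.- p)) (p+[q-p]≡q p q))
    (ℚ.+-monoˡ-< (ℚ.- p) r<p+q)

+-0-rawMonoid : RawMonoid _ _
+-0-rawMonoid = record { _≈_ = _≈_ ; _∙_ = _+_ ; ε = 0ℝ }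

-- n · x is the n-fold sum x + ⋯ + x.
open RawMonoidOps +-0-rawMonoid public using () renaming (_×_ to _·_)

open RawSemiringOps ℚ.+-*-rawSemiring using (_^_)

private
  r≤r^s : ∀ s .{{_ : NonZero s}} {r} → 1ℚ ℚ.≤ r → r ℚ.≤ r ^ s
  r≤r^s (suc s) {r} 1≤r = subst (ℚ._≤ r ^ suc s) (ℚ.*-identityʳ r)
    (ℚ.*-monoˡ-≤-nonNeg r {{nn}} (1≤r^ s))
    where
    nn = ℚ.nonNegative (ℚ.≤-trans (ℚ.nonNegative⁻¹ 1ℚ) 1≤r)
    1≤r^ : ∀ k → 1ℚ ℚ.≤ r ^ k
    1≤r^ zero    = ℚ.≤-refl
    1≤r^ (suc k) = ℚ.≤-trans 1≤r (subst (ℚ._≤ r ^ suc k) (ℚ.*-identityʳ r)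
      (ℚ.*-monoˡ-≤-nonNeg r {{nn}} (1≤r^ k)))

  0^s≡0 : ∀ s .{{_ : NonZero s}} → 0ℚ ^ s ≡ 0ℚ
  0^s≡0 (suc s) = ℚ.*-zeroˡ (0ℚ ^ s)

  0≤n : ∀ n → 0ℚ ℚ.≤ + n ℚ./ 1
  0≤n n = ℚ.nonNegative⁻¹ _ {{ℚ.normalize-nonNeg n 1}}

-- The s-th root of n, as sup { r ≥ 0 ∣ r ^ s ≤ n }.
root : (s : ℕ) → .{{NonZero s}} → ℕ → ℝ
root s n = record
  { lower     = λ q → ∃[ r ] (q ℚ.< r × 0ℚ ℚ.≤ r × r ^ s ℚ.≤ + n ℚ./ 1)
  ; inhabited = ℚ.- 1ℚ , 0ℚ , ℚ.negative⁻¹ (ℚ.- 1ℚ) , ℚ.≤-refl ,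
      subst (ℚ._≤ + n ℚ./ 1) (sym (0^s≡0 s)) (0≤n n)
  ; proper    = (1ℚ ℚ.+ + n ℚ./ 1) , λ (r , 1+n<r , _ , r^s≤n) →
      ℚ.<-irrefl refl (begin-strict
        r                ≤⟨ r≤r^s s (1≤r 1+n<r) ⟩
        r ^ s            ≤⟨ r^s≤n ⟩
        + n ℚ./ 1        ≡⟨ ℚ.+-identityˡ _ ⟨
        0ℚ ℚ.+ + n ℚ./ 1 <⟨ ℚ.+-monoˡ-< (+ n ℚ./ 1) (ℚ.positive⁻¹ 1ℚ) ⟩
        1ℚ ℚ.+ + n ℚ./ 1 <⟨ 1+n<r ⟩
        r                ∎)
  ; closed    = λ p<q (r , q<r , h) → r , ℚ.<-trans p<q q<r , h
  ; rounded   = λ (r , p<r , h) →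
      let q , p<q , q<r = ℚ.<-dense p<r in q , p<q , r , q<r , h
  }
  where
  open ℚ.≤-Reasoning
  1≤r : ∀ {r} → 1ℚ ℚ.+ + n ℚ./ 1 ℚ.< r → 1ℚ ℚ.≤ r
  1≤r {r} 1+n<r = begin
    1ℚ               ≡⟨ ℚ.+-identityʳ 1ℚ ⟨
    1ℚ ℚ.+ 0ℚ        ≤⟨ ℚ.+-monoʳ-≤ 1ℚ (0≤n n) ⟩
    1ℚ ℚ.+ + n ℚ./ 1 <⟨ 1+n<r ⟩
    r                ∎

√_ : ℕ → ℝ
√ n = root 2 n

infix 4 _⟶_

-- Convergence of a sequence indexed by the positive integers; the two
-- inequalities say that ∣ x n - l ∣ < ε.
_⟶_ : ((n : ℕ) → .{{NonZero n}} → ℝ) → ℝ → Set₁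
x ⟶ l = ∀ ε → 0ℝ < ε →
  ∃[ N ] (∀ n .{{_ : NonZero n}} → N ℕ.≤ n → x n < l + ε × l < x n + ε)

------------------------------------------------------------------------

-- This includes m = 0, as 0 ^ 0 = 1.
m^m≢0 : ∀ m → NonZero (m ℕ.^ m)
m^m≢0 zero    = _
m^m≢0 (suc m) = ℕ.m^n≢0 (suc m) (suc m)

upperBound : ℕ → ℚ
upperBound t =
  (+ (2t-1 ℕ.^ 2t-1) ℚ./ ((t ℕ.∸ 1) ℕ.^ (t ℕ.∸ 1) ℕ.* t ℕ.^ t))
    {{ℕ.m*n≢0 _ _ {{m^m≢0 (t ℕ.∸ 1)}} {{m^m≢0 t}}}}
  where
  2t-1 = 2 ℕ.* t ℕ.∸ 1

{-# OPTIONS --safe #-}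
-- Let u x be the time at which the letter x occurs in a 321-avoiding linear extension.
-- Call x an N if some smaller letter occurs later, and a P otherwise; the first s letters
-- are P, and both the P's and the N's occur in increasing order.  The word is therefore
-- determined by the set of N's together with the number T x of P's read before each N,
-- and the words correspond to the data with T weakly increasing, T x less than the number
-- of P's below x, and T x at least the number of P's up to x - s whenever x - s is a P.
--
-- Limit.  If these inequalities hold only up to an error δ, inserting f > 2 δ new P's at
-- the start of every row (f new columns) and raising T accordingly makes them exact.
-- There are only exp (o s) possibilities for T and for the counting function of the P's
-- rounded to multiples of b.  Interleaving the columns of k words with the same rounding
-- satisfies the inequalities up to O (k b), so A s ^ k ≤ exp (o s) ^ k * A N for all
-- N ≥ k (s + O b), and the roots converge as in Fekete's lemma.
--
-- Upper bound.  The word is also determined by the colours of its letters, listed once by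
-- letter and once by time.  The two lists have equally many N's, and weighting a letter of
-- the rows j ≥ 2 by t or t - 1 and a time by t - 1 or t gives all words the same weight.
--
-- Lower bound.  Cut the rows into chunks of length b.  In rows j ≥ 3, subsets X, Y of a
-- chunk with a elements give about 4 ^ b choices of a chunk: X is its set of N's, and Y says
-- how T grows.  In row 2 the positions outside X may moreover be P or N freely, giving
-- C(b,a)² 2 ^ (b-a), which for the best a is about (1 + √2) ^ (2 b).
module Submission where

-- Plain supermultiplicativity fails because the inequality at a letter compares counts over all
-- smaller letters: once several words are interleaved, it is needed for the sum over all of them,
-- although only one of them supplies it. Words with nearly equal profiles supply it for each other,
-- hence the pigeonhole on rounded profiles. The rounding step is taken proportional to the width s.
-- A profile is then described by boundedly many numbers, so the classes are polynomially many,
-- while the padding is a small fraction of s. Both losses are absorbed by passing from a trial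
-- growth rate p/q to a smaller rate p′/q′.
--
-- The limit is defined as a lower limit, namely the cut of all rationals below some r with r ^ N at
-- most the count for all large N. Excluded middle enters with convergence: it locates this cut on a
-- grid and turns the failure of "eventually never" into "infinitely often".
--
-- The estimates live in the natural numbers. The number √2 is represented by fractions P/Q with P *
-- P ≤ 2 * (Q * Q), and solutions of P² + 1 = 2Q² finally close the gap to √2.

module Combinatorics where

  open import Data.Bool using (Bool; true; false; not; if_then_else_; _∧_; T)
  open import Data.Bool.Properties using (not-injective)
  open import Data.Fin using (Fin; toℕ; fromℕ<)
  open import Data.Fin.Properties using (toℕ<n; toℕ-injective; toℕ-fromℕ<; fromℕ<-toℕ)
  open import Data.List using (List; []; _∷_; _++_; length; map; filter; upTo;
    cartesianProduct; cartesianProductWith)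
  open import Data.List.Membership.Propositional using (_∈_)
  open import Data.List.Membership.Propositional.Properties using (∈-∃++; ∈-++⁻; ∈-++⁺ˡ; ∈-++⁺ʳ;
    ∈-filter⁺; ∈-filter⁻; ∈-allFin; ∈-upTo⁺; ∈-cartesianProduct⁺; ∈-cartesianProduct⁻;
    ∈-cartesianProductWith⁺; ∈-cartesianProductWith⁻)
  open import Data.List.Properties as List using (length-++; map-++; length-upTo)
  open import Data.List.Relation.Unary.All as All using ([]; _∷_)
  open import Data.List.Relation.Unary.Any using (here; there)
  open import Data.List.Relation.Unary.Unique.Propositional using (Unique; []; _∷_)
  open import Data.List.Relation.Unary.Unique.Propositional.Properties
    using (filter⁺; allFin⁺; cartesianProduct⁺; cartesianProductWith⁺)
  open import Data.Maybe as Maybe using (Maybe; just; nothing; is-nothing; maybe′)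
  open import Data.Maybe.Properties using (just-injective)
  open import Data.Nat
  open import Data.Nat.DivMod hiding (result)
  open import Data.Nat.Divisibility using (divides-refl)
  open import Data.Nat.ListAction using (sum)
  open import Data.Nat.ListAction.Properties using (sum-++)
  open import Data.Nat.Properties
  open import Data.Nat.Tactic.RingSolver using (solve-∀)
  open import Data.Product using (∃-syntax; _×_; _,_; proj₁; proj₂)
  import Data.Product.Properties as Product
  open import Data.Sum using (_⊎_; inj₁; inj₂)
  open import Data.Vec as Vec using (Vec; []; _∷_; lookup; tabulate; toList; replicate)
  open import Data.Vec.Properties as Vec
    using (∷-injective; lookup∘tabulate; tabulate∘lookup; tabulate-cong; length-toList)
  import Data.Vec.Relation.Unary.All as VecAll
  import Data.Vec.Relation.Unary.All.Properties as VecAll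
  open import Data.Vec.Relation.Unary.Unique.Propositional.Properties using (tabulate⁺; lookup-injective)
  open import Function using (_∘_)
  open import Relation.Binary.Construct.Closure.Transitive using (TransClosure; [_]; _∷_)
  open import Relation.Binary.Definitions using (DecidableEquality; tri<; tri≈; tri>)
  open import Relation.Binary.PropositionalEquality
  open import Relation.Nullary using (¬_; ¬?; Dec; yes; no; does; contradiction)
  open import Relation.Nullary.Decidable using (_×-dec_)
  open import Defs using (Word; Precedes; IsLinearExtension; mkLinearExtension; Avoids321; avoids321?;
    isLinearExtension?; words; vectors; Kᵅ; Kᵅ-cover)

  -- Finite sums and counting below a bound.

  ∑ : (ℕ → ℕ) → ℕ → ℕ
  ∑ f zero    = 0
  ∑ f (suc n) = ∑ f n + f n

  ∑-cong : ∀ {f g} n → (∀ x → x < n → f x ≡ g x) → ∑ f n ≡ ∑ g n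
  ∑-cong zero    h = refl
  ∑-cong (suc n) h = cong₂ _+_ (∑-cong n λ x x<n → h x (m<n⇒m<1+n x<n)) (h n ≤-refl)

  ∑-mono : ∀ {f g} n → (∀ x → x < n → f x ≤ g x) → ∑ f n ≤ ∑ g n
  ∑-mono zero    h = z≤n
  ∑-mono (suc n) h = +-mono-≤ (∑-mono n λ x x<n → h x (m<n⇒m<1+n x<n)) (h n ≤-refl)

  ∑-const : ∀ c n → ∑ (λ _ → c) n ≡ n * c
  ∑-const c zero    = refl
  ∑-const c (suc n) = trans (cong (_+ c) (∑-const c n)) (+-comm (n * c) c)

  ∑-distrib-+ : ∀ f g n → ∑ (λ x → f x + g x) n ≡ ∑ f n + ∑ g n
  ∑-distrib-+ f g zero    = refl
  ∑-distrib-+ f g (suc n) rewrite ∑-distrib-+ f g n = lem (∑ f n) (∑ g n) (f n) (g n)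
    where
    lem : ∀ a b c d → a + b + (c + d) ≡ a + c + (b + d)
    lem = solve-∀

  ∑-split : ∀ f m n → ∑ f (m + n) ≡ ∑ f m + ∑ (f ∘ (m +_)) n
  ∑-split f m zero    rewrite +-identityʳ m = sym (+-identityʳ _)
  ∑-split f m (suc n) rewrite +-suc m n | ∑-split f m n = +-assoc (∑ f m) _ _

  ∑-cancel : ∀ {f g} n k → k < n → (∀ x → x < n → x ≢ k → f x ≡ g x) →
             ∑ f n ≡ ∑ g n → f k ≡ g k
  ∑-cancel {f} {g} (suc n) k k<1+n h eq with k ≟ n
  ... | yes refl = +-cancelˡ-≡ (∑ f n) _ _ (trans eq (cong (_+ g n) (sym
          (∑-cong n λ x x<n → h x (m<n⇒m<1+n x<n) (<⇒≢ x<n)))))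
  ... | no k≢n   = ∑-cancel n k (≤∧≢⇒< (≤-pred k<1+n) k≢n)
          (λ x x<n → h x (m<n⇒m<1+n x<n))
          (+-cancelʳ-≡ (g n) _ _ (trans (cong (∑ f n +_) (sym (h n ≤-refl (k≢n ∘ sym)))) eq))

  𝟙 : Bool → ℕ
  𝟙 b = if b then 1 else 0

  𝟙≤1 : ∀ b → 𝟙 b ≤ 1
  𝟙≤1 true  = ≤-refl
  𝟙≤1 false = z≤n

  count : (ℕ → Bool) → ℕ → ℕ
  count Q = ∑ (𝟙 ∘ Q)

  count-cong : ∀ {Q R} n → (∀ x → x < n → Q x ≡ R x) → count Q n ≡ count R n
  count-cong n h = ∑-cong n λ x x<n → cong 𝟙 (h x x<n)

  count-suc : ∀ Q n → Q n ≡ true → count Q (suc n) ≡ suc (count Q n)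
  count-suc Q n eq rewrite eq = +-comm (count Q n) 1

  count-skip : ∀ Q n → Q n ≡ false → count Q (suc n) ≡ count Q n
  count-skip Q n eq rewrite eq = +-identityʳ (count Q n)

  count-mono : ∀ Q {m n} → m ≤ n → count Q m ≤ count Q n
  count-mono Q {m} {n} m≤n = begin
    count Q m             ≤⟨ m≤m+n _ _ ⟩
    _                     ≡⟨ ∑-split (𝟙 ∘ Q) m (n ∸ m) ⟨
    count Q (m + (n ∸ m)) ≡⟨ cong (count Q) (m+[n∸m]≡n m≤n) ⟩
    count Q n             ∎
    where open ≤-Reasoning

  count-< : ∀ Q {m n} → m < n → Q m ≡ true → count Q m < count Q n
  count-< Q {m} {n} m<n eq = subst (_≤ count Q n) (count-suc Q m eq) (count-mono Q m<n)

  count≤ : ∀ Q n → count Q n ≤ n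
  count≤ Q n = ≤-trans (∑-mono n λ x _ → 𝟙≤1 (Q x)) (≤-reflexive (trans (∑-const 1 n) (*-identityʳ n)))

  count-+≤ : ∀ Q m n → count Q (m + n) ≤ count Q m + n
  count-+≤ Q m n = ≤-trans (≤-reflexive (∑-split (𝟙 ∘ Q) m n))
                           (+-monoʳ-≤ (count Q m) (count≤ (Q ∘ (m +_)) n))

  count-all : ∀ {Q} n → (∀ x → x < n → Q x ≡ true) → count Q n ≡ n
  count-all n h = trans (∑-cong n λ x x<n → cong 𝟙 (h x x<n)) (trans (∑-const 1 n) (*-identityʳ n))

  count-complement : ∀ Q n → count Q n + count (not ∘ Q) n ≡ n
  count-complement Q n = trans (sym (∑-distrib-+ (𝟙 ∘ Q) (𝟙 ∘ not ∘ Q) n))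
    (trans (∑-cong n λ x _ → lem (Q x)) (trans (∑-const 1 n) (*-identityʳ n)))
    where
    lem : ∀ b → 𝟙 b + 𝟙 (not b) ≡ 1
    lem true  = refl
    lem false = refl

  ≡ᵇ-refl : ∀ n → (n ≡ᵇ n) ≡ true
  ≡ᵇ-refl zero    = refl
  ≡ᵇ-refl (suc n) = ≡ᵇ-refl n

  ≢⇒≡ᵇ-false : ∀ {m n} → m ≢ n → (m ≡ᵇ n) ≡ false
  ≢⇒≡ᵇ-false {m} {n} m≢n with m ≡ᵇ n in eq
  ... | false = refl
  ... | true  = contradiction (≡ᵇ⇒≡ m n (subst T (sym eq) _)) m≢n

  count-remove : ∀ R n y → y < n → R y ≡ true →
                 count R n ≡ suc (count (λ x → R x ∧ not (x ≡ᵇ y)) n)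
  count-remove R (suc n) y y<1+n Ry with y ≟ n
  ... | yes refl rewrite Ry | ≡ᵇ-refl n = trans (+-comm _ 1) (cong suc (trans
          (count-cong n λ x x<n → lem (R x) (≢⇒≡ᵇ-false (<⇒≢ x<n))) (sym (+-identityʳ _))))
    where
    lem : ∀ b {c} → c ≡ false → b ≡ b ∧ not c
    lem true  refl = refl
    lem false refl = refl
  ... | no y≢n rewrite count-remove R n y (≤∧≢⇒< (≤-pred y<1+n) y≢n) Ry
                     | ≢⇒≡ᵇ-false (y≢n ∘ sym) = cong (λ z → suc (count (λ x → R x ∧ not (x ≡ᵇ y)) n + 𝟙 z))
                         (lem (R n))
    where
    lem : ∀ b → b ≡ b ∧ true
    lem true  = refl
    lem false = refl

  -- Induction on `a`, removing the image of the last counted argument from `R`. With the identity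
  -- for `f` it also compares counts over different ranges.
  count-injection : ∀ Q R a b (f : ℕ → ℕ) →
    (∀ x → x < a → Q x ≡ true → f x < b × R (f x) ≡ true) →
    (∀ x y → x < a → y < a → Q x ≡ true → Q y ≡ true → f x ≡ f y → x ≡ y) →
    count Q a ≤ count R b
  count-injection Q R zero    b f h inj = z≤n
  count-injection Q R (suc a) b f h inj with Q a in Qa
  ... | false = subst (_≤ count R b) (sym (+-identityʳ _))
        (count-injection Q R a b f (λ x x<a → h x (m<n⇒m<1+n x<a))
          (λ x y x<a y<a → inj x y (m<n⇒m<1+n x<a) (m<n⇒m<1+n y<a)))
  ... | true  = subst₂ _≤_ (+-comm 1 _) (sym (count-remove R b (f a) fa<b Rfa))
        (s≤s (count-injection Q _ a b f h′
          (λ x y x<a y<a → inj x y (m<n⇒m<1+n x<a) (m<n⇒m<1+n y<a))))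
    where
    fa<b = proj₁ (h a ≤-refl Qa)
    Rfa  = proj₂ (h a ≤-refl Qa)
    h′ : ∀ x → x < a → Q x ≡ true → f x < b × (R (f x) ∧ not (f x ≡ᵇ f a)) ≡ true
    h′ x x<a Qx with fx<b , Rfx ← h x (m<n⇒m<1+n x<a) Qx
      rewrite Rfx | ≢⇒≡ᵇ-false {f x} {f a}
        (λ eq → <⇒≢ x<a (inj x a (m<n⇒m<1+n x<a) ≤-refl Qx Qa eq)) = fx<b , refl

  InjectiveBelow : ℕ → (ℕ → ℕ) → Set
  InjectiveBelow n u = ∀ x y → x < n → y < n → u x ≡ u y → x ≡ y

  injective⇒surjective : ∀ n u → (∀ x → x < n → u x < n) → InjectiveBelow n u →
                         ∀ τ → τ < n → ∃[ x ] (x < n × u x ≡ τ)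
  injective⇒surjective n u u< inj τ τ<n with anyUpTo? (λ x → u x ≟ τ) n
  ... | yes found = found
  ... | no ¬found = contradiction (begin-strict
      count (λ _ → true) n          ≤⟨ count-injection _ _ n n u
        (λ x x<n _ → u< x x<n , cong not (≢⇒≡ᵇ-false λ eq → ¬found (x , x<n , eq)))
        (λ x y x<n y<n _ _ → inj x y x<n y<n) ⟩
      count (λ x → not (x ≡ᵇ τ)) n <⟨ ≤-refl ⟩
      suc (count (λ x → not (x ≡ᵇ τ)) n) ≡⟨ count-remove (λ _ → true) n τ τ<n refl ⟨
      count (λ _ → true) n ∎) (<-irrefl refl)
    where open ≤-Reasoning

  ^-distribʳ-* : ∀ k a b → (a * b) ^ k ≡ a ^ k * b ^ k
  ^-distribʳ-* zero    a b = refl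
  ^-distribʳ-* (suc k) a b rewrite ^-distribʳ-* k a b = lem a b (a ^ k) (b ^ k)
    where
    lem : ∀ a b c d → a * b * (c * d) ≡ a * c * (b * d)
    lem = solve-∀

  -- Sizes and weights of lists, and the pigeonhole principle.

  private variable
    α β γ : Set

  -- A relation takes the place of an injective function because the image of an element may depend
  -- on the proof that it lies in the list.
  injection⇒length≤ : ∀ {xs : List α} {ys : List β} (R : α → β → Set) → Unique xs →
    (∀ {x} → x ∈ xs → ∃[ y ] (y ∈ ys × R x y)) →
    (∀ {x x′ y} → x ∈ xs → x′ ∈ xs → R x y → R x′ y → x ≡ x′) →
    length xs ≤ length ys
  injection⇒length≤ {xs = []}     R u total inj = z≤n
  injection⇒length≤ {xs = x ∷ xs} {ys} R (x∉ ∷ u) total inj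
    with y , y∈ys , Rxy ← total (here refl)
    with zs , ws , refl ← ∈-∃++ y∈ys = begin
      suc (length xs)              ≤⟨ s≤s (injection⇒length≤ R u total′ λ p q → inj (there p) (there q)) ⟩
      suc (length (zs ++ ws))      ≡⟨ cong suc (length-++ zs) ⟩
      suc (length zs + length ws)  ≡⟨ +-suc (length zs) (length ws) ⟨
      length zs + suc (length ws)  ≡⟨ length-++ zs ⟨
      length (zs ++ y ∷ ws)        ∎
    where
    open ≤-Reasoning
    total′ : ∀ {x′} → x′ ∈ xs → ∃[ y′ ] (y′ ∈ zs ++ ws × R x′ y′)
    total′ x′∈ with total (there x′∈)
    ... | y′ , y′∈ , Rx′y′ with ∈-++⁻ zs y′∈
    ... | inj₁ p            = y′ , ∈-++⁺ˡ p , Rx′y′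
    ... | inj₂ (there p)    = y′ , ∈-++⁺ʳ zs p , Rx′y′
    ... | inj₂ (here refl)  = contradiction (inj (here refl) (there x′∈) Rxy Rx′y′) (All.lookup x∉ x′∈)

  weight : (α → ℕ) → List α → ℕ
  weight w xs = sum (map w xs)

  weight-const : ∀ (w : α → ℕ) c xs → (∀ {x} → x ∈ xs → w x ≡ c) → weight w xs ≡ length xs * c
  weight-const w c []       h = refl
  weight-const w c (x ∷ xs) h = cong₂ _+_ (h (here refl)) (weight-const w c xs (h ∘ there))

  length≡weight : ∀ (xs : List α) → length xs ≡ weight (λ _ → 1) xs
  length≡weight xs = sym (trans (weight-const _ 1 xs λ _ → refl) (*-identityʳ _))

  weight-++ : ∀ (w : α → ℕ) xs ys → weight w (xs ++ ys) ≡ weight w xs + weight w ys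
  weight-++ w xs ys = trans (cong sum (map-++ w xs ys)) (sum-++ (map w xs) (map w ys))

  weight-filter≤ : ∀ {P : α → Set} (P? : ∀ x → Dec (P x)) (w : α → ℕ) xs →
                   weight w (filter P? xs) ≤ weight w xs
  weight-filter≤ P? w []       = z≤n
  weight-filter≤ P? w (x ∷ xs) with P? x
  ... | yes _ = +-monoʳ-≤ (w x) (weight-filter≤ P? w xs)
  ... | no  _ = ≤-trans (weight-filter≤ P? w xs) (m≤n+m _ (w x))

  module _ (_≟C_ : DecidableEquality γ) (f : α → γ) where

    fibre : γ → List α → List α
    fibre c = filter (λ x → f x ≟C c)

    private
      others : γ → List α → List α
      others c = filter (λ x → ¬? (f x ≟C c))

      weight-split : ∀ (w : α → ℕ) c xs → weight w xs ≡ weight w (fibre c xs) + weight w (others c xs)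
      weight-split w c []       = refl
      weight-split w c (x ∷ xs) with f x ≟C c
      ... | yes _ = trans (cong (w x +_) (weight-split w c xs)) (sym (+-assoc (w x) _ _))
      ... | no  _ = trans (cong (w x +_) (weight-split w c xs))
                          (lem (w x) (weight w (fibre c xs)) _)
        where
        lem : ∀ a b c → a + (b + c) ≡ b + (a + c)
        lem = solve-∀

      fibre-others≤ : ∀ (w : α → ℕ) c′ c xs → weight w (fibre c′ (others c xs)) ≤ weight w (fibre c′ xs)
      fibre-others≤ w c′ c []       = z≤n
      fibre-others≤ w c′ c (x ∷ xs) with f x ≟C c
      fibre-others≤ w c′ c (x ∷ xs) | yes _ with f x ≟C c′
      ... | yes _ = ≤-trans (fibre-others≤ w c′ c xs) (m≤n+m _ (w x))
      ... | no  _ = fibre-others≤ w c′ c xs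
      fibre-others≤ w c′ c (x ∷ xs) | no _ with f x ≟C c′
      ... | yes _ = +-monoʳ-≤ (w x) (fibre-others≤ w c′ c xs)
      ... | no  _ = fibre-others≤ w c′ c xs

    -- Induction on the classes: compare the fibre of `c` with the heaviest fibre among the others
    -- and keep the heavier one. `c₀` is the answer when no class is left.
    pigeonhole : ∀ (w : α → ℕ) (c₀ : γ) cs xs → (∀ {x} → x ∈ xs → f x ∈ cs) →
                 ∃[ c ] weight w xs ≤ length cs * weight w (fibre c xs)
    pigeonhole w c₀ []       []       h = c₀ , z≤n
    pigeonhole w c₀ []       (x ∷ xs) h with () ← h (here refl)
    pigeonhole w c₀ (c ∷ cs) xs       h
      with pigeonhole w c₀ cs (others c xs) inOthers
      where
      inOthers : ∀ {x} → x ∈ others c xs → f x ∈ cs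
      inOthers x∈ with x∈xs , fx≢c ← ∈-filter⁻ (λ x → ¬? (f x ≟C c)) {xs = xs} x∈ with h x∈xs
      ... | here eq = contradiction eq fx≢c
      ... | there p = p
    ... | c′ , le with ≤-total (weight w (fibre c′ xs)) (weight w (fibre c xs))
    ... | inj₁ c′≤c = c , (begin
            weight w xs                                        ≡⟨ weight-split w c xs ⟩
            weight w (fibre c xs) + weight w (others c xs)     ≤⟨ +-monoʳ-≤ _ (≤-trans le
                (*-monoʳ-≤ (length cs) (≤-trans (fibre-others≤ w c′ c xs) c′≤c))) ⟩
            suc (length cs) * weight w (fibre c xs)            ∎)
      where open ≤-Reasoning
    ... | inj₂ c≤c′ = c′ , (begin
            weight w xs                                        ≡⟨ weight-split w c xs ⟩
            weight w (fibre c xs) + weight w (others c xs)     ≤⟨ +-mono-≤ c≤c′ (≤-trans le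
                (*-monoʳ-≤ (length cs) (fibre-others≤ w c′ c xs))) ⟩
            suc (length cs) * weight w (fibre c′ xs)           ∎)
      where open ≤-Reasoning

  weightᵛ : (α → ℕ) → ∀ {n} → Vec α n → ℕ
  weightᵛ w []       = 1
  weightᵛ w (x ∷ xs) = w x * weightᵛ w xs

  weight-cartesianProductWith : ∀ (f : α → β → γ) (w : α → ℕ) (w′ : β → ℕ) (w″ : γ → ℕ) →
    (∀ x y → w″ (f x y) ≡ w x * w′ y) → ∀ xs ys →
    weight w″ (cartesianProductWith f xs ys) ≡ weight w xs * weight w′ ys
  weight-cartesianProductWith f w w′ w″ h []       ys = refl
  weight-cartesianProductWith f w w′ w″ h (x ∷ xs) ys = begin
    weight w″ (map (f x) ys ++ cartesianProductWith f xs ys)  ≡⟨ weight-++ w″ (map (f x) ys) _ ⟩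
    weight w″ (map (f x) ys) + _ ≡⟨ cong₂ _+_ (row ys) (weight-cartesianProductWith f w w′ w″ h xs ys) ⟩
    w x * weight w′ ys + weight w xs * weight w′ ys ≡⟨ *-distribʳ-+ (weight w′ ys) (w x) (weight w xs) ⟨
    (w x + weight w xs) * weight w′ ys ∎
    where
    open ≡-Reasoning
    row : ∀ ys → weight w″ (map (f x) ys) ≡ w x * weight w′ ys
    row []       = sym (*-zeroʳ (w x))
    row (y ∷ ys) = trans (cong₂ _+_ (h x y) (row ys)) (sym (*-distribˡ-+ (w x) (w′ y) _))

  length-cartesianProductWith : ∀ (f : α → β → γ) xs ys →
    length (cartesianProductWith f xs ys) ≡ length xs * length ys
  length-cartesianProductWith f xs ys = trans (length≡weight (cartesianProductWith f xs ys)) (trans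
    (weight-cartesianProductWith f (λ _ → 1) (λ _ → 1) (λ _ → 1) (λ _ _ → refl) xs ys)
    (sym (cong₂ _*_ (length≡weight xs) (length≡weight ys))))

  weight-vectors : ∀ (w : α → ℕ) xs k → weight (weightᵛ w) (vectors xs k) ≡ weight w xs ^ k
  weight-vectors w xs zero    = refl
  weight-vectors w xs (suc k) = trans
    (weight-cartesianProductWith _∷_ w (weightᵛ w) (weightᵛ w) (λ _ _ → refl) xs (vectors xs k))
    (cong (weight w xs *_) (weight-vectors w xs k))

  length-vectors : ∀ (xs : List α) k → length (vectors xs k) ≡ length xs ^ k
  length-vectors xs zero    = refl
  length-vectors xs (suc k) = trans (length-cartesianProductWith _∷_ xs (vectors xs k))
                                    (cong (length xs *_) (length-vectors xs k))

  unique-vectors : ∀ {xs : List α} → Unique xs → ∀ k → Unique (vectors xs k)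
  unique-vectors u zero    = [] ∷ []
  unique-vectors u (suc k) = cartesianProductWith⁺ _∷_ ∷-injective u (unique-vectors u k)

  ∈-vectors⁺ : ∀ {xs : List α} {k} {v : Vec α k} → VecAll.All (_∈ xs) v → v ∈ vectors xs k
  ∈-vectors⁺ VecAll.[]       = here refl
  ∈-vectors⁺ (p VecAll.∷ ps) = ∈-cartesianProductWith⁺ _∷_ p (∈-vectors⁺ ps)

  ∈-vectors⁻ : ∀ {xs : List α} {k} {v : Vec α k} → v ∈ vectors xs k → VecAll.All (_∈ xs) v
  ∈-vectors⁻ {k = zero}  {[]}     _ = VecAll.[]
  ∈-vectors⁻ {xs = xs} {suc k} {x ∷ v} p
    with _ , _ , x∈ , v∈ , refl ← ∈-cartesianProductWith⁻ _∷_ xs (vectors xs k) p =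
    x∈ VecAll.∷ ∈-vectors⁻ v∈

  -- Time functions, and objects describing them.

  -- `u` is the inverse of the word, from letters to times. The pattern 321 is its own inverse, so
  -- avoidance keeps its form.
  record LinExt (s n : ℕ) (u : ℕ → ℕ) : Set where
    field
      bounded   : ∀ x → x < n → u x < n
      injective : InjectiveBelow n u
      spine     : ∀ x → suc x < s → suc x < n → u x < u (suc x)
      tooth     : ∀ x → x + s < n → u x < u (x + s)
      avoids    : ∀ x y z → x < y → y < z → z < n → u z < u y → ¬ (u y < u x)

  -- nothing for a P, just a for an N that is read when a P's have been read.
  Object : Set
  Object = ℕ → Maybe ℕ

  isP isN : Object → ℕ → Bool
  isP o x = is-nothing (o x)
  isN o x = not (isP o x)

  #P #N : Object → ℕ → ℕ
  #P o = count (isP o)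
  #N o = count (isN o)

  #P+#N : ∀ o x → #P o x + #N o x ≡ x
  #P+#N o = count-complement (isP o)

  -- `spine` and `mono` carry no slack: padding raises all values of a row by the same amount, so it
  -- could not repair an error in either.
  record Relaxed (s n δ : ℕ) (o : Object) : Set where
    field
      spine : ∀ x → x < s → o x ≡ nothing
      mono  : ∀ x y {a b} → x < y → y < n → o x ≡ just a → o y ≡ just b → a ≤ b
      below : ∀ x {a} → x < n → o x ≡ just a → a ≤ #P o x + δ
      above : ∀ x {a} → x + s < n → o x ≡ nothing → o (x + s) ≡ just a → suc (#P o x) ≤ a + δ

  -- Of the four colourings of a cover between x and x + s, only a P below an N needs its own
  -- condition. The others follow from `mono`, from `below`, or from the order of the P's.
  record Exact (s n : ℕ) (o : Object) : Set where
    field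
      spine : ∀ x → x < s → o x ≡ nothing
      mono  : ∀ x y {a b} → x < y → y < n → o x ≡ just a → o y ≡ just b → a ≤ b
      below : ∀ x {a} → x < n → o x ≡ just a → a < #P o x
      above : ∀ x {a} → x + s < n → o x ≡ nothing → o (x + s) ≡ just a → suc (#P o x) ≤ a

  cases : ∀ (m : Maybe ℕ) → (m ≡ nothing) ⊎ (∃[ a ] m ≡ just a)
  cases nothing  = inj₁ refl
  cases (just a) = inj₂ (a , refl)

  isP-nothing : ∀ o x → o x ≡ nothing → isP o x ≡ true
  isP-nothing o x eq rewrite eq = refl

  isN-just : ∀ o x {a} → o x ≡ just a → isN o x ≡ true
  isN-just o x eq rewrite eq = refl

  isP-just : ∀ o x {a} → o x ≡ just a → isP o x ≡ false
  isP-just o x eq rewrite eq = refl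

  -- From objects to time functions.

  readBy : Object → ℕ → ℕ → Bool
  readBy o m y with o y
  ... | nothing = false
  -- Not strict: an N with value a is read after a P's, hence before the P that has exactly a
  -- smaller P's.
  ... | just a  = a ≤ᵇ m

  ≤ᵇ-true : ∀ {m n} → m ≤ n → (m ≤ᵇ n) ≡ true
  ≤ᵇ-true {m} {n} m≤n with m ≤ᵇ n | ≤⇒≤ᵇ m≤n
  ... | true | _ = refl

  ≤ᵇ-false : ∀ {m n} → n < m → (m ≤ᵇ n) ≡ false
  ≤ᵇ-false {m} {n} n<m with m ≤ᵇ n in eq
  ... | false = refl
  ... | true  = contradiction (≤ᵇ⇒≤ m n (subst T (sym eq) _)) (<⇒≱ n<m)

  timeOf : ℕ → Object → ℕ → ℕ
  timeOf n o x with o x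
  ... | nothing = #P o x + count (readBy o (#P o x)) n
  ... | just a  = a + #N o x

  timeOf-P : ∀ n o x → o x ≡ nothing → timeOf n o x ≡ #P o x + count (readBy o (#P o x)) n
  timeOf-P n o x eq rewrite eq = refl

  timeOf-N : ∀ n o x {a} → o x ≡ just a → timeOf n o x ≡ a + #N o x
  timeOf-N n o x eq rewrite eq = refl

  readBy⇒ : ∀ o m y → readBy o m y ≡ true → ∃[ a ] (o y ≡ just a × a ≤ m)
  readBy⇒ o m y eq with o y
  ... | just a = a , refl , ≤ᵇ⇒≤ a m (subst T (sym eq) _)

  ⇒readBy : ∀ o m y {a} → o y ≡ just a → a ≤ m → readBy o m y ≡ true
  ⇒readBy o m y eq a≤m rewrite eq = ≤ᵇ-true a≤m

  count-⊆ : ∀ {Q R} n → (∀ x → x < n → Q x ≡ true → R x ≡ true) → count Q n ≤ count R n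
  count-⊆ n h = count-injection _ _ n n (λ x → x) (λ x x<n Qx → x<n , h x x<n Qx) (λ _ _ _ _ _ _ eq → eq)

  module Encode {s n : ℕ} {o : Object} (0<s : 0 < s) (E : Exact s n o) where
    open Exact E

    private
      u = timeOf n o
      read = λ x → count (readBy o (#P o x)) n

    PP : ∀ x y → x < y → o x ≡ nothing → o y ≡ nothing → u x < u y
    PP x y x<y ox oy rewrite timeOf-P n o x ox | timeOf-P n o y oy =
      +-mono-<-≤ px<py (count-⊆ n λ z _ r → let a , oz , a≤ = readBy⇒ o _ z r in
        ⇒readBy o _ z oz (≤-trans a≤ (<⇒≤ px<py)))
      where px<py = count-< (isP o) x<y (isP-nothing o x ox)

    NN : ∀ x y {a b} → x < y → y < n → o x ≡ just a → o y ≡ just b → u x < u y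
    NN x y x<y y<n ox oy rewrite timeOf-N n o x ox | timeOf-N n o y oy =
      +-mono-≤-< (mono x y x<y y<n ox oy) (count-< (isN o) x<y (isN-just o x ox))

    -- All N's up to x have values at most `a`, so all `suc (#N o x)` of them precede the P at y,
    -- whichever of x and y is the larger letter.
    NP : ∀ x y {a} → x < n → o x ≡ just a → o y ≡ nothing → a ≤ #P o y → u x < u y
    NP x y {a} x<n ox oy a≤ rewrite timeOf-N n o x ox | timeOf-P n o y oy =
      +-mono-≤-< a≤ (≤-trans (≤-reflexive (sym (count-suc (isN o) x (isN-just o x ox))))
        (count-injection _ _ (suc x) n (λ z → z) sub (λ _ _ _ _ _ _ eq → eq)))
      where
      sub : ∀ z → z < suc x → isN o z ≡ true → z < n × readBy o (#P o y) z ≡ true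
      sub z z≤x Nz with cases (o z)
      ... | inj₁ oz rewrite oz with () ← Nz
      ... | inj₂ (b , oz) = ≤-<-trans (≤-pred z≤x) x<n , ⇒readBy o _ z oz b≤
        where
        b≤ : b ≤ #P o y
        b≤ with m≤n⇒m<n∨m≡n (≤-pred z≤x)
        ... | inj₁ z<x  = ≤-trans (mono z x z<x x<n oz ox) a≤
        ... | inj₂ refl = subst (_≤ #P o y) (just-injective (trans (sym ox) oz)) a≤

    PN : ∀ x y {a} → x < n → o x ≡ just a → o y ≡ nothing → #P o y < a → u y < u x
    PN x y {a} x<n ox oy <a rewrite timeOf-N n o x ox | timeOf-P n o y oy =
      +-mono-<-≤ <a (count-injection _ _ n x (λ z → z) sub (λ _ _ _ _ _ _ eq → eq))
      where
      sub : ∀ z → z < n → readBy o (#P o y) z ≡ true → z < x × isN o z ≡ true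
      sub z z<n r with b , oz , b≤ ← readBy⇒ o _ z r with <-cmp z x
      ... | tri< z<x _ _ = z<x , isN-just o z oz
      ... | tri≈ _ refl _ with refl ← trans (sym oz) ox = contradiction <a (≤⇒≯ b≤)
      ... | tri> _ _ x<z = contradiction <a (≤⇒≯ (≤-trans (mono x z x<z z<n ox oz) b≤))

    u< : ∀ x → x < n → u x < n
    u< x x<n with cases (o x)
    ... | inj₁ ox rewrite timeOf-P n o x ox = begin-strict
        #P o x + read x ≤⟨ +-monoʳ-≤ (#P o x) (count-⊆ n λ z _ r →
                             let a , oz , _ = readBy⇒ o _ z r in isN-just o z oz) ⟩
        #P o x + #N o n <⟨ +-monoˡ-< (#N o n) (count-< (isP o) x<n (isP-nothing o x ox)) ⟩
        #P o n + #N o n ≡⟨ #P+#N o n ⟩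
        n               ∎
      where open ≤-Reasoning
    ... | inj₂ (a , ox) rewrite timeOf-N n o x ox = begin-strict
        a + #N o x      <⟨ +-monoˡ-< (#N o x) (below x x<n ox) ⟩
        #P o x + #N o x ≡⟨ #P+#N o x ⟩
        x               <⟨ x<n ⟩
        n               ∎
      where open ≤-Reasoning

    private
      u≢ : ∀ x y → x < y → y < n → u x ≢ u y
      u≢ x y x<y y<n eq with cases (o x) | cases (o y)
      ... | inj₁ ox | inj₁ oy = <⇒≢ (PP x y x<y ox oy) eq
      ... | inj₂ (_ , ox) | inj₂ (_ , oy) = <⇒≢ (NN x y x<y y<n ox oy) eq
      ... | inj₂ (a , ox) | inj₁ oy with a ≤? #P o y
      ...   | yes a≤ = <⇒≢ (NP x y (<-trans x<y y<n) ox oy a≤) eq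
      ...   | no a≰  = <⇒≢ (PN x y (<-trans x<y y<n) ox oy (≰⇒> a≰)) (sym eq)
      u≢ x y x<y y<n eq | inj₁ ox | inj₂ (b , oy) with b ≤? #P o x
      ...   | yes b≤ = <⇒≢ (NP y x y<n oy ox b≤) (sym eq)
      ...   | no b≰  = <⇒≢ (PN y x y<n oy ox (≰⇒> b≰)) eq

    linExt : LinExt s n u
    linExt = record
      { bounded   = u<
      ; injective = inj
      ; spine     = λ x sx<s sx<n → PP x (suc x) ≤-refl (spine x (<-trans ≤-refl sx<s)) (spine (suc x) sx<s)
      ; tooth     = tooth′
      ; avoids    = avoids′
      }
      where
      inj : InjectiveBelow n u
      inj x y x<n y<n eq with <-cmp x y
      ... | tri< x<y _ _ = contradiction eq (u≢ x y x<y y<n)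
      ... | tri≈ _ x≡y _ = x≡y
      ... | tri> _ _ y<x = contradiction (sym eq) (u≢ y x y<x x<n)
      tooth′ : ∀ x → x + s < n → u x < u (x + s)
      tooth′ x x+s<n with cases (o x) | cases (o (x + s))
      ... | inj₁ ox       | inj₁ oxs       = PP x (x + s) (m<m+n x 0<s) ox oxs
      ... | inj₁ ox       | inj₂ (_ , oxs) = PN (x + s) x x+s<n oxs ox (above x x+s<n ox oxs)
      ... | inj₂ (_ , ox) | inj₁ oxs       = NP x (x + s) x<n ox oxs
              (≤-trans (<⇒≤ (below x x<n ox)) (count-mono (isP o) (m≤m+n x s)))
        where x<n = ≤-<-trans (m≤m+n x s) x+s<n
      ... | inj₂ (_ , ox) | inj₂ (_ , oxs) = NN x (x + s) (m<m+n x 0<s) x+s<n ox oxs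
      avoids′ : ∀ x y z → x < y → y < z → z < n → u z < u y → ¬ (u y < u x)
      avoids′ x y z x<y y<z z<n zy yx with cases (o x) | cases (o y) | cases (o z)
      ... | inj₁ ox | inj₁ oy | _       = <-asym yx (PP x y x<y ox oy)
      ... | inj₁ ox | inj₂ oy | inj₁ oz = <-asym (<-trans zy yx) (PP x z (<-trans x<y y<z) ox oz)
      ... | inj₂ ox | inj₁ oy | inj₁ oz = <-asym zy (PP y z y<z oy oz)
      ... | inj₂ (_ , ox) | inj₂ (_ , oy) | _ = <-asym yx (NN x y x<y (<-trans y<z z<n) ox oy)
      ... | inj₂ (_ , ox) | inj₁ oy | inj₂ (_ , oz) = <-asym (<-trans zy yx)
          (NN x z (<-trans x<y y<z) z<n ox oz)
      ... | inj₁ ox | inj₂ (_ , oy) | inj₂ (_ , oz) = <-asym zy (NN y z y<z z<n oy oz)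

    private
      predecessor : ∀ x → 0 < #P o x → ∃[ y ] (y < x × o y ≡ nothing × suc (#P o y) ≡ #P o x)
      predecessor (suc x) 0<p with cases (o x)
      ... | inj₁ ox = x , ≤-refl , ox , sym (count-suc (isP o) x (isP-nothing o x ox))
      ... | inj₂ (_ , ox) with eq ← count-skip (isP o) x (isP-just o x ox)
        with y , y<x , oy , eq′ ← predecessor x (subst (0 <_) eq 0<p) =
          y , m<n⇒m<1+n y<x , oy , trans eq′ (sym eq)

    -- The witness is the largest P below x: it has one smaller P less than `#P o x`, so the strict
    -- bound `below` still puts x before it. Together with `P⇒no-inversion` this makes the colours
    -- visible in the times.
    N⇒inversion : ∀ x {a} → x < n → o x ≡ just a → ∃[ y ] (y < x × u x < u y)
    N⇒inversion x {a} x<n ox with a<p ← below x x<n ox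
      with y , y<x , oy , eq ← predecessor x (≤-trans (s≤s z≤n) a<p) =
      y , y<x , NP x y x<n ox oy (≤-pred (subst (a <_) (sym eq) a<p))

    P⇒no-inversion : ∀ x y → x < n → o x ≡ nothing → y < x → u y < u x
    P⇒no-inversion x y x<n ox y<x with cases (o y)
    ... | inj₁ oy       = PP y x y<x oy ox
    ... | inj₂ (_ , oy) = NP y x y<n oy ox (≤-trans (<⇒≤ (below y y<n oy)) (count-mono (isP o) (<⇒≤ y<x)))
      where y<n = <-trans y<x x<n

  module _ {s n : ℕ} (0<s : 0 < s) where

    private
      N-agree : ∀ {o o′} → Exact s n o → Exact s n o′ → (∀ x → x < n → timeOf n o x ≡ timeOf n o′ x) →
                ∀ x {a} → x < n → o x ≡ just a → o′ x ≢ nothing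
      N-agree {o} {o′} E E′ eq x x<n ox o′x with y , y<x , lt ← Encode.N⇒inversion 0<s E x x<n ox =
        <-asym lt (subst₂ _<_ (sym (eq y (<-trans y<x x<n))) (sym (eq x x<n))
          (Encode.P⇒no-inversion 0<s E′ x y x<n o′x y<x))

    -- The N's are the letters with a smaller letter read later, so the times determine the colours.
    -- The value of an N is then its time minus the number of smaller N's.
    timeOf-injective : ∀ {o o′} → Exact s n o → Exact s n o′ →
                       (∀ x → x < n → timeOf n o x ≡ timeOf n o′ x) → ∀ x → x < n → o x ≡ o′ x
    timeOf-injective {o} {o′} E E′ eq = values
      where
      tape : ∀ x → x < n → isP o x ≡ isP o′ x
      tape x x<n with cases (o x) | cases (o′ x)
      ... | inj₁ ox       | inj₁ o′x       rewrite ox | o′x = refl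
      ... | inj₂ (_ , ox) | inj₂ (_ , o′x) rewrite ox | o′x = refl
      ... | inj₁ ox       | inj₂ (_ , o′x) = contradiction ox
              (N-agree E′ E (λ y y<n → sym (eq y y<n)) x x<n o′x)
      ... | inj₂ (_ , ox) | inj₁ o′x       = contradiction o′x (N-agree E E′ eq x x<n ox)
      values : ∀ x → x < n → o x ≡ o′ x
      values x x<n with cases (o x) | cases (o′ x)
      ... | inj₁ ox       | inj₁ o′x       = trans ox (sym o′x)
      ... | inj₁ ox       | inj₂ (_ , o′x) = contradiction ox
              (N-agree E′ E (λ y y<n → sym (eq y y<n)) x x<n o′x)
      ... | inj₂ (_ , ox) | inj₁ o′x       = contradiction o′x (N-agree E E′ eq x x<n ox)
      ... | inj₂ (a , ox) | inj₂ (b , o′x) = trans ox (trans (cong just a≡b) (sym o′x))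
        where
        a≡b : a ≡ b
        a≡b = +-cancelʳ-≡ (#N o x) a b (begin
          a + #N o x     ≡⟨ timeOf-N n o x ox ⟨
          timeOf n o x   ≡⟨ eq x x<n ⟩
          timeOf n o′ x  ≡⟨ timeOf-N n o′ x o′x ⟩
          b + #N o′ x    ≡⟨ cong (b +_) (count-cong x λ y y<x → cong not (tape y (<-trans y<x x<n))) ⟨
          b + #N o x     ∎)
          where open ≡-Reasoning

  -- From time functions back to objects.

  overtaken : (ℕ → ℕ) → ℕ → Bool
  overtaken u x = does (anyUpTo? (λ y → u x <? u y) x)

  tape : (ℕ → ℕ) → ℕ → Bool
  tape u = not ∘ overtaken u

  objectOf : (ℕ → ℕ) → (ℕ → ℕ) → Object
  objectOf u w x = if overtaken u x then just (count (tape u ∘ w) (u x)) else nothing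

  record Inverses (n : ℕ) (u w : ℕ → ℕ) : Set where
    field
      w< : ∀ τ → τ < n → w τ < n
      uw : ∀ τ → τ < n → u (w τ) ≡ τ
      wu : ∀ x → x < n → w (u x) ≡ x

  overtaken⇒ : ∀ u x → overtaken u x ≡ true → ∃[ y ] (y < x × u x < u y)
  overtaken⇒ u x eq with anyUpTo? (λ y → u x <? u y) x
  ... | yes p = p

  ¬overtaken⇒ : ∀ u x → overtaken u x ≡ false → ∀ y → y < x → ¬ (u x < u y)
  ¬overtaken⇒ u x eq y y<x lt with anyUpTo? (λ y → u x <? u y) x
  ... | no ¬p = ¬p (y , y<x , lt)

  isP-objectOf : ∀ u w x → isP (objectOf u w) x ≡ tape u x
  isP-objectOf u w x with overtaken u x
  ... | true  = refl
  ... | false = refl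

  #P-objectOf : ∀ u w x → #P (objectOf u w) x ≡ count (tape u) x
  #P-objectOf u w x = count-cong x λ y _ → isP-objectOf u w y

  objectOf-N : ∀ u w x → overtaken u x ≡ true → objectOf u w x ≡ just (count (tape u ∘ w) (u x))
  objectOf-N u w x eq rewrite eq = refl

  objectOf-P : ∀ u w x → overtaken u x ≡ false → objectOf u w x ≡ nothing
  objectOf-P u w x eq rewrite eq = refl

  objectOf-just : ∀ u w x {a} → objectOf u w x ≡ just a →
                  overtaken u x ≡ true × a ≡ count (tape u ∘ w) (u x)
  objectOf-just u w x eq with overtaken u x
  ... | true = refl , sym (just-injective eq)

  objectOf-nothing : ∀ u w x → objectOf u w x ≡ nothing → overtaken u x ≡ false
  objectOf-nothing u w x eq with overtaken u x
  ... | false = refl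

  module Decode {s n : ℕ} {u w : ℕ → ℕ} (L : LinExt s n u) (I : Inverses n u w) where
    open LinExt L
    open Inverses I

    PP : ∀ x y → x < y → y < n → tape u y ≡ true → u x < u y
    PP x y x<y y<n Py with <-cmp (u x) (u y)
    ... | tri< lt _ _ = lt
    ... | tri≈ _ eq _ = contradiction (injective x y (<-trans x<y y<n) y<n eq) (<⇒≢ x<y)
    ... | tri> _ _ gt = contradiction gt (¬overtaken⇒ u y (not-injective Py) x x<y)

    -- This is where 321-avoidance enters: some z below x is read after x, so reading y before x
    -- would make z, x, y a forbidden triple.
    NN : ∀ x y → x < y → y < n → overtaken u x ≡ true → u x < u y
    NN x y x<y y<n Nx with <-cmp (u x) (u y)
    ... | tri< lt _ _ = lt
    ... | tri≈ _ eq _ = contradiction (injective x y (<-trans x<y y<n) y<n eq) (<⇒≢ x<y)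
    ... | tri> _ _ gt with z , z<x , lt ← overtaken⇒ u x Nx = contradiction lt (avoids z x y z<x x<y y<n gt)

    -- When the letters of Q are read in increasing order, `u` and `w` match those below x with the
    -- times before `u x` that carry a letter of Q.
    rank : ∀ Q → (∀ x y → x < y → y < n → Q x ≡ true → Q y ≡ true → u x < u y) →
           ∀ x → x < n → Q x ≡ true → count Q x ≡ count (Q ∘ w) (u x)
    rank Q mono x x<n Qx = ≤-antisym
      (count-injection Q (Q ∘ w) x (u x) u
        (λ y y<x Qy → mono y x y<x x<n Qy Qx , trans (cong Q (wu y (<-trans y<x x<n))) Qy)
        (λ y z y<x z<x _ _ → injective y z (<-trans y<x x<n) (<-trans z<x x<n)))
      (count-injection (Q ∘ w) Q (u x) x w
        (λ τ τ<ux Qwτ → w<x τ τ<ux Qwτ , Qwτ)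
        (λ τ σ τ< σ< _ _ eq → trans (sym (uw τ (<-trans τ< u<n)))
            (trans (cong u eq) (uw σ (<-trans σ< u<n)))))
      where
      u<n = bounded x x<n
      w<x : ∀ τ → τ < u x → Q (w τ) ≡ true → w τ < x
      w<x τ τ<ux Qwτ with <-cmp (w τ) x
      ... | tri< lt _ _ = lt
      ... | tri≈ _ eq _ = contradiction (trans (sym (uw τ (<-trans τ<ux u<n))) (cong u eq)) (<⇒≢ τ<ux)
      ... | tri> _ _ gt = contradiction (subst (u x <_) (uw τ (<-trans τ<ux u<n))
                            (mono x (w τ) gt (w< τ (<-trans τ<ux u<n)) Qx Qwτ)) (<-asym τ<ux)

    rankP : ∀ x → x < n → tape u x ≡ true → count (tape u) x ≡ count (tape u ∘ w) (u x)
    rankP = rank (tape u) λ x y x<y y<n _ → PP x y x<y y<n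

    rankN : ∀ x → x < n → overtaken u x ≡ true → count (overtaken u) x ≡ count (overtaken u ∘ w) (u x)
    rankN = rank (overtaken u) λ x y x<y y<n Nx _ → NN x y x<y y<n Nx

    tape-wu : ∀ x → x < n → tape u (w (u x)) ≡ tape u x
    tape-wu x x<n = cong (tape u) (wu x x<n)

    private
      increasing : ∀ x y → x < y → y < s → y < n → u x < u y
      increasing x (suc y) x<1+y 1+y<s 1+y<n with m≤n⇒m<n∨m≡n (≤-pred x<1+y)
      ... | inj₁ x<y  = <-trans (increasing x y x<y (<-trans ≤-refl 1+y<s) (<-trans ≤-refl 1+y<n))
                                         (spine y 1+y<s 1+y<n)
      ... | inj₂ refl = spine y 1+y<s 1+y<n

    exact : s ≤ n → Exact s n (objectOf u w)
    exact s≤n = record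
      { spine = λ x x<s → objectOf-P u w x (spine′ x x<s)
      ; mono  = mono′
      ; below = below′
      ; above = above′
      }
      where
      spine′ : ∀ x → x < s → overtaken u x ≡ false
      spine′ x x<s with overtaken u x in eq
      ... | false = refl
      ... | true with y , y<x , lt ← overtaken⇒ u x eq =
        contradiction lt (<-asym (increasing y x y<x x<s (≤-trans x<s s≤n)))
      mono′ : ∀ x y {a b} → x < y → y < n → objectOf u w x ≡ just a → objectOf u w y ≡ just b → a ≤ b
      mono′ x y x<y y<n ox oy with Nx , refl ← objectOf-just u w x ox | Ny , refl ← objectOf-just u w y oy =
        count-mono (tape u ∘ w) (<⇒≤ (NN x y x<y y<n Nx))
      below′ : ∀ x {a} → x < n → objectOf u w x ≡ just a → a < #P (objectOf u w) x
      below′ x x<n ox with Nx , refl ← objectOf-just u w x ox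
        -- The letter y read too late must be a P, since N's keep their order. It is a P below x
        -- that has not been read when x is, which gives strictness.
        with y , y<x , ux<uy ← overtaken⇒ u x Nx with overtaken u y in Ny
      ... | true  = contradiction (NN y x y<x x<n Ny) (<-asym ux<uy)
      ... | false rewrite #P-objectOf u w x = begin-strict
          count (tape u ∘ w) (u x) ≤⟨ count-mono (tape u ∘ w) (<⇒≤ ux<uy) ⟩
          count (tape u ∘ w) (u y) ≡⟨ rankP y (<-trans y<x x<n) (cong not Ny) ⟨
          count (tape u) y         <⟨ count-< (tape u) y<x (cong not Ny) ⟩
          count (tape u) x         ∎
        where open ≤-Reasoning
      above′ : ∀ x {a} → x + s < n → objectOf u w x ≡ nothing → objectOf u w (x + s) ≡ just a →
               suc (#P (objectOf u w) x) ≤ a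
      above′ x x+s<n ox oxs with Nxs , refl ← objectOf-just u w (x + s) oxs
        rewrite #P-objectOf u w x = begin-strict
          count (tape u) x               ≡⟨ rankP x x<n Px ⟩
          count (tape u ∘ w) (u x)       <⟨ count-< (tape u ∘ w) (tooth x x+s<n) (trans (tape-wu x x<n) Px) ⟩
          count (tape u ∘ w) (u (x + s)) ∎
        where
        open ≤-Reasoning
        x<n = ≤-<-trans (m≤m+n x s) x+s<n
        Px  = cong not (objectOf-nothing u w x ox)

    time-N : ∀ x → x < n → overtaken u x ≡ true →
             u x ≡ count (tape u ∘ w) (u x) + count (overtaken u) x
    time-N x x<n Nx = trans (sym (count-complement (overtaken u ∘ w) (u x)))
      (trans (cong (_+ count (tape u ∘ w) (u x)) (sym (rankN x x<n Nx))) (+-comm (count (overtaken u) x) _))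

  module _ {s n : ℕ} {u w u′ w′ : ℕ → ℕ}
           (L : LinExt s n u) (I : Inverses n u w) (L′ : LinExt s n u′) (I′ : Inverses n u′ w′) where

    private
      module D  = Decode L I
      module D′ = Decode L′ I′

    -- The number of letters below x of the colour of x equals the number of times of that colour
    -- before x is read. If x were read later in the second word, the time `u x`, which has the
    -- colour of x, would be counted once more there.
    colours⇒≮ : (∀ x → x < n → tape u x ≡ tape u′ x) →
                (∀ τ → τ < n → tape u (w τ) ≡ tape u′ (w′ τ)) →
                ∀ x → x < n → ¬ (u x < u′ x)
    colours⇒≮ labels times x x<n lt with overtaken u x in Nx
    ... | false = <-irrefl refl (begin-strict
          count (tape u) x            ≡⟨ D.rankP x x<n Px ⟩
          count (tape u ∘ w) (u x)    ≡⟨ count-cong (u x) (λ τ τ< → times τ (<-trans τ< u<n)) ⟩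
          count (tape u′ ∘ w′) (u x)  <⟨ count-< (tape u′ ∘ w′) lt
            (trans (sym (times (u x) u<n)) (trans (D.tape-wu x x<n) Px)) ⟩
          count (tape u′ ∘ w′) (u′ x) ≡⟨ D′.rankP x x<n (trans (sym (labels x x<n)) Px) ⟨
          count (tape u′) x           ≡⟨ count-cong x (λ y y<x → labels y (<-trans y<x x<n)) ⟨
          count (tape u) x            ∎)
      where
      open ≤-Reasoning
      u<n = LinExt.bounded L x x<n
      Px = cong not Nx
    ... | true  = <-irrefl refl (begin-strict
          count (overtaken u) x            ≡⟨ D.rankN x x<n Nx ⟩
          count (overtaken u ∘ w) (u x)    ≡⟨ count-cong (u x)
              (λ τ τ< → not-injective (times τ (<-trans τ< u<n))) ⟩
          count (overtaken u′ ∘ w′) (u x)  <⟨ count-< (overtaken u′ ∘ w′) lt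
            (trans (not-injective (sym (times (u x) u<n))) (trans (not-injective (D.tape-wu x x<n)) Nx)) ⟩
          count (overtaken u′ ∘ w′) (u′ x) ≡⟨ D′.rankN x x<n (trans (not-injective (sym (labels x x<n))) Nx) ⟨
          count (overtaken u′) x           ≡⟨ count-cong x
              (λ y y<x → not-injective (labels y (<-trans y<x x<n))) ⟨
          count (overtaken u) x            ∎)
      where
      open ≤-Reasoning
      u<n = LinExt.bounded L x x<n

  module _ {s n : ℕ} {u w u′ w′ : ℕ → ℕ}
           (L : LinExt s n u) (I : Inverses n u w) (L′ : LinExt s n u′) (I′ : Inverses n u′ w′) where

    private
      module D  = Decode L I
      module D′ = Decode L′ I′

    colours-determine : (∀ x → x < n → tape u x ≡ tape u′ x) →
                        (∀ τ → τ < n → tape u (w τ) ≡ tape u′ (w′ τ)) →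
                        ∀ x → x < n → u x ≡ u′ x
    colours-determine labels times x x<n with <-cmp (u x) (u′ x)
    ... | tri< lt _ _ = contradiction lt (colours⇒≮ L I L′ I′ labels times x x<n)
    ... | tri≈ _ eq _ = eq
    ... | tri> _ _ gt = contradiction gt (colours⇒≮ L′ I′ L I
            (λ y y<n → sym (labels y y<n)) (λ τ τ<n → sym (times τ τ<n)) x x<n)

    -- By `time-N` the objects fix the times of the N's. All remaining times belong to P's, so the
    -- colours by time agree and `colours-determine` applies.
    objectOf-injective : (∀ x → x < n → objectOf u w x ≡ objectOf u′ w′ x) → ∀ x → x < n → u x ≡ u′ x
    objectOf-injective eq = colours-determine labels times
      where
      labels : ∀ x → x < n → tape u x ≡ tape u′ x
      labels x x<n = trans (sym (isP-objectOf u w x))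
          (trans (cong is-nothing (eq x x<n)) (isP-objectOf u′ w′ x))
      N-times : ∀ x → x < n → overtaken u x ≡ true → u x ≡ u′ x
      N-times x x<n Nx with N′x ← trans (not-injective (sym (labels x x<n))) Nx = begin
        u x                                             ≡⟨ D.time-N x x<n Nx ⟩
        count (tape u ∘ w) (u x) + count (overtaken u) x ≡⟨ cong₂ _+_
            (just-injective (trans (sym (objectOf-N u w x Nx)) (trans (eq x x<n) (objectOf-N u′ w′ x N′x))))
            (count-cong x λ y y<x → not-injective (labels y (<-trans y<x x<n))) ⟩
        _                                               ≡⟨ D′.time-N x x<n N′x ⟨
        u′ x                                            ∎
        where open ≡-Reasoning
      times : ∀ τ → τ < n → tape u (w τ) ≡ tape u′ (w′ τ)
      times τ τ<n with overtaken u (w τ) in N | overtaken u′ (w′ τ) in N′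
      ... | true  | true  = refl
      ... | false | false = refl
      ... | true  | false = contradiction (trans (sym N) (trans (cong (overtaken u) same)
               (trans (not-injective (labels (w′ τ) (Inverses.w< I′ τ τ<n))) N′))) λ ()
        where
        same : w τ ≡ w′ τ
        same = trans (sym (Inverses.wu I′ (w τ) (Inverses.w< I τ τ<n)))
          (cong w′ (trans (sym (N-times (w τ) (Inverses.w< I τ τ<n) N)) (Inverses.uw I τ τ<n)))
      ... | false | true  = contradiction (trans (sym N′) (trans (cong (overtaken u′) (sym same))
               (trans (not-injective (sym (labels (w τ) (Inverses.w< I τ τ<n)))) N))) λ ()
        where
        Nw′ : overtaken u (w′ τ) ≡ true
        Nw′ = trans (not-injective (labels (w′ τ) (Inverses.w< I′ τ τ<n))) N′
        same : w τ ≡ w′ τ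
        same = trans (cong w (trans (sym (Inverses.uw I′ τ τ<n))
            (sym (N-times (w′ τ) (Inverses.w< I′ τ τ<n) Nw′))))
                     (Inverses.wu I (w′ τ) (Inverses.w< I′ τ τ<n))

  -- Words in the sense of the theorem and their time functions.

  extensions : ∀ s t → List (Word (s * t))
  extensions s t = filter (λ w → isLinearExtension? (Kᵅ s t) w ×-dec avoids321? w) (words (s * t))

  letter : ∀ {n} → Word n → ℕ → ℕ
  letter {n} v τ with τ <? n
  ... | yes p = toℕ (lookup v (fromℕ< p))
  ... | no _  = 0

  letter-toℕ : ∀ {n} (v : Word n) i → letter v (toℕ i) ≡ toℕ (lookup v i)
  letter-toℕ {n} v i with toℕ i <? n
  ... | yes p = cong (λ j → toℕ (lookup v j)) (fromℕ<-toℕ i p)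
  ... | no ¬p = contradiction (toℕ<n i) ¬p

  letter-< : ∀ {n} (v : Word n) {τ} (τ<n : τ < n) → letter v τ ≡ toℕ (lookup v (fromℕ< τ<n))
  letter-< v τ<n = trans (cong (letter v) (sym (toℕ-fromℕ< τ<n))) (letter-toℕ v (fromℕ< τ<n))

  letter-ext : ∀ {n} (v v′ : Word n) → (∀ τ → τ < n → letter v τ ≡ letter v′ τ) → v ≡ v′
  letter-ext v v′ h = trans (sym (tabulate∘lookup v)) (trans
    (tabulate-cong λ i → toℕ-injective (trans (sym (letter-toℕ v i))
      (trans (h (toℕ i) (toℕ<n i)) (letter-toℕ v′ i))))
    (tabulate∘lookup v′))

  position : ∀ {n} → Word n → ℕ → ℕ
  position {n} v x with anyUpTo? (λ τ → letter v τ ≟ x) n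
  ... | yes (τ , _) = τ
  ... | no _        = 0

  module FromWord {s t : ℕ} {v : Word (s * t)} (v∈ : v ∈ extensions s t) where

    private
      n = s * t
      u = position v
      w = letter v
      valid = proj₂ (∈-filter⁻ (λ w → isLinearExtension? (Kᵅ s t) w ×-dec avoids321? w) {xs = words n} v∈)
      open IsLinearExtension (proj₁ valid)

      w< : ∀ τ → τ < n → w τ < n
      w< τ τ<n = subst (_< n) (sym (letter-< v τ<n)) (toℕ<n _)

      w-injective : InjectiveBelow n w
      w-injective τ σ τ<n σ<n eq = trans (sym (toℕ-fromℕ< τ<n)) (trans (cong toℕ
        (lookup-injective isPermutation (fromℕ< τ<n) (fromℕ< σ<n)
          (toℕ-injective (trans (sym (letter-< v τ<n)) (trans eq (letter-< v σ<n))))))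
        (toℕ-fromℕ< σ<n))

      found : ∀ x → x < n → u x < n × w (u x) ≡ x
      found x x<n with anyUpTo? (λ τ → letter v τ ≟ x) n
      ... | yes (τ , τ<n , eq) = τ<n , eq
      ... | no ¬p = contradiction (injective⇒surjective n w w< w-injective x x<n) ¬p

      u-letter : ∀ i → u (toℕ (lookup v i)) ≡ toℕ i
      u-letter i with u<n , wu ← found _ (toℕ<n (lookup v i)) =
        w-injective _ _ u<n (toℕ<n i) (trans wu (sym (letter-toℕ v i)))

      precedes⇒< : ∀ x y → Precedes v x y → u (toℕ x) < u (toℕ y)
      precedes⇒< x y (i , j , i<j , refl , refl) = subst₂ _<_ (sym (u-letter i)) (sym (u-letter j)) i<j

      covers⇒< : ∀ x y → (x<n : x < n) (y<n : y < n) → Kᵅ-cover s t (fromℕ< x<n) (fromℕ< y<n) → u x < u y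
      covers⇒< x y x<n y<n c = subst₂ _<_ (cong u (toℕ-fromℕ< x<n)) (cong u (toℕ-fromℕ< y<n))
        (precedes⇒< _ _ (respects _ _ [ c ]))

    inverses : Inverses n u w
    inverses = record
      { w< = w<
      ; uw = λ τ τ<n → w-injective _ _ (proj₁ (found _ (w< τ τ<n))) τ<n (proj₂ (found _ (w< τ τ<n)))
      ; wu = λ x x<n → proj₂ (found x x<n)
      }

    linExt : LinExt s n u
    linExt = record
      { bounded   = λ x x<n → proj₁ (found x x<n)
      ; injective = λ x y x<n y<n eq → trans (sym (proj₂ (found x x<n)))
          (trans (cong w eq) (proj₂ (found y y<n)))
      ; spine     = λ x 1+x<s 1+x<n → let x<n = <-trans ≤-refl 1+x<n in
          covers⇒< x (suc x) x<n 1+x<n (inj₁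
            ( subst (λ z → suc z < s) (sym (toℕ-fromℕ< x<n)) 1+x<s
            , trans (toℕ-fromℕ< 1+x<n) (cong suc (sym (toℕ-fromℕ< x<n)))))
      ; tooth     = λ x x+s<n → let x<n = ≤-<-trans (m≤m+n x s) x+s<n in
          covers⇒< x (x + s) x<n x+s<n (inj₂ (trans (toℕ-fromℕ< x+s<n) (cong (_+ s) (sym (toℕ-fromℕ< x<n)))))
      ; avoids    = λ x y z x<y y<z z<n zy yx →
          let y<n = <-trans y<z z<n ; x<n = <-trans x<y y<n
              at : ∀ {a} (a<n : a < n) → toℕ (lookup v (fromℕ< (proj₁ (found a a<n)))) ≡ a
              at a<n = trans (sym (letter-< v (proj₁ (found _ a<n)))) (proj₂ (found _ a<n))
          in proj₂ valid (fromℕ< (proj₁ (found z z<n)) , fromℕ< (proj₁ (found y y<n)) , fromℕ<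
                  (proj₁ (found x x<n)) ,
               subst₂ _<_ (sym (toℕ-fromℕ< _)) (sym (toℕ-fromℕ< _)) zy ,
               subst₂ _<_ (sym (toℕ-fromℕ< _)) (sym (toℕ-fromℕ< _)) yx ,
               subst₂ _<_ (sym (at x<n)) (sym (at y<n)) x<y ,
               subst₂ _<_ (sym (at y<n)) (sym (at z<n)) y<z)
      }

    object : Object
    object = objectOf u w

  position-injective : ∀ {s t} {v v′ : Word (s * t)} → v ∈ extensions s t → v′ ∈ extensions s t →
    (∀ x → x < s * t → position v x ≡ position v′ x) → v ≡ v′
  position-injective {s} {t} {v} {v′} v∈ v′∈ eq = letter-ext v v′ λ τ τ<n → begin
      letter v τ                            ≡⟨ wu I′ _ (w< I τ τ<n) ⟨
      letter v′ (position v′ (letter v τ))  ≡⟨ cong (letter v′) (trans (sym (eq _ (w< I τ τ<n))) (uw I τ τ<n))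
          ⟩
      letter v′ τ                           ∎
    where
    open ≡-Reasoning
    open Inverses
    I  = FromWord.inverses {s} {t} v∈
    I′ = FromWord.inverses {s} {t} v′∈

  unique-extensions : ∀ s t → Unique (extensions s t)
  unique-extensions s t = filter⁺ _ (unique-vectors (allFin⁺ _) _)

  Spells : ∀ {n} → (ℕ → ℕ) → Word n → Set
  Spells {n} u v = ∀ x → x < n → letter v (u x) ≡ x

  spell : ∀ s t u → LinExt s (s * t) u → ∃[ v ] (v ∈ extensions s t × Spells u v)
  spell s t u L = v , ∈-filter⁺ _ v∈words (mkLinearExtension unique respects′ , avoids′) , spells
    where
    open LinExt L
    n = s * t
    inv = injective⇒surjective n u bounded injective
    w′ : Fin n → Fin n
    w′ i = fromℕ< (proj₁ (proj₂ (inv (toℕ i) (toℕ<n i))))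
    uw : ∀ i → u (toℕ (w′ i)) ≡ toℕ i
    uw i = trans (cong u (toℕ-fromℕ< _)) (proj₂ (proj₂ (inv (toℕ i) (toℕ<n i))))
    v = tabulate w′
    w′-injective : ∀ {i j} → w′ i ≡ w′ j → i ≡ j
    w′-injective {i} {j} eq = toℕ-injective (trans (sym (uw i)) (trans (cong (λ k → u (toℕ k)) eq) (uw j)))
    unique = tabulate⁺ w′-injective
    v∈words = ∈-vectors⁺ (VecAll.tabulate⁺ λ i → ∈-allFin (w′ i))
    time : Fin n → Fin n
    time a = fromℕ< (bounded (toℕ a) (toℕ<n a))
    lookup-time : ∀ a → lookup v (time a) ≡ a
    lookup-time a = trans (lookup∘tabulate w′ (time a)) (toℕ-injective
      (injective _ _ (toℕ<n _) (toℕ<n a) (trans (uw (time a)) (toℕ-fromℕ< _))))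
    cover⇒< : ∀ {x y} → Kᵅ-cover s t x y → u (toℕ x) < u (toℕ y)
    cover⇒< {x} {y} (inj₁ (1+x<s , eq)) = subst (λ z → u (toℕ x) < u z) (sym eq)
      (spine (toℕ x) 1+x<s (subst (_< n) eq (toℕ<n y)))
    cover⇒< {x} {y} (inj₂ eq) = subst (λ z → u (toℕ x) < u z) (sym eq)
      (tooth (toℕ x) (subst (_< n) eq (toℕ<n y)))
    closure⇒< : ∀ {x y} → TransClosure (Kᵅ-cover s t) x y → u (toℕ x) < u (toℕ y)
    closure⇒< [ c ]    = cover⇒< c
    closure⇒< (c ∷ cs) = <-trans (cover⇒< c) (closure⇒< cs)
    respects′ : ∀ x y → TransClosure (Kᵅ-cover s t) x y → Precedes v x y
    respects′ x y c = time x , time y ,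
      subst₂ _<_ (sym (toℕ-fromℕ< _)) (sym (toℕ-fromℕ< _)) (closure⇒< c) , lookup-time x , lookup-time y
    u-lookup : ∀ i → u (toℕ (lookup v i)) ≡ toℕ i
    u-lookup i = trans (cong (λ a → u (toℕ a)) (lookup∘tabulate w′ i)) (uw i)
    avoids′ : Avoids321 v
    avoids′ (i , j , k , i<j , j<k , kj , ji) = avoids _ _ _ kj ji (toℕ<n (lookup v i))
      (subst₂ _<_ (sym (u-lookup i)) (sym (u-lookup j)) i<j)
          (subst₂ _<_ (sym (u-lookup j)) (sym (u-lookup k)) j<k)
    spells : Spells u v
    spells x x<n = trans (cong (letter v) (sym eq)) (trans (letter-toℕ v (time (fromℕ< x<n)))
      (trans (cong toℕ (lookup-time (fromℕ< x<n))) (toℕ-fromℕ< x<n)))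
      where
      eq : toℕ (time (fromℕ< x<n)) ≡ u x
      eq = trans (toℕ-fromℕ< _) (cong u (toℕ-fromℕ< x<n))

  spells-injective : ∀ {s t u u′} {v : Word (s * t)} → v ∈ extensions s t →
    LinExt s (s * t) u → LinExt s (s * t) u′ → Spells u v → Spells u′ v →
    ∀ x → x < s * t → u x ≡ u′ x
  spells-injective {s} {t} {u} {u′} {v} v∈ L L′ S S′ x x<n = begin
      u x                     ≡⟨ uw (u x) (LinExt.bounded L x x<n) ⟨
      position v (letter v (u x)) ≡⟨ cong (position v) (trans (S x x<n) (sym (S′ x x<n))) ⟩
      position v (letter v (u′ x)) ≡⟨ uw (u′ x) (LinExt.bounded L′ x x<n) ⟩
      u′ x                    ∎
    where
    open ≡-Reasoning
    open Inverses (FromWord.inverses {s} {t} v∈)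

  -- Row and column arithmetic.

  module _ (d : ℕ) .{{_ : NonZero d}} where

    quotient-unique : ∀ j {r} → r < d → (j * d + r) / d ≡ j
    quotient-unique j {r} r<d = begin
      (j * d + r) / d    ≡⟨ +-distrib-/-∣ˡ r (divides-refl j) ⟩
      j * d / d + r / d  ≡⟨ cong₂ _+_ (m*n/n≡m j d) (m<n⇒m/n≡0 r<d) ⟩
      j + 0              ≡⟨ +-identityʳ j ⟩
      j                  ∎
      where open ≡-Reasoning

    remainder-unique : ∀ j {r} → r < d → (j * d + r) % d ≡ r
    remainder-unique j {r} r<d = trans (cong (_% d) (+-comm (j * d) r))
      (trans ([m+kn]%n≡m%n r j d) (m<n⇒m%n≡m r<d))

    division : ∀ x → ∃[ j ] ∃[ r ] (r < d × x ≡ j * d + r)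
    division x = x / d , x % d , m%n<n x d , trans (m≡m%n+[m/n]*n x d) (+-comm (x % d) _)

  <-next-multiple : ∀ m d .{{_ : NonZero d}} → m < suc (m / d) * d
  <-next-multiple m d = subst (_< suc (m / d) * d) (sym (m≡m%n+[m/n]*n m d)) (+-monoˡ-< _ (m%n<n m d))

  lex-< : ∀ {d j k r q} → q < d → j * d + r < k * d + q → j < k ⊎ (j ≡ k × r < q)
  lex-< {d} {j} {k} {r} {q} q<d lt with <-cmp j k
  ... | tri< j<k _ _  = inj₁ j<k
  ... | tri≈ _ refl _ = inj₂ (refl , +-cancelˡ-< (j * d) r q lt)
  ... | tri> _ _ k<j  = contradiction lt (≤⇒≯ (begin
      k * d + q  ≤⟨ +-monoʳ-≤ (k * d) (<⇒≤ q<d) ⟩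
      k * d + d  ≡⟨ +-comm (k * d) d ⟩
      suc k * d  ≤⟨ *-monoˡ-≤ d k<j ⟩
      j * d      ≤⟨ m≤m+n (j * d) r ⟩
      j * d + r  ∎))
    where open ≤-Reasoning

  lex-row : ∀ {d j t r} → j * d + r < d * t → j < t
  lex-row {d} {j} {t} {r} lt = *-cancelˡ-< d j t (≤-<-trans
    (≤-trans (≤-reflexive (*-comm d j)) (m≤m+n (j * d) r)) lt)

  row-lex : ∀ {d j t r} → j < t → r < d → j * d + r < d * t
  row-lex {d} {j} {t} {r} j<t r<d = begin-strict
    j * d + r  <⟨ +-monoʳ-< (j * d) r<d ⟩
    j * d + d  ≡⟨ +-comm (j * d) d ⟩
    suc j * d  ≤⟨ *-monoˡ-≤ d j<t ⟩
    t * d      ≡⟨ *-comm t d ⟩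
    d * t      ∎
    where open ≤-Reasoning

  -- Padding: from relaxed to exact objects.

  module Pad (s g δ : ℕ) (o : Object) where

    f = suc g
    s′ = f + s

    -- A letter of row j gains (j + 1) f smaller P's, and the letter covered by it in the preceding
    -- row gains j f. So the raise must be at least j f + δ for `above` and less than (j + 1) f - δ
    -- for `below`; the first of these is chosen, and f > 2 δ makes it satisfy the second.
    row : ℕ → ℕ → Maybe ℕ
    row j r with r <? f
    ... | yes _ = nothing
    ... | no _  = Maybe.map (_+ (j * f + δ)) (o (j * s + (r ∸ f)))

    pad : Object
    pad x = row (x / s′) (x % s′)

    pad-row : ∀ j {r} → r < s′ → pad (j * s′ + r) ≡ row j r
    pad-row j r<s′ = cong₂ row (quotient-unique s′ j r<s′) (remainder-unique s′ j r<s′)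

    row-new : ∀ j {r} → r < f → row j r ≡ nothing
    row-new j {r} r<f with r <? f
    ... | yes _  = refl
    ... | no ¬p = contradiction r<f ¬p

    row-old : ∀ j r → row j (f + r) ≡ Maybe.map (_+ (j * f + δ)) (o (j * s + r))
    row-old j r with f + r <? f
    ... | yes p = contradiction p (≤⇒≯ (m≤m+n f r))
    ... | no _  = cong (λ z → Maybe.map (_+ (j * f + δ)) (o (j * s + z))) (m+n∸m≡n f r)

    pad-new : ∀ j {r} → r < f → pad (j * s′ + r) ≡ nothing
    pad-new j r<f = trans (pad-row j (m≤n⇒m≤n+o s r<f)) (row-new j r<f)

    pad-old : ∀ j {r} → r < s → pad (j * s′ + (f + r)) ≡ Maybe.map (_+ (j * f + δ)) (o (j * s + r))
    pad-old j {r} r<s = trans (pad-row j (+-monoʳ-< f r<s)) (row-old j r)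

    isP-map : ∀ {c} m → is-nothing (Maybe.map (_+ c) m) ≡ is-nothing m
    isP-map nothing  = refl
    isP-map (just _) = refl

    #P-old : ∀ j r → r ≤ s → #P pad (j * s′ + (f + r)) ≡ #P o (j * s + r) + suc j * f

    #P-start : ∀ j → #P pad (j * s′) ≡ #P o (j * s) + j * f
    #P-start zero    = refl
    #P-start (suc j) = begin
      #P pad (s′ + j * s′)            ≡⟨ cong (#P pad) (+-comm s′ (j * s′)) ⟩
      #P pad (j * s′ + (f + s))       ≡⟨ #P-old j s ≤-refl ⟩
      #P o (j * s + s) + suc j * f    ≡⟨ cong (λ z → #P o z + suc j * f) (+-comm (j * s) s) ⟩
      #P o (suc j * s) + suc j * f    ∎
      where open ≡-Reasoning

    #P-old j r r≤s = begin
      #P pad (j * s′ + (f + r))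
        ≡⟨ ∑-split (𝟙 ∘ isP pad) (j * s′) (f + r) ⟩
      #P pad (j * s′) + count (isP pad ∘ (j * s′ +_)) (f + r)
        ≡⟨ cong₂ _+_ (#P-start j) (∑-split (𝟙 ∘ isP pad ∘ (j * s′ +_)) f r) ⟩
      #P o (j * s) + j * f + (count (isP pad ∘ (j * s′ +_)) f + count (isP pad ∘ (j * s′ +_) ∘ (f +_)) r)
        ≡⟨ cong (#P o (j * s) + j * f +_) (cong₂ _+_
             (count-all f λ x x<f → isP-nothing pad (j * s′ + x) (pad-new j x<f))
             (count-cong r λ x x<r → trans (cong is-nothing (pad-old j (<-≤-trans x<r r≤s)))
                                           (isP-map (o (j * s + x))))) ⟩
      #P o (j * s) + j * f + (f + count (isP o ∘ (j * s +_)) r)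
        ≡⟨ lem (#P o (j * s)) (j * f) f _ ⟩
      #P o (j * s) + count (isP o ∘ (j * s +_)) r + (f + j * f)
        ≡⟨ cong (_+ suc j * f) (∑-split (𝟙 ∘ isP o) (j * s) r) ⟨
      #P o (j * s + r) + suc j * f ∎
      where
      open ≡-Reasoning
      lem : ∀ a b c d → a + b + (c + d) ≡ a + d + (c + b)
      lem = solve-∀

    data At (x : ℕ) : Set where
      new : ∀ j r → r < f → x ≡ j * s′ + r → At x
      old : ∀ j r → r < s → x ≡ j * s′ + (f + r) → At x

    at : ∀ x → At x
    at x with j , r , r<s′ , eq ← division s′ x with r <? f
    ... | yes r<f = new j r r<f eq
    ... | no r≮f = old j (r ∸ f) (+-cancelˡ-< f _ s (subst (_< s′) (sym eq′) r<s′))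
        (trans eq (cong (j * s′ +_) (sym eq′)))
      where eq′ = m+[n∸m]≡n (≮⇒≥ r≮f)

    map-just : ∀ {c a} m → Maybe.map (_+ c) m ≡ just a → ∃[ b ] (m ≡ just b × a ≡ b + c)
    map-just (just b) refl = b , refl , refl

    map-nothing : ∀ {c} m → Maybe.map (_+ c) m ≡ nothing → m ≡ nothing
    map-nothing nothing refl = refl

    pad-just : ∀ x {a} → pad x ≡ just a → ∃[ j ] ∃[ r ] ∃[ b ]
      (r < s × x ≡ j * s′ + (f + r) × o (j * s + r) ≡ just b × a ≡ b + (j * f + δ))
    pad-just x eq with at x
    ... | new j r r<f refl with () ← trans (sym eq) (pad-new j r<f)
    ... | old j r r<s refl with b , ob , refl ← map-just (o (j * s + r)) (trans (sym (pad-old j r<s)) eq) =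
      j , r , b , r<s , refl , ob , refl

    shift : ∀ d j r → j * d + r + d ≡ suc j * d + r
    shift d j r = trans (+-comm _ d) (sym (+-assoc d (j * d) r))

    pad-exact : ∀ {t} → δ + δ ≤ g → Relaxed s (s * t) δ o → Exact s′ (s′ * t) pad
    pad-exact {t} 2δ≤g R = record { spine = spine′ ; mono = mono′ ; below = below′ ; above = above′ }
      where
      open Relaxed R
      inside : ∀ j {r} → r < s → j * s′ + (f + r) < s′ * t → j * s + r < s * t
      inside j {r} r<s lt = row-lex (lex-row {s′} {j} {t} {f + r} lt) r<s
      spine′ : ∀ x → x < s′ → pad x ≡ nothing
      spine′ x x<s′ with pad x in eq
      ... | nothing = refl
      ... | just a with pad-just x eq
      ...   | zero  , r , b , r<s , refl , ob , refl = contradiction (trans (sym ob) (spine r r<s)) λ ()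
      ...   | suc j , r , b , r<s , refl , ob , refl =
          contradiction x<s′ (≤⇒≯ (≤-trans (m≤m+n s′ (j * s′)) (m≤m+n _ (f + r))))
      mono′ : ∀ x y {a b} → x < y → y < s′ * t → pad x ≡ just a → pad y ≡ just b → a ≤ b
      mono′ x y x<y y<n ox oy
        with j , r , a , r<s , refl , oa , refl ← pad-just x ox
        with k , q , b , q<s , refl , ob , refl ← pad-just y oy
        with lex-< {s′} {j} {k} (+-monoʳ-< f q<s) x<y
      ... | inj₁ j<k = +-mono-≤ (mono _ _ (<-≤-trans (+-monoʳ-< (j * s) r<s)
              (≤-trans (≤-trans (≤-reflexive (+-comm (j * s) s)) (*-monoˡ-≤ s j<k)) (m≤m+n (k * s) q)))
              (inside k q<s y<n) oa ob) (+-monoˡ-≤ δ (*-monoˡ-≤ f (<⇒≤ j<k)))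
      ... | inj₂ (refl , lt) = +-monoˡ-≤ (j * f + δ) (mono _ _
              (+-monoʳ-< (j * s) (+-cancelˡ-< f r q lt)) (inside k q<s y<n) oa ob)
      below′ : ∀ x {a} → x < s′ * t → pad x ≡ just a → a < #P pad x
      below′ x x<n ox with j , r , a , r<s , refl , oa , refl ← pad-just x ox = begin-strict
          a + (j * f + δ)                      ≤⟨ +-monoˡ-≤ (j * f + δ) (below _ (inside j r<s x<n) oa) ⟩
          #P o (j * s + r) + δ + (j * f + δ)   ≡⟨ lem (#P o (j * s + r)) δ (j * f) ⟩
          #P o (j * s + r) + (δ + δ + j * f)   <⟨ +-monoʳ-< _ (+-monoˡ-< (j * f) (s≤s 2δ≤g)) ⟩
          #P o (j * s + r) + (f + j * f)       ≡⟨ #P-old j r (<⇒≤ r<s) ⟨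
          #P pad (j * s′ + (f + r))            ∎
        where
        open ≤-Reasoning
        lem : ∀ a b c → a + b + (c + b) ≡ a + (b + b + c)
        lem = solve-∀
      above′ : ∀ x {a} → x + s′ < s′ * t → pad x ≡ nothing → pad (x + s′) ≡ just a → suc (#P pad x) ≤ a
      above′ x {a} x+s′<n ox oxs with at x
      ... | new j r r<f refl = contradiction (trans (sym oxs) (trans
              (cong pad (shift s′ j r)) (pad-new (suc j) r<f))) λ ()
      ... | old j r r<s refl
        with b , ob , refl ← map-just (o (suc j * s + r)) (trans (sym (pad-old (suc j) r<s))
                               (trans (cong pad (sym (shift s′ j (f + r)))) oxs)) = begin
          suc (#P pad (j * s′ + (f + r)))       ≡⟨ cong suc (#P-old j r (<⇒≤ r<s)) ⟩
          suc (#P o (j * s + r)) + (suc j * f)  ≤⟨ +-monoˡ-≤ (suc j * f)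
              (above (j * s + r) (subst (_< s * t) (sym (shift s j r))
               (inside (suc j) r<s (subst (_< s′ * t) (shift s′ j (f + r)) x+s′<n)))
               (map-nothing _ (trans (sym (pad-old j r<s)) ox)) (trans (cong o (shift s j r)) ob)) ⟩
          b + δ + suc j * f                     ≡⟨ trans (+-assoc b δ _) (cong (b +_) (+-comm δ _)) ⟩
          b + (suc j * f + δ)                   ∎
        where
        open ≤-Reasoning


  open Pad using (pad; pad-exact; pad-old)

  pad-injective : ∀ s g δ {t o o′} → 0 < s →
    (∀ x → x < (suc g + s) * t → pad s g δ o x ≡ pad s g δ o′ x) → ∀ x → x < s * t → o x ≡ o′ x
  pad-injective s g δ {t} {o} {o′} 0<s eq x x<n
    with j , r , r<s , refl ← division s {{>-nonZero 0<s}} x =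
    map-+-injective (o (j * s + r)) (o′ (j * s + r)) (trans (sym (pad-old s g δ o j r<s))
      (trans (eq _ (row-lex (lex-row {s} {j} {t} {r} x<n) (+-monoʳ-< (suc g) r<s))) (pad-old s g δ o′ j r<s)))
    where
    map-+-injective : ∀ {c} (m m′ : Maybe ℕ) → Maybe.map (_+ c) m ≡ Maybe.map (_+ c) m′ → m ≡ m′
    map-+-injective     nothing  nothing  _ = refl
    map-+-injective {c} (just a) (just b) e = cong just (+-cancelʳ-≡ c a b (just-injective e))

  -- Families of objects bound the number of words from below.

  #extensions : ℕ → ℕ → ℕ
  #extensions t s = length (extensions s t)

  exact-family : ∀ {I : Set} s t → 0 < s → (is : List I) (O : I → Object) → Unique is →
    (∀ {i} → i ∈ is → Exact s (s * t) (O i)) →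
    (∀ {i j} → i ∈ is → j ∈ is → (∀ x → x < s * t → O i x ≡ O j x) → i ≡ j) →
    length is ≤ #extensions t s
  exact-family s t 0<s is O unique E inj =
    injection⇒length≤ (λ i v → v ∈ extensions s t × Spells (timeOf (s * t) (O i)) v) unique
      (λ i∈ → let v , v∈ , S = spell s t _ (lin i∈) in v , v∈ , v∈ , S)
      (λ i∈ j∈ (v∈ , S) (_ , S′) → inj i∈ j∈ (timeOf-injective 0<s (E i∈) (E j∈)
        (spells-injective {s} {t} v∈ (lin i∈) (lin j∈) S S′)))
    where
    lin : ∀ {i} → i ∈ is → LinExt s (s * t) (timeOf (s * t) (O i))
    lin i∈ = Encode.linExt 0<s (E i∈)

  relaxed-family : ∀ {I : Set} s g δ t → 0 < s → δ + δ ≤ g → (is : List I) (O : I → Object) → Unique is →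
    (∀ {i} → i ∈ is → Relaxed s (s * t) δ (O i)) →
    (∀ {i j} → i ∈ is → j ∈ is → (∀ x → x < s * t → O i x ≡ O j x) → i ≡ j) →
    length is ≤ #extensions t (suc g + s)
  relaxed-family s g δ t 0<s 2δ≤g is O unique R inj =
    exact-family (suc g + s) t (s≤s z≤n) is (λ i → pad s g δ (O i)) unique
      (λ i∈ → pad-exact s g δ _ {t} 2δ≤g (R i∈))
      (λ i∈ j∈ eq → inj i∈ j∈ (pad-injective s g δ {t} 0<s eq))

  -- Interleaving the columns of several words.

  -- Extends the values from the N's to a monotone function of all letters, so that words whose N's
  -- lie at different letters can be added and compared.
  last : Object → ℕ → ℕ
  last o zero    = 0
  last o (suc x) = maybe′ (λ a → a) (last o x) (o x)

  last-just : ∀ o x {a} → o x ≡ just a → last o (suc x) ≡ a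
  last-just o x eq rewrite eq = refl

  last-nothing : ∀ o x → o x ≡ nothing → last o (suc x) ≡ last o x
  last-nothing o x eq rewrite eq = refl

  module _ {s n : ℕ} {o : Object} (E : Exact s n o) where
    open Exact E

    last≤ : ∀ x y {a} → x ≤ y → y < n → o y ≡ just a → last o x ≤ a
    last≤ zero    y x≤y y<n oy = z≤n
    last≤ (suc x) y x<y y<n oy with cases (o x)
    ... | inj₁ ox       rewrite last-nothing o x ox = last≤ x y (<⇒≤ x<y) y<n oy
    ... | inj₂ (_ , ox) rewrite last-just o x ox    = mono x y x<y y<n ox oy

    last-step : ∀ x → x < n → last o x ≤ last o (suc x)
    last-step x x<n with cases (o x)
    ... | inj₁ ox       = ≤-reflexive (sym (last-nothing o x ox))
    ... | inj₂ (_ , ox) = ≤-trans (last≤ x x ≤-refl x<n ox) (≤-reflexive (sym (last-just o x ox)))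

    last-mono : ∀ x y → x ≤ y → y ≤ n → last o x ≤ last o y
    last-mono x y x≤y y≤n with m≤n⇒m<n∨m≡n x≤y
    ... | inj₂ refl = ≤-refl
    last-mono x (suc y) x≤y y<n | inj₁ x<1+y =
      ≤-trans (last-mono x y (≤-pred x<1+y) (<⇒≤ y<n)) (last-step y y<n)

    last≤#P : ∀ x → x ≤ n → last o x ≤ #P o x
    last≤#P zero    _   = z≤n
    last≤#P (suc x) x<n with cases (o x)
    ... | inj₁ ox       = ≤-trans (≤-reflexive (last-nothing o x ox))
                            (≤-trans (last≤#P x (<⇒≤ x<n)) (count-mono (isP o) (n≤1+n x)))
    ... | inj₂ (_ , ox) = ≤-trans (≤-reflexive (last-just o x ox))
                            (≤-trans (<⇒≤ (below x x<n ox)) (count-mono (isP o) (n≤1+n x)))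

  module Merge (k : ℕ) .{{_ : NonZero k}} (lo : ℕ → ℕ) (o : ℕ → Object) where

    -- In the x-th group all copies first jump to their common lower bound lo (suc x), since
    -- already the first N of the group has to lie above it; then they catch up one by one.
    raised : ℕ → ℕ → ℕ
    raised l x = last (o l) x ⊔ lo (suc x)

    term : ℕ → ℕ → ℕ → ℕ
    term x l l′ = if l′ ≤ᵇ l then last (o l′) (suc x) else raised l′ x

    -- Letter x of copy l becomes x * k + l. Since the numbers of P's of the copies add up
    -- (`#P-merge`), the value of a merged N has to be a sum over all copies as well, also over
    -- those with a P at x.
    value : ℕ → ℕ → ℕ
    value x l = ∑ (term x l) k

    entry : ℕ → ℕ → Maybe ℕ
    entry x l = Maybe.map (λ _ → value x l) (o l x)

    merge : Object
    merge y = entry (y / k) (y % k)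

    merge-at : ∀ x {l} → l < k → merge (x * k + l) ≡ entry x l
    merge-at x l<k = cong₂ entry (quotient-unique k x l<k) (remainder-unique k x l<k)

    merge-just-at : ∀ x {l a} → l < k → merge (x * k + l) ≡ just a →
                    ∃[ b ] (o l x ≡ just b × a ≡ value x l)
    merge-just-at x {l} l<k eq with cases (o l x)
    ... | inj₁ ol = contradiction (trans (sym (trans (merge-at x l<k) (cong (Maybe.map _) ol))) eq) λ ()
    ... | inj₂ (b , ol) = b , ol ,
          sym (just-injective (trans (sym (trans (merge-at x l<k) (cong (Maybe.map _) ol))) eq))

    merge-just : ∀ y {a} → merge y ≡ just a →
      ∃[ x ] ∃[ l ] ∃[ b ] (l < k × y ≡ x * k + l × o l x ≡ just b × a ≡ value x l)
    merge-just y eq with x , l , l<k , refl ← division k y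
      with b , ol , a≡ ← merge-just-at x l<k eq = x , l , b , l<k , refl , ol , a≡

    merge-nothing : ∀ x {l} → l < k → merge (x * k + l) ≡ nothing → o l x ≡ nothing
    merge-nothing x {l} l<k eq with cases (o l x)
    ... | inj₁ ol = ol
    ... | inj₂ (_ , ol) = contradiction (trans (sym eq) (trans (merge-at x l<k) (cong (Maybe.map _) ol))) λ ()

    #P-merge : ∀ x → #P merge (x * k) ≡ ∑ (λ l → #P (o l) x) k
    #P-merge zero    = sym (trans (∑-const 0 k) (*-zeroʳ k))
    #P-merge (suc x) = begin
      #P merge (k + x * k)        ≡⟨ cong (#P merge) (+-comm k (x * k)) ⟩
      #P merge (x * k + k)        ≡⟨ ∑-split (𝟙 ∘ isP merge) (x * k) k ⟩
      #P merge (x * k) + ∑ (𝟙 ∘ isP merge ∘ (x * k +_)) k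
        ≡⟨ cong₂ _+_ (#P-merge x) (∑-cong k λ l l<k →
             cong 𝟙 (trans (cong is-nothing (merge-at x l<k)) (isP-map (o l x)))) ⟩
      ∑ (λ l → #P (o l) x) k + ∑ (λ l → 𝟙 (isP (o l) x)) k
        ≡⟨ ∑-distrib-+ (λ l → #P (o l) x) (λ l → 𝟙 (isP (o l) x)) k ⟨
      ∑ (λ l → #P (o l) (suc x)) k ∎
      where
      open ≡-Reasoning
      isP-map : ∀ {c} (m : Maybe ℕ) → is-nothing (Maybe.map {A = ℕ} {B = ℕ} (λ _ → c) m) ≡ is-nothing m
      isP-map nothing  = refl
      isP-map (just _) = refl

  -- All copies lie in a strip of width `W` above the common profiles `lo` and `plo`; membership in
  -- one class of rounded profiles will provide this.
  record Window (n k W : ℕ) (lo plo : ℕ → ℕ) (o : ℕ → Object) : Set where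
    field
      lo≤   : ∀ l x → l < k → x ≤ n → lo x ≤ last (o l) x
      ≤lo   : ∀ l x → l < k → x ≤ n → last (o l) x ≤ lo x + W
      plo≤  : ∀ l x → l < k → x ≤ n → plo x ≤ #P (o l) x
      ≤plo  : ∀ l x → l < k → x ≤ n → #P (o l) x ≤ plo x + W

  module _ {s n k W : ℕ} .{{_ : NonZero k}} {lo plo : ℕ → ℕ} {o : ℕ → Object}
           (E : ∀ l → l < k → Exact s n (o l)) (win : Window n k W lo plo o) where
    open Merge k lo o
    open Window win

    private
      raised≤ : ∀ l x → l < k → x < n → raised l x ≤ last (o l) (suc x)
      raised≤ l x l<k x<n = ⊔-lub (last-step (E l l<k) x x<n) (lo≤ l (suc x) l<k x<n)

      term≤ : ∀ x l l′ → l′ < k → x < n → term x l l′ ≤ last (o l′) (suc x)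
      term≤ x l l′ l′<k x<n with l′ ≤ᵇ l
      ... | true  = ≤-refl
      ... | false = raised≤ l′ x l′<k x<n

      ≤term : ∀ x l l′ → l′ < k → x < n → raised l′ x ≤ term x l l′
      ≤term x l l′ l′<k x<n with l′ ≤ᵇ l
      ... | true  = raised≤ l′ x l′<k x<n
      ... | false = ≤-refl

      term-mono : ∀ x l m l′ → l ≤ m → l′ < k → x < n → term x l l′ ≤ term x m l′
      term-mono x l m l′ l≤m l′<k x<n with l′ ≤? l
      ... | yes l′≤l rewrite ≤ᵇ-true l′≤l | ≤ᵇ-true (≤-trans l′≤l l≤m) = ≤-refl
      ... | no l′≰l rewrite ≤ᵇ-false (≰⇒> l′≰l) = ≤term x m l′ l′<k x<n

      value-mono : ∀ x l y m → x < n → y < n → x < y ⊎ (x ≡ y × l < m) → value x l ≤ value y m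
      value-mono x l y m x<n y<n (inj₁ x<y) = ∑-mono k λ l′ l′<k → begin
        term x l l′          ≤⟨ term≤ x l l′ l′<k x<n ⟩
        last (o l′) (suc x)  ≤⟨ last-mono (E l′ l′<k) (suc x) y x<y (<⇒≤ y<n) ⟩
        last (o l′) y        ≤⟨ m≤m⊔n _ _ ⟩
        raised l′ y          ≤⟨ ≤term y m l′ l′<k y<n ⟩
        term y m l′          ∎
        where open ≤-Reasoning
      value-mono x l x m x<n _ (inj₂ (refl , l<m)) = ∑-mono k λ l′ l′<k → term-mono x l m l′ (<⇒≤ l<m) l′<k
          x<n

      inside : ∀ x {l} → x * k + l < n * k → x < n
      inside x {l} lt = lex-row {k} {x} {n} {l} (subst (x * k + l <_) (*-comm n k) lt)

      1≤k = >-nonZero⁻¹ k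

    -- For `below` each copy loses at most 1, the possible P at x itself. For `above` each copy
    -- loses `W` when its P's are compared with `plo` and another `W` when `plo` is compared with
    -- `lo`.
    merge-relaxed : 1 ≤ W → Relaxed (s * k) (n * k) (k * (W + W)) merge
    merge-relaxed 1≤W = record { spine = spine′ ; mono = mono′ ; below = below′ ; above = above′ }
      where
      spine′ : ∀ y → y < s * k → merge y ≡ nothing
      spine′ y y<sk with merge y in eq
      ... | nothing = refl
      ... | just a with x , l , b , l<k , refl , ol , refl ← merge-just y eq =
        contradiction (trans (sym ol) (Exact.spine (E l l<k) x
          (lex-row {k} {x} {s} {l} (subst (x * k + l <_) (*-comm s k) y<sk)))) λ ()
      mono′ : ∀ y z {a b} → y < z → z < n * k → merge y ≡ just a → merge z ≡ just b → a ≤ b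
      mono′ y z y<z z<n oy oz
        with x , l , _ , l<k , refl , _ , refl ← merge-just y oy
        with x′ , m , _ , m<k , refl , _ , refl ← merge-just z oz =
        value-mono x l x′ m (inside x (<-trans y<z z<n)) (inside x′ z<n) (lex-< {k} {x} {x′} m<k y<z)
      below′ : ∀ y {a} → y < n * k → merge y ≡ just a → a ≤ #P merge y + k * (W + W)
      below′ y y<n oy with x , l , _ , l<k , refl , _ , refl ← merge-just y oy = begin
        value x l                              ≤⟨ ∑-mono k
            (λ l′ l′<k → ≤-trans (term≤ x l l′ l′<k (inside x y<n))
                                                    (≤-trans (last≤#P (E l′ l′<k) (suc x) (inside x y<n))
                                                             (+-monoʳ-≤ (#P (o l′) x) (𝟙≤1 (isP (o l′) x)))))
                                                                 ⟩
        ∑ (λ l′ → #P (o l′) x + 1) k           ≡⟨ ∑-distrib-+ (λ l′ → #P (o l′) x) (λ _ → 1) k ⟩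
        ∑ (λ l′ → #P (o l′) x) k + ∑ (λ _ → 1) k ≡⟨ cong₂ _+_ (sym (#P-merge x)) (∑-const 1 k) ⟩
        #P merge (x * k) + k * 1               ≤⟨ +-mono-≤ (count-mono (isP merge) (m≤m+n (x * k) l))
                                                    (*-monoʳ-≤ k (≤-trans 1≤W (m≤m+n W W))) ⟩
        #P merge (x * k + l) + k * (W + W)     ∎
        where open ≤-Reasoning
      above′ : ∀ y {a} → y + s * k < n * k → merge y ≡ nothing → merge (y + s * k) ≡ just a →
               suc (#P merge y) ≤ a + k * (W + W)
      above′ y {a} y+<n oy oys with x , l , l<k , refl ← division k y = begin
          suc (#P merge (x * k + l))        ≡⟨ count-suc (isP merge) (x * k + l)
              (isP-nothing merge (x * k + l) oy) ⟨
          #P merge (suc (x * k + l))        ≤⟨ count-mono (isP merge)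
              (≤-trans (+-monoʳ-< (x * k) l<k) (≤-reflexive (+-comm (x * k) k))) ⟩
          #P merge (suc x * k)              ≡⟨ #P-merge (suc x) ⟩
          ∑ (λ l′ → #P (o l′) (suc x)) k    ≤⟨ ∑-mono k
              (λ l′ l′<k → ≤-trans (≤plo l′ (suc x) l′<k sx≤n) (+-monoˡ-≤ W plo≤lo)) ⟩
          ∑ (λ _ → lo (suc (x + s)) + W + W) k ≤⟨ ∑-mono k (λ l′ l′<k → ≤-trans (≤-reflexive (+-assoc _ W W))
                                               (+-monoˡ-≤ (W + W) (≤-trans (m≤n⊔m (last (o l′) (x + s)) _)
                                                 (≤term (x + s) l l′ l′<k xs<n)))) ⟩
          ∑ (λ l′ → term (x + s) l l′ + (W + W)) k ≡⟨ ∑-distrib-+ (term (x + s) l) (λ _ → W + W) k ⟩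
          value (x + s) l + ∑ (λ _ → W + W) k  ≡⟨ cong₂ _+_ (sym value≡) (∑-const (W + W) k) ⟩
          a + k * (W + W)                      ∎
        where
        open ≤-Reasoning
        shift : x * k + l + s * k ≡ (x + s) * k + l
        shift = lem x k l s
          where
          lem : ∀ x k l s → x * k + l + s * k ≡ (x + s) * k + l
          lem = solve-∀
        xs<n : x + s < n
        xs<n = inside (x + s) (subst (_< n * k) shift y+<n)
        sx≤n : suc x ≤ n
        sx≤n = ≤-<-trans (m≤m+n x s) xs<n
        ol = merge-nothing x l<k oy
        olxs = merge-just-at (x + s) l<k (trans (cong merge (sym shift)) oys)
        value≡ = proj₂ (proj₂ olxs)
        -- The inequality between the common profiles is taken from copy `l`, the one copy known to
        -- have a P at x and an N at x + s.
        plo≤lo : plo (suc x) ≤ lo (suc (x + s)) + W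
        plo≤lo = begin
          plo (suc x)               ≤⟨ plo≤ l (suc x) l<k sx≤n ⟩
          #P (o l) (suc x)          ≡⟨ count-suc (isP (o l)) x (isP-nothing (o l) x ol) ⟩
          suc (#P (o l) x)          ≤⟨ Exact.above (E l l<k) x xs<n ol (proj₁ (proj₂ olxs)) ⟩
          proj₁ olxs                ≡⟨ last-just (o l) (x + s) (proj₁ (proj₂ olxs)) ⟨
          last (o l) (suc (x + s))  ≤⟨ ≤lo l (suc (x + s)) l<k xs<n ⟩
          lo (suc (x + s)) + W      ∎

  module _ (n k : ℕ) .{{_ : NonZero k}} (lo : ℕ → ℕ) (o o′ : ℕ → Object)
           (eq : ∀ y → y < n * k → Merge.merge k lo o y ≡ Merge.merge k lo o′ y) where
    private
      module M  = Merge k lo o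
      module M′ = Merge k lo o′

      Same : ℕ → Set
      Same x = ∀ l → l < k → last (o l) x ≡ last (o′ l) x

      step : ∀ x → x < n → Same x → ∀ l → l ≤ k → ∀ l′ → l′ < l → o l′ x ≡ o′ l′ x
      step x x<n same (suc l) l<k l′ l′≤l with m≤n⇒m<n∨m≡n (≤-pred l′≤l)
      ... | inj₁ l′<l = step x x<n same l (<⇒≤ l<k) l′ l′<l
      ... | inj₂ refl = agree
        where
        entries : M.entry x l ≡ M′.entry x l
        entries = trans (sym (M.merge-at x l<k)) (trans (eq (x * k + l)
          (subst (x * k + l <_) (*-comm k n) (row-lex x<n l<k))) (M′.merge-at x l<k))
        others : ∀ m → m < k → m ≢ l → M.term x l m ≡ M′.term x l m
        others m m<k m≢l with <-cmp m l
        ... | tri< m<l _ _ rewrite ≤ᵇ-true (<⇒≤ m<l) | step x x<n same l (<⇒≤ l<k) m m<l | same m m<k = refl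
        ... | tri≈ _ m≡l _ = contradiction m≡l m≢l
        ... | tri> _ _ l<m rewrite ≤ᵇ-false l<m | same m m<k = refl
        agree : o l x ≡ o′ l x
        agree with o l x in ol | o′ l x in o′l | entries
        ... | nothing | nothing | _ = refl
        ... | just a  | just a′ | e = cong just (begin
              a                       ≡⟨ last-just (o l) x ol ⟨
              last (o l) (suc x)      ≡⟨ cong (λ c → if c then last (o l) (suc x) else M.raised l x) l≤l ⟨
              M.term x l l            ≡⟨ ∑-cancel k l l<k others (just-injective e) ⟩
              M′.term x l l           ≡⟨ cong (λ c → if c then last (o′ l) (suc x) else M′.raised l x) l≤l ⟩
              last (o′ l) (suc x)     ≡⟨ last-just (o′ l) x o′l ⟩
              a′                      ∎)
          where
          open ≡-Reasoning
          l≤l = ≤ᵇ-true (≤-refl {l})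

      same : ∀ x → x ≤ n → Same x
      same zero    _   l l<k = refl
      same (suc x) x<n l l<k = cong₂ (maybe′ (λ a → a)) (same x (<⇒≤ x<n) l l<k)
                                     (step x x<n (same x (<⇒≤ x<n)) k ≤-refl l l<k)

    -- Entries are recovered in increasing order of x, then of l. In the sum for copy l, the terms
    -- of smaller indices are already known and those of larger indices depend only on letters
    -- before x and on the shared `lo`. Cancelling them leaves the value of copy l.
    merge-injective : ∀ x → x < n → ∀ l → l < k → o l x ≡ o′ l x
    merge-injective x x<n l l<k = step x x<n (same x (<⇒≤ x<n)) k ≤-refl l l<k

  object : ∀ {n} → Word n → Object
  object v = objectOf (position v) (letter v)

  module _ {s t : ℕ} where

    exact-object : ∀ {v} → 0 < t → v ∈ extensions s t → Exact s (s * t) (object v)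
    exact-object 0<t v∈ = Decode.exact (FromWord.linExt {s} {t} v∈) (FromWord.inverses {s} {t} v∈)
      (m≤m*n s t {{>-nonZero 0<t}})

    object-injective : ∀ {v v′} → v ∈ extensions s t → v′ ∈ extensions s t →
      (∀ x → x < s * t → object v x ≡ object v′ x) → v ≡ v′
    object-injective v∈ v′∈ eq = position-injective {s} {t} v∈ v′∈
      (objectOf-injective (FromWord.linExt {s} {t} v∈) (FromWord.inverses {s} {t} v∈)
                          (FromWord.linExt {s} {t} v′∈) (FromWord.inverses {s} {t} v′∈) eq)

  -- Rounded profiles and approximate supermultiplicativity.

  module _ (n b : ℕ) .{{_ : NonZero b}} where

    -- For monotone g the entries are the places where g passes the multiples of b,
    -- so there are few codes, and the code determines g up to an error b.
    code : (ℕ → ℕ) → Vec ℕ (n / b)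
    code g = tabulate λ i → count (λ x → g x <ᵇ suc (toℕ i) * b) (suc n)

    codes : List (Vec ℕ (n / b))
    codes = vectors (upTo (suc (suc n))) (n / b)

    length-codes : length codes ≡ suc (suc n) ^ (n / b)
    length-codes = trans (length-vectors _ (n / b)) (cong (_^ (n / b)) (length-upTo _))

    code∈codes : ∀ g → code g ∈ codes
    code∈codes g = ∈-vectors⁺ (VecAll.tabulate⁺ λ i → ∈-upTo⁺ (s≤s (count≤ _ (suc n))))

    <ᵇ-true : ∀ {x y} → x < y → (x <ᵇ y) ≡ true
    <ᵇ-true {x} {y} x<y with x <ᵇ y | <⇒<ᵇ x<y
    ... | true | _ = refl

    -- If g x exceeded g′ x + b, some multiple of b would lie above g′ x and below g x. Then at most
    -- x arguments have g below this multiple, but at least x + 1 have g′ below it, so the codes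
    -- would differ there.
    code-close : ∀ g g′ → (∀ x y → x ≤ y → y ≤ n → g x ≤ g y) → (∀ x y → x ≤ y → y ≤ n → g′ x ≤ g′ y) →
                 (∀ x → x ≤ n → g x ≤ n) → code g ≡ code g′ → ∀ x → x ≤ n → g x ≤ g′ x + b
    code-close g g′ mono mono′ g≤n eq x x≤n = ≮⇒≥ λ far → let
        i    = g′ x / b
        θ≤   = ≤-trans (+-monoʳ-≤ b (m/n*n≤m (g′ x) b)) (≤-reflexive (+-comm b (g′ x)))
        θ<gx = ≤-<-trans θ≤ far
        -- The multiple lies below g x ≤ n, so it is one of the n / b multiples recorded in the
        -- code.
        i<V  = *-cancelʳ-< b i (n / b) (+-cancelˡ-< b _ _ (<-trans (<-≤-trans θ<gx (g≤n x x≤n))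
                 (<-next-multiple n b)))
        agree = begin
          count (λ y → g y <ᵇ suc i * b) (suc n)   ≡⟨ cong (λ j → count (λ y → g y <ᵇ suc j * b) (suc n))
              (toℕ-fromℕ< i<V) ⟨
          _                                        ≡⟨ lookup∘tabulate _ (fromℕ< i<V) ⟨
          lookup (code g) (fromℕ< i<V)             ≡⟨ cong (λ c → lookup c (fromℕ< i<V)) eq ⟩
          lookup (code g′) (fromℕ< i<V)            ≡⟨ lookup∘tabulate _ (fromℕ< i<V) ⟩
          _                                        ≡⟨ cong (λ j → count (λ y → g′ y <ᵇ suc j * b) (suc n))
              (toℕ-fromℕ< i<V) ⟩
          count (λ y → g′ y <ᵇ suc i * b) (suc n)  ∎
        few  = count-injection (λ y → g y <ᵇ suc i * b) (λ _ → true) (suc n) x (λ y → y)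
                 (λ y y≤n gy → ≰⇒> (λ x≤y → <-asym θ<gx (≤-<-trans (mono x y x≤y (≤-pred y≤n))
                   (<ᵇ⇒< (g y) _ (subst T (sym gy) _)))) , refl)
                 (λ _ _ _ _ _ _ e → e)
        many = count-injection (λ _ → true) (λ y → g′ y <ᵇ suc i * b) (suc x) (suc n) (λ y → y)
                 (λ y y≤x _ → s≤s (≤-trans (≤-pred y≤x) x≤n) ,
                   <ᵇ-true (≤-<-trans (mono′ y x (≤-pred y≤x) x≤n) (<-next-multiple (g′ x) b)))
                 (λ _ _ _ _ _ _ e → e)
      in <-irrefl refl (subst₂ _≤_ (count-all (suc x) λ _ _ → refl) (count-all x λ _ _ → refl)
           (≤-trans many (≤-trans (≤-reflexive (sym agree)) few)))
      where open ≡-Reasoning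

  module _ (s t b : ℕ) .{{_ : NonZero b}} (0<s : 0 < s) (0<t : 0 < t) where

    private
      n = s * t
      V = n / b

      Code : Set
      Code = Vec ℕ V × Vec ℕ V

      _≟C_ : DecidableEquality Code
      _≟C_ = Product.≡-dec (Vec.≡-dec _≟_) (Vec.≡-dec _≟_)

      classOf : Word n → Code
      classOf v = code n b (last (object v)) , code n b (#P (object v))

      class : Code → List (Word n)
      class c = fibre _≟C_ classOf c (extensions s t)

      ∈class : ∀ {c v} → v ∈ class c → v ∈ extensions s t × classOf v ≡ c
      ∈class {c} = ∈-filter⁻ (λ v → classOf v ≟C c) {xs = extensions s t}

      close : ∀ {c v v′} → v ∈ class c → v′ ∈ class c → ∀ x → x ≤ n →
              last (object v) x ≤ last (object v′) x + b × #P (object v) x ≤ #P (object v′) x + b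
      close {c} {v} {v′} v∈ v′∈ x x≤n =
        code-close n b (last (object v)) (last (object v′)) (last-mono E) (last-mono E′)
          (λ y y≤n → ≤-trans (last≤#P E y y≤n) (≤-trans (count≤ (isP (object v)) y) y≤n))
          (cong proj₁ eq) x x≤n ,
        code-close n b (#P (object v)) (#P (object v′)) (λ _ _ le _ → count-mono (isP (object v)) le)
            (λ _ _ le _ → count-mono (isP (object v′)) le)
          (λ y y≤n → ≤-trans (count≤ (isP (object v)) y) y≤n)
          (cong proj₂ eq) x x≤n
        where
        E  = exact-object {s} {t} 0<t (proj₁ (∈class v∈))
        E′ = exact-object {s} {t} 0<t (proj₁ (∈class v′∈))
        eq : classOf v ≡ classOf v′
        eq = trans (proj₂ (∈class v∈)) (sym (proj₂ (∈class v′∈)))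

    private module _ (k : ℕ) .{{_ : NonZero k}} (c : Code) (r : Word n) (r∈ : r ∈ class c) where

      -- Members of the class are within b of the representative `r` in both directions. Lowering
      -- its profiles by b makes them common lower bounds, and the window then has width b + b.
      lo plo : ℕ → ℕ
      lo x  = last (object r) x ∸ b
      plo x = #P (object r) x ∸ b

      copies : Vec (Word n) k → ℕ → Object
      copies v l = object (lookup v (l mod k))

      merged : Vec (Word n) k → Object
      merged v = Merge.merge k lo (copies v)

      module _ {v : Vec (Word n) k} (v∈ : v ∈ vectors (class c) k) where

        copy∈ : ∀ l → lookup v (l mod k) ∈ class c
        copy∈ l = VecAll.lookup⁺ (∈-vectors⁻ v∈) (l mod k)

        exact : ∀ l → l < k → Exact s n (copies v l)
        exact l _ = exact-object {s} {t} 0<t (proj₁ (∈class (copy∈ l)))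

        upper : ∀ {x y} → x ≤ y + b → x ≤ y ∸ b + (b + b)
        upper {x} {y} le = ≤-trans le (≤-trans (+-monoˡ-≤ b (m≤n+m∸n y b))
          (≤-reflexive (lem b (y ∸ b))))
          where
          lem : ∀ b z → b + z + b ≡ z + (b + b)
          lem = solve-∀

        window : Window n k (b + b) lo plo (copies v)
        window = record
          { lo≤  = λ l x _ x≤n → m≤n+o⇒m∸n≤o _ b (≤-trans (proj₁ (close r∈ (copy∈ l) x x≤n))
              (≤-reflexive (+-comm _ b)))
          ; ≤lo  = λ l x _ x≤n → upper (proj₁ (close (copy∈ l) r∈ x x≤n))
          ; plo≤ = λ l x _ x≤n → m≤n+o⇒m∸n≤o _ b (≤-trans (proj₂ (close r∈ (copy∈ l) x x≤n))
              (≤-reflexive (+-comm _ b)))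
          ; ≤plo = λ l x _ x≤n → upper (proj₂ (close (copy∈ l) r∈ x x≤n))
          }

        relaxed : Relaxed (s * k) (s * k * t) (k * (b + b + (b + b))) (merged v)
        relaxed = subst (λ m → Relaxed (s * k) m (k * (b + b + (b + b))) (merged v)) (lem s t k)
          (merge-relaxed exact window (≤-trans (>-nonZero⁻¹ b) (m≤m+n b b)))
          where
          lem : ∀ s t k → s * t * k ≡ s * k * t
          lem = solve-∀

      merged-injective : ∀ {v v′} → v ∈ vectors (class c) k → v′ ∈ vectors (class c) k →
        (∀ y → y < s * k * t → merged v y ≡ merged v′ y) → v ≡ v′
      merged-injective {v} {v′} v∈ v′∈ eq = trans (sym (tabulate∘lookup v))
        (trans (tabulate-cong same) (tabulate∘lookup v′))
        where
        lem : ∀ s t k → s * t * k ≡ s * k * t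
        lem = solve-∀
        mod-toℕ : ∀ (i : Fin k) → toℕ i mod k ≡ i
        mod-toℕ i = toℕ-injective (trans (toℕ-fromℕ< _) (m<n⇒m%n≡m (toℕ<n i)))
        same : ∀ i → lookup v i ≡ lookup v′ i
        same i = subst (λ j → lookup v j ≡ lookup v′ j) (mod-toℕ i)
          (object-injective {s} {t} {lookup v (toℕ i mod k)} {lookup v′ (toℕ i mod k)}
              (proj₁ (∈class (copy∈ v∈ (toℕ i)))) (proj₁ (∈class (copy∈ v′∈ (toℕ i))))
            λ x x<n → merge-injective n k lo (copies v) (copies v′)
              (λ y y<nk → eq y (subst (y <_) (lem s t k) y<nk)) x x<n (toℕ i) (toℕ<n i))

    private
      0^k : ∀ k → .{{_ : NonZero k}} → 0 ^ k ≡ 0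
      0^k (suc _) = refl

      -- The tuples of k words of a class form a family of relaxed objects of width s * k, and the
      -- padding is chosen to reach width exactly N. Matching on the class provides the
      -- representative; an empty class contributes `0 ^ k` with k positive.
      class≤ : ∀ k N c → 1 ≤ k → k * (s + 9 * b) ≤ N → ∀ ws → class c ≡ ws →
               length (class c) ^ k ≤ #extensions t N
      class≤ k N c 1≤k room [] eq = ≤-trans (≤-reflexive (trans (cong (λ ws → length ws ^ k) eq)
        (0^k k {{>-nonZero 1≤k}}))) z≤n
      class≤ k N c 1≤k room (r ∷ ws) eq = begin
        length (class c) ^ k            ≡⟨ length-vectors (class c) k ⟨
        length (vectors (class c) k)    ≤⟨ relaxed-family (s * k) g δ t (*-mono-≤ 0<s 1≤k)
             (m+n≤o⇒m≤o∸n (δ + δ) (≤-trans (≤-reflexive (+-comm (δ + δ) _)) enough))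
             (vectors (class c) k) (merged k c r r∈)
             (unique-vectors (filter⁺ _ (unique-extensions s t)) k)
             (relaxed k c r r∈) (merged-injective k c r r∈) ⟩
        #extensions t (suc g + s * k)   ≡⟨ cong (#extensions t) width ⟩
        #extensions t N                 ∎
        where
        open ≤-Reasoning
        instance k≢0 = >-nonZero 1≤k
        r∈ = subst (r ∈_) (sym eq) (here refl)
        g = N ∸ suc (s * k)
        δ = k * (b + b + (b + b))
        -- Origin of the 9: the slack is δ = 4 k b, padding needs more than 2 δ = 8 k b new columns,
        -- and a ninth k b ≥ 1 pays for "more than".
        lem : ∀ s b k → k * b + (s * k + (k * (b + b + (b + b)) + k * (b + b + (b + b)))) ≡ k * (s + 9 * b)
        lem = solve-∀
        enough : suc (s * k) + (δ + δ) ≤ N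
        enough = ≤-trans (≤-trans (+-monoˡ-≤ (s * k + (δ + δ)) (*-mono-≤ 1≤k (>-nonZero⁻¹ b)))
          (≤-reflexive (lem s b k))) room
        width : suc g + s * k ≡ N
        width = trans (sym (+-suc g (s * k))) (m∸n+n≡m (≤-trans (m≤m+n _ (δ + δ)) enough))

      #classes : ℕ
      #classes = suc (suc n) ^ V * suc (suc n) ^ V

      largest : ∃[ c ] weight (λ _ → 1) (extensions s t) ≤
                       length (cartesianProduct (codes n b) (codes n b)) * weight (λ _ → 1) (class c)
      largest = pigeonhole _≟C_ classOf (λ _ → 1) (code n b (λ _ → 0) , code n b (λ _ → 0))
        (cartesianProduct (codes n b) (codes n b)) (extensions s t)
        (λ {v} _ → ∈-cartesianProduct⁺ (code∈codes n b (last (object v))) (code∈codes n b (#P (object v))))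

      number : length (cartesianProduct (codes n b) (codes n b)) ≡ #classes
      number = trans (length-cartesianProductWith _,_ (codes n b) (codes n b))
        (cong₂ _*_ (length-codes n b) (length-codes n b))

    -- Up to the number of classes, #extensions is supermultiplicative: k words of one
    -- class can be interleaved, and the rounding error is absorbed by padding.
    supermultiplicative : ∀ k N → 1 ≤ k → k * (s + 9 * b) ≤ N →
      #extensions t s ^ k ≤ (suc (suc n) ^ V * suc (suc n) ^ V) ^ k * #extensions t N
    supermultiplicative k N 1≤k room = begin
      #extensions t s ^ k                     ≤⟨ ^-monoˡ-≤ k
          (subst₂ _≤_ (sym (length≡weight (extensions s t)))
                                                   (cong₂ _*_ number (sym (length≡weight (class c))))
                                                       (proj₂ largest)) ⟩
      (#classes * length (class c)) ^ k       ≡⟨ ^-distribʳ-* k #classes (length (class c)) ⟩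
      #classes ^ k * length (class c) ^ k     ≤⟨ *-monoʳ-≤ (#classes ^ k)
          (class≤ k N c 1≤k room (class c) refl) ⟩
      #classes ^ k * #extensions t N          ∎
      where
      open ≤-Reasoning
      c = proj₁ largest

  -- The upper bound by weighted colourings.

  bools : List Bool
  bools = true ∷ false ∷ []

  ∈-bools : ∀ b → b ∈ bools
  ∈-bools true  = here refl
  ∈-bools false = there (here refl)

  unique-bools : Unique bools
  unique-bools = ((λ ()) ∷ []) ∷ [] ∷ []

  pick : ℕ → ℕ → Bool → ℕ
  pick x y b = if b then x else y

  prefix : ∀ n → (ℕ → Bool) → Vec Bool n
  prefix n Q = tabulate (Q ∘ toℕ)

  prefix-at : ∀ {n} Q {x} → (x<n : x < n) → lookup (prefix n Q) (fromℕ< x<n) ≡ Q x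
  prefix-at Q x<n = trans (lookup∘tabulate _ (fromℕ< x<n)) (cong Q (toℕ-fromℕ< x<n))

  prefix∈ : ∀ n Q → prefix n Q ∈ vectors bools n
  prefix∈ n Q = ∈-vectors⁺ (VecAll.tabulate⁺ λ i → ∈-bools _)

  weight-prefix : ∀ x y n Q → weightᵛ (pick x y) (prefix n Q) ≡ x ^ count Q n * y ^ count (not ∘ Q) n
  weight-prefix x y zero    Q = refl
  weight-prefix x y (suc n) Q
    rewrite ∑-split (𝟙 ∘ Q) 1 n | ∑-split (𝟙 ∘ not ∘ Q) 1 n | weight-prefix x y n (Q ∘ suc) with Q 0
  ... | true  = sym (*-assoc x _ _)
  ... | false = lem y (x ^ count (Q ∘ suc) n) _
    where
    lem : ∀ a b c → a * (b * c) ≡ b * (a * c)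
    lem = solve-∀

  module _ (s p : ℕ) where

    private
      t = suc p
      n = s * t
      goal = p ^ (s * p) * t ^ n

      pairs : List (Vec Bool (s * p) × Vec Bool n)
      pairs = cartesianProduct (vectors bools (s * p)) (vectors bools n)

      pairWeight : Vec Bool (s * p) × Vec Bool n → ℕ
      pairWeight (X , Y) = weightᵛ (pick t p) X * weightᵛ (pick p t) Y

      good : List (Vec Bool (s * p) × Vec Bool n)
      good = filter (λ XY → pairWeight XY ≟ goal) pairs

      encode : Word n → Vec Bool (s * p) × Vec Bool n
      encode v = prefix (s * p) (λ x → overtaken (position v) (s + x)) ,
                 prefix n (λ τ → overtaken (position v) (letter v τ))

      n≡ : n ≡ s + s * p
      n≡ = *-suc s p

      module _ {v : Word n} (v∈ : v ∈ extensions s t) where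

        private
          u = position v
          w = letter v
          L = FromWord.linExt {s} {t} v∈
          I = FromWord.inverses {s} {t} v∈

        spine-P : ∀ x → x < s → overtaken u x ≡ false
        spine-P x x<s = objectOf-nothing u w x (Exact.spine (exact-object {s} {t} z<s v∈) x x<s)

        times≡labels : ∀ Q → count (Q ∘ w) n ≡ count Q n
        times≡labels Q = ≤-antisym
          (count-injection (Q ∘ w) Q n n w (λ τ τ<n Qw → Inverses.w< I τ τ<n , Qw)
            (λ τ σ τ<n σ<n _ _ eq → trans (sym (Inverses.uw I τ τ<n))
                (trans (cong u eq) (Inverses.uw I σ σ<n))))
          (count-injection Q (Q ∘ w) n n u (λ x x<n Qx → LinExt.bounded L x x<n , trans
              (cong Q (Inverses.wu I x x<n)) Qx)
            (λ x y x<n y<n _ _ → LinExt.injective L x y x<n y<n))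

        -- Grouped by letters: a letter outside the first row contributes t * p in total whichever
        -- its colour, since its label and its time carry opposite weights, and a letter of the
        -- first row contributes t from its time, being a P.
        encode-good : pairWeight (encode v) ≡ goal
        encode-good = begin
          pairWeight (encode v)  ≡⟨ cong₂ _*_ (weight-prefix t p (s * p) (N ∘ (s +_)))
                                              (weight-prefix p t n (N ∘ w)) ⟩
          t ^ N₁ * p ^ P₁ * (p ^ count (N ∘ w) n * t ^ count (not ∘ N ∘ w) n)
                                 ≡⟨ cong₂ (λ i j → t ^ N₁ * p ^ P₁ * (p ^ i * t ^ j)) NY
                                     (times≡labels (not ∘ N)) ⟩
          t ^ N₁ * p ^ P₁ * (p ^ N₁ * t ^ count (not ∘ N) n) ≡⟨ lem (t ^ N₁) (p ^ P₁) (p ^ N₁) _ ⟩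
          p ^ N₁ * p ^ P₁ * (t ^ N₁ * t ^ count (not ∘ N) n)
                                 ≡⟨ cong₂ _*_ (^-distribˡ-+-* p N₁ P₁) (^-distribˡ-+-* t N₁ _) ⟨
          p ^ (N₁ + P₁) * t ^ (N₁ + count (not ∘ N) n)
                                 ≡⟨ cong₂ (λ i j → p ^ i * t ^ j) (count-complement (N ∘ (s +_)) (s * p))
                                      (trans (cong (_+ count (not ∘ N) n) (trans (sym NY) (times≡labels N)))
                                          (count-complement N n)) ⟩
          goal                   ∎
          where
          open ≡-Reasoning
          N  = overtaken u
          N₁ = count (N ∘ (s +_)) (s * p)
          P₁ = count (not ∘ N ∘ (s +_)) (s * p)
          NY : count (N ∘ w) n ≡ N₁
          NY = trans (times≡labels N) (trans (cong (count N) n≡) (trans (∑-split (𝟙 ∘ N) s (s * p))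
            (cong (_+ N₁) (trans (∑-cong s λ x x<s → cong 𝟙 (spine-P x x<s))
                (trans (∑-const 0 s) (*-zeroʳ s))))))
          lem : ∀ a b c d → a * b * (c * d) ≡ c * b * (a * d)
          lem = solve-∀

      encode-injective : ∀ {v v′} → v ∈ extensions s t → v′ ∈ extensions s t → encode v ≡ encode v′ → v ≡ v′
      encode-injective {v} {v′} v∈ v′∈ eq = position-injective {s} {t} v∈ v′∈
        (colours-determine (FromWord.linExt {s} {t} v∈) (FromWord.inverses {s} {t} v∈)
          (FromWord.linExt {s} {t} v′∈) (FromWord.inverses {s} {t} v′∈)
          (λ x x<n → cong not (labels x x<n)) (λ τ τ<n → cong not (times τ τ<n)))
        where
        times : ∀ τ → τ < n → overtaken (position v) (letter v τ) ≡ overtaken (position v′) (letter v′ τ)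
        times τ τ<n = trans (sym (prefix-at (λ τ → overtaken (position v) (letter v τ)) τ<n))
          (trans (cong (λ XY → lookup (proj₂ XY) (fromℕ< τ<n)) eq)
                 (prefix-at (λ τ → overtaken (position v′) (letter v′ τ)) τ<n))
        labels : ∀ x → x < n → overtaken (position v) x ≡ overtaken (position v′) x
        labels x x<n with x <? s
        ... | yes x<s = trans (spine-P v∈ x x<s) (sym (spine-P v′∈ x x<s))
        ... | no x≮s = subst (λ y → overtaken (position v) y ≡ overtaken (position v′) y)
            (m+[n∸m]≡n (≮⇒≥ x≮s))
              (trans (sym (prefix-at (λ x → overtaken (position v) (s + x)) x′<))
              (trans (cong (λ XY → lookup (proj₁ XY) (fromℕ< x′<)) eq)
                     (prefix-at (λ x → overtaken (position v′) (s + x)) x′<)))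
          where
          x′< : x ∸ s < s * p
          x′< = +-cancelˡ-< s (x ∸ s) (s * p) (subst₂ _<_ (sym (m+[n∸m]≡n (≮⇒≥ x≮s))) n≡ x<n)

    -- Weighting the colours makes every pair that arises equally heavy.
    upper-bound : #extensions t s * (p ^ (s * p) * t ^ (s * t)) ≤ (t + p) ^ (s * p) * (p + t) ^ (s * t)
    upper-bound = begin
      #extensions t s * goal         ≤⟨ *-monoˡ-≤ goal
          (injection⇒length≤ (λ v XY → encode v ≡ XY) (unique-extensions s t)
          (λ {v} v∈ → encode v , ∈-filter⁺ (λ XY → pairWeight XY ≟ goal)
            (∈-cartesianProduct⁺ (prefix∈ (s * p) (λ x → overtaken (position v) (s + x)))
               (prefix∈ n (λ τ → overtaken (position v) (letter v τ)))) (encode-good v∈) , refl)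
          (λ { v∈ v′∈ eq refl → encode-injective v∈ v′∈ eq })) ⟩
      length good * goal             ≡⟨ weight-const pairWeight goal good
          (λ XY∈ → proj₂ (∈-filter⁻ (λ XY → pairWeight XY ≟ goal) {xs = pairs} XY∈)) ⟨
      weight pairWeight good         ≤⟨ weight-filter≤ (λ XY → pairWeight XY ≟ goal) pairWeight pairs ⟩
      weight pairWeight pairs        ≡⟨ weight-cartesianProductWith _,_ (weightᵛ (pick t p))
          (weightᵛ (pick p t)) pairWeight
                                          (λ _ _ → refl) (vectors bools (s * p)) (vectors bools n) ⟩
      weight (weightᵛ (pick t p)) (vectors bools (s * p)) * weight (weightᵛ (pick p t)) (vectors bools n)
                                     ≡⟨ cong₂ _*_ (weight-vectors (pick t p) bools (s * p))
                                         (weight-vectors (pick p t) bools n) ⟩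
      (t + (p + 0)) ^ (s * p) * (p + (t + 0)) ^ n
                                     ≡⟨ cong₂ (λ i j → (t + i) ^ (s * p) * (p + j) ^ n) (+-identityʳ p)
                                         (+-identityʳ t) ⟩
      (t + p) ^ (s * p) * (p + t) ^ (s * t) ∎
      where open ≤-Reasoning

  -- Objects assembled from chunks.

  Chunk : Set
  Chunk = ℕ → Maybe ℕ

  -- The values in a chunk are relative to a base added later; `cap` bounds the rise within the
  -- chunk.
  record Fits (b cap : ℕ) (c : Chunk) : Set where
    field
      increasing : ∀ r q {x y} → r < q → q < b → c r ≡ just x → c q ≡ just y → x ≤ y
      capped     : ∀ r {x} → r < b → c r ≡ just x → x ≤ cap

  module Chunked (b m : ℕ) .{{_ : NonZero b}} (chunk : ℕ → Chunk) where

    labels : Object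
    labels x with x / b <? m
    ... | yes _ = nothing
    ... | no _  = chunk (x / b) (x % b)

    -- In the second row T starts a chunk at the number of P's before the chunk above,
    -- in later rows at the number of P's before the chunk itself.
    base : ℕ → ℕ
    base e with e <? m + m
    ... | yes _ = #P labels ((e ∸ m) * b)
    ... | no _  = #P labels (e * b)

    assembled : Object
    assembled x = Maybe.map (base (x / b) +_) (labels x)

    labels-row₀ : ∀ e {r} → r < b → e < m → labels (e * b + r) ≡ nothing
    labels-row₀ e {r} r<b e<m with (e * b + r) / b <? m
    ... | yes _ = refl
    ... | no ¬p = contradiction (subst (_< m) (sym (quotient-unique b e r<b)) e<m) ¬p

    labels-chunk : ∀ e {r} → r < b → m ≤ e → labels (e * b + r) ≡ chunk e r
    labels-chunk e {r} r<b m≤e with (e * b + r) / b <? m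
    ... | yes p = contradiction (subst (_< m) (quotient-unique b e r<b) p) (≤⇒≯ m≤e)
    ... | no _  = cong₂ chunk (quotient-unique b e r<b) (remainder-unique b e r<b)

    assembled-at : ∀ e {r} → r < b → assembled (e * b + r) ≡ Maybe.map (base e +_) (labels (e * b + r))
    assembled-at e {r} r<b = cong (λ z → Maybe.map (base z +_) (labels (e * b + r))) (quotient-unique b e r<b)

    isP-assembled : ∀ x → isP assembled x ≡ isP labels x
    isP-assembled x with labels x
    ... | nothing = refl
    ... | just _  = refl

    #P-assembled : ∀ x → #P assembled x ≡ #P labels x
    #P-assembled x = count-cong x λ y _ → isP-assembled y

    assembled-just : ∀ x {a} → assembled x ≡ just a → ∃[ e ] ∃[ r ] ∃[ c ]
      (r < b × x ≡ e * b + r × m ≤ e × chunk e r ≡ just c × a ≡ base e + c)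
    assembled-just x eq with division b x
    ... | e , r , r<b , refl with e <? m
    ... | yes e<m = contradiction (trans (sym eq) (trans (assembled-at e r<b)
                      (cong (Maybe.map _) (labels-row₀ e r<b e<m)))) λ ()
    ... | no e≮m = found (chunk e r) refl (trans (sym (trans (assembled-at e r<b)
                      (cong (Maybe.map (base e +_)) (labels-chunk e r<b (≮⇒≥ e≮m))))) eq)
      where
      found : ∀ {a} v → chunk e r ≡ v → Maybe.map (base e +_) v ≡ just a → ∃[ e′ ] ∃[ r′ ] ∃[ c ]
        (r′ < b × e * b + r ≡ e′ * b + r′ × m ≤ e′ × chunk e′ r′ ≡ just c × a ≡ base e′ + c)
      found (just c) ec refl = e , r , c , r<b , refl , ≮⇒≥ e≮m , ec , refl

    #P-row₀ : ∀ e → e ≤ m → #P labels (e * b) ≡ e * b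
    #P-row₀ e e≤m = count-all (e * b) λ x x<eb → row₀ x x<eb (division b x)
      where
      row₀ : ∀ x → x < e * b → ∃[ j ] ∃[ r ] (r < b × x ≡ j * b + r) → isP labels x ≡ true
      row₀ x x<eb (j , r , r<b , refl) = isP-nothing labels (j * b + r) (labels-row₀ j r<b
        (<-≤-trans (lex-row {b} {j} {e} {r} (subst (j * b + r <_) (*-comm e b) x<eb)) e≤m))

    base-row₁ : ∀ e → e < m + m → base e ≡ #P labels ((e ∸ m) * b)
    base-row₁ e e<2m with e <? m + m
    ... | yes _ = refl
    ... | no ¬p = contradiction e<2m ¬p

    base-later : ∀ e → m + m ≤ e → base e ≡ #P labels (e * b)
    base-later e 2m≤e with e <? m + m
    ... | yes p = contradiction p (≤⇒≯ 2m≤e)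
    ... | no _  = refl

    base≤ : ∀ e → base e ≤ #P labels (e * b)
    base≤ e with e <? m + m
    ... | yes _ = count-mono (isP labels) (*-monoˡ-≤ b (m∸n≤m e m))
    ... | no _  = ≤-refl

    -- The room up to the base of the next chunk. In the second row it is governed by the chunk
    -- above, which consists of b P's, and so does not depend on the colours in the chunk itself;
    -- this is what makes free colours possible in that row.
    cap : ℕ → ℕ
    cap e with e <? m + m
    ... | yes _ = b
    ... | no _  = count (is-nothing ∘ chunk e) b

    cap-row₁ : ∀ e → e < m + m → cap e ≡ b
    cap-row₁ e e<2m with e <? m + m
    ... | yes _ = refl
    ... | no ¬p = contradiction e<2m ¬p

    cap-later : ∀ e → m + m ≤ e → cap e ≡ count (is-nothing ∘ chunk e) b
    cap-later e 2m≤e with e <? m + m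
    ... | yes p = contradiction p (≤⇒≯ 2m≤e)
    ... | no _  = refl

    cap≤ : ∀ e → cap e ≤ b
    cap≤ e with e <? m + m
    ... | yes _ = ≤-refl
    ... | no _  = count≤ _ b

    base-step : ∀ e → m ≤ e → base e + cap e ≤ base (suc e)
    base-step e m≤e with <-cmp (suc e) (m + m)
    ... | tri< 1+e<2m _ _ = ≤-reflexive (begin
        base e + cap e                 ≡⟨ cong₂ _+_ (base-row₁ e e<2m) (cap-row₁ e e<2m) ⟩
        #P labels ((e ∸ m) * b) + b    ≡⟨ cong (_+ b) (#P-row₀ (e ∸ m) (<⇒≤ e-m<m)) ⟩
        (e ∸ m) * b + b                ≡⟨ +-comm _ b ⟩
        suc (e ∸ m) * b                ≡⟨ #P-row₀ (suc (e ∸ m)) e-m<m ⟨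
        #P labels (suc (e ∸ m) * b)    ≡⟨ cong (λ z → #P labels (z * b)) (+-∸-assoc 1 m≤e) ⟨
        #P labels ((suc e ∸ m) * b)    ≡⟨ base-row₁ (suc e) 1+e<2m ⟨
        base (suc e)                   ∎)
      where
      open ≡-Reasoning
      e<2m = <-trans ≤-refl 1+e<2m
      e-m<m = +-cancelˡ-< m (e ∸ m) m (subst (_< m + m) (sym (m+[n∸m]≡n m≤e)) e<2m)
    -- Between the second and the third row `base` changes its definition; the count is then taken
    -- at a later letter, so it can only jump upwards.
    ... | tri≈ _ 1+e≡2m _ = begin
        base e + cap e                 ≡⟨ cong₂ _+_ (base-row₁ e e<2m) (cap-row₁ e e<2m) ⟩
        #P labels ((e ∸ m) * b) + b    ≡⟨ cong (_+ b) (#P-row₀ (e ∸ m) (<⇒≤ e-m<m)) ⟩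
        (e ∸ m) * b + b                ≡⟨ +-comm _ b ⟩
        suc (e ∸ m) * b                ≡⟨ #P-row₀ (suc (e ∸ m)) e-m<m ⟨
        #P labels (suc (e ∸ m) * b)    ≤⟨ count-mono (isP labels) (*-monoˡ-≤ b (s≤s (m∸n≤m e m))) ⟩
        #P labels (suc e * b)          ≡⟨ base-later (suc e) (≤-reflexive (sym 1+e≡2m)) ⟨
        base (suc e)                   ∎
      where
      open ≤-Reasoning
      e<2m = subst (e <_) 1+e≡2m ≤-refl
      e-m<m = +-cancelˡ-< m (e ∸ m) m (subst (_< m + m) (sym (m+[n∸m]≡n m≤e)) e<2m)
    ... | tri> _ _ 2m<1+e = ≤-reflexive (begin
        base e + cap e                 ≡⟨ cong₂ _+_ (base-later e 2m≤e) (cap-later e 2m≤e) ⟩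
        #P labels (e * b) + count (is-nothing ∘ chunk e) b
          ≡⟨ cong (#P labels (e * b) +_) (count-cong b λ r r<b → cong is-nothing (labels-chunk e r<b m≤e)) ⟨
        #P labels (e * b) + count (isP labels ∘ (e * b +_)) b
                                       ≡⟨ ∑-split (𝟙 ∘ isP labels) (e * b) b ⟨
        #P labels (e * b + b)          ≡⟨ cong (#P labels) (+-comm (e * b) b) ⟩
        #P labels (suc e * b)          ≡⟨ base-later (suc e) (<⇒≤ 2m<1+e) ⟨
        base (suc e)                   ∎)
      where
      open ≡-Reasoning
      2m≤e = ≤-pred 2m<1+e

    base-mono : ∀ e f → m ≤ e → e < f → base e + cap e ≤ base f
    base-mono e (suc f) m≤e e<1+f with m≤n⇒m<n∨m≡n (≤-pred e<1+f)
    ... | inj₂ refl = base-step e m≤e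
    ... | inj₁ e<f  = ≤-trans (base-mono e f m≤e e<f) (≤-trans (m≤m+n _ (cap f))
                        (base-step f (≤-trans m≤e (<⇒≤ e<f))))

    -- Every error stays within one chunk. For `below`, the base is at most the number of P's before
    -- the chunk, and the rise is at most b. For `above`, the P's up to the end of the chunk above
    -- exceed the base by at most b; in later rows they do not exceed it at all.
    assembled-relaxed : ∀ t → 0 < m → (∀ e → m ≤ e → e < m * t → Fits b (cap e) (chunk e)) →
                        Relaxed (m * b) (m * b * t) b assembled
    assembled-relaxed t 0<m fits = record { spine = spine′ ; mono = mono′ ; below = below′ ; above = above′ }
      where
      lem : ∀ m b t → m * b * t ≡ b * (m * t)
      lem = solve-∀
      inside : ∀ e {r} → e * b + r < m * b * t → e < m * t
      inside e {r} lt = lex-row {b} {e} {m * t} {r} (subst (e * b + r <_) (lem m b t) lt)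
      spine′ : ∀ x → x < m * b → assembled x ≡ nothing
      spine′ x x<mb with division b x
      ... | e , r , r<b , refl = trans (assembled-at e r<b) (cong (Maybe.map _) (labels-row₀ e r<b
              (lex-row {b} {e} {m} {r} (subst (e * b + r <_) (*-comm m b) x<mb))))
      mono′ : ∀ x y {a c} → x < y → y < m * b * t → assembled x ≡ just a → assembled y ≡ just c → a ≤ c
      mono′ x y x<y y<n ox oy
        with e , r , a , r<b , refl , m≤e , ca , refl ← assembled-just x ox
        with f , q , c , q<b , refl , m≤f , cc , refl ← assembled-just y oy
        with lex-< {b} {e} {f} q<b x<y
      ... | inj₁ e<f = ≤-trans (+-monoʳ-≤ (base e)
          (Fits.capped (fits e m≤e (<-trans e<f (inside f y<n))) r r<b ca))
                         (≤-trans (base-mono e f m≤e e<f) (m≤m+n (base f) c))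
      ... | inj₂ (refl , r<q) = +-monoʳ-≤ (base e)
          (Fits.increasing (fits e m≤e (inside f y<n)) r q r<q q<b ca cc)
      below′ : ∀ x {a} → x < m * b * t → assembled x ≡ just a → a ≤ #P assembled x + b
      below′ x x<n ox with e , r , a , r<b , refl , m≤e , ca , refl ← assembled-just x ox = +-mono-≤
        (≤-trans (base≤ e) (≤-trans (count-mono (isP labels) (m≤m+n (e * b) r))
            (≤-reflexive (sym (#P-assembled (e * b + r))))))
        (≤-trans (Fits.capped (fits e m≤e (inside e x<n)) r r<b ca) (cap≤ e))
      above′ : ∀ x {a} → x + m * b < m * b * t → assembled x ≡ nothing → assembled (x + m * b) ≡ just a →
               suc (#P assembled x) ≤ a + b
      above′ x {a} lt ox oxs with division b x
      ... | e , r , r<b , refl = begin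
          suc (#P assembled (e * b + r))  ≡⟨ count-suc (isP assembled) (e * b + r)
              (isP-nothing assembled (e * b + r) ox) ⟨
          #P assembled (suc (e * b + r))  ≡⟨ #P-assembled (suc (e * b + r)) ⟩
          #P labels (suc (e * b + r))     ≤⟨ count-mono (isP labels) (+-monoʳ-< (e * b) r<b) ⟩
          #P labels (e * b + b)           ≤⟨ reached ⟩
          base (e + m) + b                ≤⟨ +-monoˡ-≤ b base≤a ⟩
          a + b                           ∎
        where
        open ≤-Reasoning
        lem′ : ∀ e b r m → e * b + r + m * b ≡ (e + m) * b + r
        lem′ = solve-∀
        base≤a : base (e + m) ≤ a
        base≤a = go (labels ((e + m) * b + r)) (trans
            (sym (trans (cong assembled (lem′ e b r m)) (assembled-at (e + m) r<b))) oxs)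
          where
          go : ∀ v → Maybe.map (base (e + m) +_) v ≡ just a → base (e + m) ≤ a
          go (just c) refl = m≤m+n _ c
        reached : #P labels (e * b + b) ≤ base (e + m) + b
        reached with e <? m
        ... | yes e<m = ≤-trans (count-+≤ (isP labels) (e * b) b) (+-monoˡ-≤ b (≤-reflexive (sym
                (trans (base-row₁ (e + m) (+-monoˡ-< m e<m))
                    (cong (λ z → #P labels (z * b)) (m+n∸n≡m e m))))))
        ... | no e≮m = ≤-trans (count-mono (isP labels) (≤-trans (≤-reflexive (+-comm (e * b) b))
                (*-monoˡ-≤ b (≤-trans (+-monoʳ-≤ 1 (≤-refl {e}))
                    (≤-trans (≤-reflexive (+-comm 1 e)) (+-monoʳ-≤ e 0<m))))))
                (≤-trans (≤-reflexive (sym (base-later (e + m) (+-monoˡ-≤ m (≮⇒≥ e≮m))))) (m≤m+n _ b))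

  module _ (b m t : ℕ) .{{_ : NonZero b}} (chunk chunk′ : ℕ → Chunk)
           (eq : ∀ x → x < m * b * t → Chunked.assembled b m chunk x ≡ Chunked.assembled b m chunk′ x) where
    private
      module C  = Chunked b m chunk
      module C′ = Chunked b m chunk′
      n = m * b * t

      #P-agree : ∀ x → x ≤ n → #P C.labels x ≡ #P C′.labels x
      #P-agree x x≤n = trans (sym (C.#P-assembled x)) (trans
        (count-cong x λ y y<x → cong is-nothing (eq y (<-≤-trans y<x x≤n))) (C′.#P-assembled x))

      base-agree : ∀ e → e * b ≤ n → C.base e ≡ C′.base e
      base-agree e le with e <? m + m
      ... | yes _ = #P-agree _ (≤-trans (*-monoˡ-≤ b (m∸n≤m e m)) le)
      ... | no _  = #P-agree _ le

    -- The bases depend only on the colours, which the assembled object shows, so equal objects have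
    -- equal bases and these can be subtracted.
    assembled-injective : ∀ e r → m ≤ e → e < m * t → r < b → chunk e r ≡ chunk′ e r
    assembled-injective e r m≤e e<mt r<b = go (chunk e r) (chunk′ e r) (begin
        Maybe.map (C.base e +_) (chunk e r)             ≡⟨ cong (Maybe.map (C.base e +_))
            (C.labels-chunk e r<b m≤e) ⟨
        Maybe.map (C.base e +_) (C.labels (e * b + r))  ≡⟨ C.assembled-at e r<b ⟨
        C.assembled (e * b + r)                         ≡⟨ eq (e * b + r) x<n ⟩
        C′.assembled (e * b + r)                        ≡⟨ C′.assembled-at e r<b ⟩
        Maybe.map (C′.base e +_) (C′.labels (e * b + r)) ≡⟨ cong₂ (λ z → Maybe.map (z +_))
                                                             (sym (base-agree e (≤-trans (m≤m+n (e * b) r)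
                                                                 (<⇒≤ x<n))))
                                                             (C′.labels-chunk e r<b m≤e) ⟩
        Maybe.map (C.base e +_) (chunk′ e r)            ∎)
      where
      open ≡-Reasoning
      lem : ∀ m b t → b * (m * t) ≡ m * b * t
      lem = solve-∀
      x<n : e * b + r < n
      x<n = subst (e * b + r <_) (lem m b t) (row-lex e<mt r<b)
      go : ∀ {z} (v v′ : Maybe ℕ) → Maybe.map (z +_) v ≡ Maybe.map (z +_) v′ → v ≡ v′
      go     nothing  nothing  _ = refl
      go {z} (just x) (just y) p = cong just (+-cancelˡ-≡ z x y (just-injective p))

  -- Chunks decoded from binary words.

  private variable
    len : ℕ

  ones zeros : List Bool → ℕ
  ones []          = 0
  ones (true ∷ Y)  = suc (ones Y)
  ones (false ∷ Y) = ones Y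
  zeros []          = 0
  zeros (true ∷ Y)  = zeros Y
  zeros (false ∷ Y) = suc (zeros Y)

  ones+zeros : ∀ Y → ones Y + zeros Y ≡ length Y
  ones+zeros []          = refl
  ones+zeros (true ∷ Y)  = cong suc (ones+zeros Y)
  ones+zeros (false ∷ Y) = trans (+-suc (ones Y) (zeros Y)) (cong suc (ones+zeros Y))

  -- A one of Y is worth d, a zero is worth 1; the result is the value reached at the
  -- first one and the part of Y that follows it.
  advance : ℕ → List Bool → ℕ → ℕ × List Bool
  advance d []          v = v , []
  advance d (true ∷ Y)  v = v + d , Y
  advance d (false ∷ Y) v = advance d Y (suc v)

  -- A one of X is an N whose value is read off Y; the zeros of X are P or, when Z says
  -- so, N with an unchanged value.
  decodeChunk : ℕ → Vec Bool len → List Bool → List Bool → ℕ → Vec (Maybe ℕ) len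
  decodeChunk d []          Z           Y v = []
  decodeChunk d (true ∷ X)  Z           Y v = just (proj₁ (advance d Y v)) ∷
    decodeChunk d X Z (proj₂ (advance d Y v)) (proj₁ (advance d Y v))
  decodeChunk d (false ∷ X) []          Y v = nothing ∷ decodeChunk d X [] Y v
  decodeChunk d (false ∷ X) (true ∷ Z)  Y v = nothing ∷ decodeChunk d X Z Y v
  decodeChunk d (false ∷ X) (false ∷ Z) Y v = just v ∷ decodeChunk d X Z Y v

  nth : α → Vec α len → ℕ → α
  nth z []       _       = z
  nth z (x ∷ xs) zero    = x
  nth z (x ∷ xs) (suc i) = nth z xs i

  nth-ext : ∀ (z : α) (xs ys : Vec α len) → (∀ i → i < len → nth z xs i ≡ nth z ys i) → xs ≡ ys
  nth-ext z []       []       h = refl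
  nth-ext z (x ∷ xs) (y ∷ ys) h = cong₂ _∷_ (h 0 z<s) (nth-ext z xs ys λ i i<n → h (suc i) (s<s i<n))

  nth-All : ∀ {P : α → Set} {z} {xs : Vec α len} → VecAll.All P xs → ∀ i → i < len → P (nth z xs i)
  nth-All (p VecAll.∷ ps) zero    _       = p
  nth-All (p VecAll.∷ ps) (suc i) (s<s i<n) = nth-All ps i i<n

  advance-≥ : ∀ d Y v → v ≤ proj₁ (advance d Y v)
  advance-≥ d []          v = ≤-refl
  advance-≥ d (true ∷ Y)  v = m≤m+n v d
  advance-≥ d (false ∷ Y) v = ≤-trans (n≤1+n v) (advance-≥ d Y (suc v))

  advance-> : ∀ d Y v → 0 < ones Y → v + d ≤ proj₁ (advance d Y v)
  advance-> d (true ∷ Y)  v _ = ≤-refl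
  advance-> d (false ∷ Y) v p = ≤-trans (n≤1+n _) (advance-> d Y (suc v) p)

  -- The value reached plus the worth of the unread part of `Y` is invariant, so the total worth of
  -- `Y` bounds the rise of a whole chunk.
  advance-total : ∀ d Y v → proj₁ (advance d Y v) +
      (d * ones (proj₂ (advance d Y v)) + zeros (proj₂ (advance d Y v))) ≡
                            v + (d * ones Y + zeros Y)
  advance-total d []          v = refl
  advance-total d (true ∷ Y)  v = lem v d (ones Y) (zeros Y)
    where
    lem : ∀ v d o z → v + d + (d * o + z) ≡ v + (d * suc o + z)
    lem = solve-∀
  advance-total d (false ∷ Y) v = trans (advance-total d Y (suc v)) (lem v (d * ones Y) (zeros Y))
    where
    lem : ∀ v o z → suc v + (o + z) ≡ v + (o + suc z)
    lem = solve-∀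

  decode-≥ : ∀ d (X : Vec Bool len) Z Y v r {x} → nth nothing (decodeChunk d X Z Y v) r ≡ just x → v ≤ x
  decode-≥ d (true ∷ X)  Z           Y v zero    refl = advance-≥ d Y v
  decode-≥ d (true ∷ X)  Z           Y v (suc r) eq   = ≤-trans (advance-≥ d Y v) (decode-≥ d X Z _ _ r eq)
  decode-≥ d (false ∷ X) []          Y v (suc r) eq   = decode-≥ d X [] Y v r eq
  decode-≥ d (false ∷ X) (true ∷ Z)  Y v (suc r) eq   = decode-≥ d X Z Y v r eq
  decode-≥ d (false ∷ X) (false ∷ Z) Y v zero    refl = ≤-refl
  decode-≥ d (false ∷ X) (false ∷ Z) Y v (suc r) eq   = decode-≥ d X Z Y v r eq

  decode-mono : ∀ d (X : Vec Bool len) Z Y v r q {x y} → r < q →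
    nth nothing (decodeChunk d X Z Y v) r ≡ just x → nth nothing (decodeChunk d X Z Y v) q ≡ just y → x ≤ y
  decode-mono d (true ∷ X)  Z           Y v zero    (suc q) _ refl eq′ = decode-≥ d X Z _ _ q eq′
  decode-mono d (true ∷ X)  Z           Y v (suc r) (suc q) (s<s lt) eq eq′ = decode-mono d X Z _ _ r q lt eq
      eq′
  decode-mono d (false ∷ X) []          Y v (suc r) (suc q) (s<s lt) eq eq′ = decode-mono d X [] Y v r q lt eq
      eq′
  decode-mono d (false ∷ X) (true ∷ Z)  Y v (suc r) (suc q) (s<s lt) eq eq′ = decode-mono d X Z Y v r q lt eq
      eq′
  decode-mono d (false ∷ X) (false ∷ Z) Y v zero    (suc q) _ refl eq′ = decode-≥ d X Z Y v q eq′
  decode-mono d (false ∷ X) (false ∷ Z) Y v (suc r) (suc q) (s<s lt) eq eq′ = decode-mono d X Z Y v r q lt eq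
      eq′

  decode-≤ : ∀ d (X : Vec Bool len) Z Y v r {x} → nth nothing (decodeChunk d X Z Y v) r ≡ just x →
             x ≤ v + (d * ones Y + zeros Y)
  decode-≤ d (true ∷ X)  Z           Y v zero    refl = ≤-trans (m≤m+n _ _)
      (≤-reflexive (advance-total d Y v))
  decode-≤ d (true ∷ X)  Z           Y v (suc r) eq   = ≤-trans (decode-≤ d X Z _ _ r eq)
      (≤-reflexive (advance-total d Y v))
  decode-≤ d (false ∷ X) []          Y v (suc r) eq   = decode-≤ d X [] Y v r eq
  decode-≤ d (false ∷ X) (true ∷ Z)  Y v (suc r) eq   = decode-≤ d X Z Y v r eq
  decode-≤ d (false ∷ X) (false ∷ Z) Y v zero    refl = m≤m+n v _
  decode-≤ d (false ∷ X) (false ∷ Z) Y v (suc r) eq   = decode-≤ d X Z Y v r eq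

  count-decode : ∀ d (X : Vec Bool len) Y v →
    count (is-nothing ∘ nth nothing (decodeChunk d X [] Y v)) len ≡ zeros (toList X)
  count-decode d []          Y v = refl
  count-decode {len = suc len} d (true ∷ X)  Y v = trans (∑-split _ 1 len) (count-decode d X _ _)
  count-decode {len = suc len} d (false ∷ X) Y v = trans (∑-split _ 1 len) (cong suc (count-decode d X Y v))

  ones-advance : ∀ d Y v {k} → ones Y ≡ suc k → ones (proj₂ (advance d Y v)) ≡ k
  ones-advance d (true ∷ Y)  v eq = suc-injective eq
  ones-advance d (false ∷ Y) v eq = ones-advance d Y (suc v) eq

  -- The value reached reveals how many zeros precede the first one, hence the part of the word that
  -- was consumed, provided that both words still contain a one.
  advance-injective : ∀ d Y Y′ v → 0 < ones Y → 0 < ones Y′ → proj₁ (advance d Y v) ≡ proj₁ (advance d Y′ v) →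
    (length Y ≡ length Y′ → length (proj₂ (advance d Y v)) ≡ length (proj₂ (advance d Y′ v))) ×
    (proj₂ (advance d Y v) ≡ proj₂ (advance d Y′ v) → Y ≡ Y′)
  advance-injective d (true ∷ Y)  (true ∷ Y′)  v p p′ eq = suc-injective , cong (true ∷_)
  advance-injective d (true ∷ Y)  (false ∷ Y′) v p p′ eq =
    contradiction (subst (suc v + d ≤_) (sym eq) (advance-> d Y′ (suc v) p′)) (<⇒≱ ≤-refl)
  advance-injective d (false ∷ Y) (true ∷ Y′)  v p p′ eq =
    contradiction (subst (suc v + d ≤_) eq (advance-> d Y (suc v) p)) (<⇒≱ ≤-refl)
  advance-injective d (false ∷ Y) (false ∷ Y′) v p p′ eq
    with f , g ← advance-injective d Y Y′ (suc v) p p′ eq = f ∘ suc-injective , cong (false ∷_) ∘ g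

  all-zeros : ∀ Y Y′ → ones Y ≡ 0 → ones Y′ ≡ 0 → length Y ≡ length Y′ → Y ≡ Y′
  all-zeros []          []           _ _ _  = refl
  all-zeros (false ∷ Y) (false ∷ Y′) p q eq = cong (false ∷_) (all-zeros Y Y′ p q (suc-injective eq))

  -- Either `Z` has one letter for each zero of `X`, and then d = 1 is required to tell the two
  -- kinds of N apart, or there is no `Z`.
  Separable : ℕ → Vec Bool len → Vec Bool len → List Bool → List Bool → Set
  Separable d X X′ Z Z′ =
    (d ≡ 1 × length Z ≡ zeros (toList X) × length Z′ ≡ zeros (toList X′)) ⊎ (Z ≡ [] × Z′ ≡ [])

  -- An N coming from `X` consumes a one of `Y` and raises the value by at least d, whereas an N
  -- coming from `Z` repeats the value; with d = 1 they cannot be confused. After the last one of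
  -- `X` only zeros of `Y` remain, and the length of `Y` determines how many.
  decode-injective : ∀ d (X X′ : Vec Bool len) Z Z′ Y Y′ v → Separable d X X′ Z Z′ →
    ones Y ≡ ones (toList X) → ones Y′ ≡ ones (toList X′) → length Y ≡ length Y′ →
    decodeChunk d X Z Y v ≡ decodeChunk d X′ Z′ Y′ v → X ≡ X′ × Z ≡ Z′ × Y ≡ Y′
  decode-injective d [] [] Z Z′ Y Y′ v sep p p′ len eq = refl , same sep , all-zeros Y Y′ p p′ len
    where
    empty : ∀ (Z : List Bool) → length Z ≡ 0 → Z ≡ []
    empty [] _ = refl
    same : Separable d [] [] Z Z′ → Z ≡ Z′
    same (inj₁ (_ , q , q′)) = trans (empty Z q) (sym (empty Z′ q′))
    same (inj₂ (q , q′))     = trans q (sym q′)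
  decode-injective d (true ∷ X) (true ∷ X′) Z Z′ Y Y′ v sep p p′ len eq
    with f , g ← advance-injective d Y Y′ v (subst (0 <_) (sym p) z<s) (subst (0 <_) (sym p′) z<s)
                   (just-injective (proj₁ (∷-injective eq)))
    with X≡ , Z≡ , Y≡ ← decode-injective d X X′ Z Z′ _ _ (proj₁ (advance d Y v)) sep
           (ones-advance d Y v p) (ones-advance d Y′ v p′) (f len)
           (trans (proj₂ (∷-injective eq)) (cong (decodeChunk d X′ Z′ _)
             (sym (just-injective (proj₁ (∷-injective eq)))))) =
    cong (true ∷_) X≡ , Z≡ , g Y≡
  decode-injective d (false ∷ X) (false ∷ X′) []          []           Y Y′ v sep p p′ len eq
    with X≡ , Z≡ , Y≡ ← decode-injective d X X′ [] [] Y Y′ v (inj₂ (refl , refl)) p p′ len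
           (proj₂ (∷-injective eq)) = cong (false ∷_) X≡ , Z≡ , Y≡
  decode-injective d (false ∷ X) (false ∷ X′) []          (_ ∷ Z′)     Y Y′ v (inj₁ (_ , () , _)) p p′ len eq
  decode-injective d (false ∷ X) (false ∷ X′) []          (_ ∷ Z′)     Y Y′ v (inj₂ (_ , ())) p p′ len eq
  decode-injective d (false ∷ X) (false ∷ X′) (_ ∷ Z)     []           Y Y′ v (inj₁ (_ , _ , ())) p p′ len eq
  decode-injective d (false ∷ X) (false ∷ X′) (_ ∷ Z)     Z′           Y Y′ v (inj₂ (() , _)) p p′ len eq
  decode-injective d (false ∷ X) (false ∷ X′) (true ∷ Z)  (true ∷ Z′)  Y Y′ v (inj₁ (d≡1 , q , q′)) p p′ len
      eq
    with X≡ , Z≡ , Y≡ ← decode-injective d X X′ Z Z′ Y Y′ v (inj₁ (d≡1 , suc-injective q , suc-injective q′))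
        p p′ len
           (proj₂ (∷-injective eq)) = cong (false ∷_) X≡ , cong (true ∷_) Z≡ , Y≡
  decode-injective d (false ∷ X) (false ∷ X′) (false ∷ Z) (false ∷ Z′) Y Y′ v (inj₁ (d≡1 , q , q′)) p p′ len
      eq
    with X≡ , Z≡ , Y≡ ← decode-injective d X X′ Z Z′ Y Y′ v (inj₁ (d≡1 , suc-injective q , suc-injective q′))
        p p′ len
           (proj₂ (∷-injective eq)) = cong (false ∷_) X≡ , cong (false ∷_) Z≡ , Y≡
  decode-injective d (false ∷ X) (false ∷ X′) (true ∷ Z)  (false ∷ Z′) Y Y′ v _ p p′ len ()
  decode-injective d (false ∷ X) (false ∷ X′) (false ∷ Z) (true ∷ Z′)  Y Y′ v _ p p′ len ()
  decode-injective d (true ∷ X)  (false ∷ X′) Z           []           Y Y′ v _ p p′ len ()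
  decode-injective d (true ∷ X)  (false ∷ X′) Z           (true ∷ Z′)  Y Y′ v _ p p′ len ()
  decode-injective d (true ∷ X)  (false ∷ X′) Z           (false ∷ Z′) Y Y′ v (inj₂ (_ , ())) p p′ len eq
  decode-injective d (true ∷ X)  (false ∷ X′) Z           (false ∷ Z′) Y Y′ v (inj₁ (refl , _)) p p′ len eq =
    contradiction (subst (v + 1 ≤_) (just-injective (proj₁ (∷-injective eq)))
      (advance-> 1 Y v (subst (0 <_) (sym p) z<s))) (<⇒≱ (≤-reflexive (+-comm 1 v)))
  decode-injective d (false ∷ X) (true ∷ X′)  []          Z′           Y Y′ v _ p p′ len ()
  decode-injective d (false ∷ X) (true ∷ X′)  (true ∷ Z)  Z′           Y Y′ v _ p p′ len ()
  decode-injective d (false ∷ X) (true ∷ X′)  (false ∷ Z) Z′           Y Y′ v (inj₂ (() , _)) p p′ len eq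
  decode-injective d (false ∷ X) (true ∷ X′)  (false ∷ Z) Z′           Y Y′ v (inj₁ (refl , _)) p p′ len eq =
    contradiction (subst (v + 1 ≤_) (sym (just-injective (proj₁ (∷-injective eq))))
      (advance-> 1 Y′ v (subst (0 <_) (sym p′) z<s))) (<⇒≱ (≤-reflexive (+-comm 1 v)))

  -- Binary words with a prescribed number of ones.

  onesᵛ : ∀ {b} → Vec Bool b → ℕ
  onesᵛ X = ones (toList X)

  binary : ∀ b → ℕ → List (Vec Bool b)
  binary b a = fibre _≟_ onesᵛ a (vectors bools b)

  #binary : ℕ → ℕ → ℕ
  #binary b a = length (binary b a)

  ∈-binary : ∀ {b a X} → X ∈ binary b a → onesᵛ X ≡ a
  ∈-binary {b} {a} X∈ = proj₂ (∈-filter⁻ (λ X → onesᵛ X ≟ a) {xs = vectors bools b} X∈)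

  unique-binary : ∀ b a → Unique (binary b a)
  unique-binary b a = filter⁺ _ (unique-vectors unique-bools b)

  zeros≡ : ∀ {b} (X : Vec Bool b) → zeros (toList X) ≡ b ∸ onesᵛ X
  zeros≡ {b} X = trans (sym (m+n∸m≡n (onesᵛ X) _)) (cong (_∸ onesᵛ X)
    (trans (ones+zeros (toList X)) (length-toList X)))

  weight-binary : ∀ p q {b} (X : Vec Bool b) → weightᵛ (pick q p) X ≡ p ^ zeros (toList X) * q ^ onesᵛ X
  weight-binary p q []          = refl
  weight-binary p q (true ∷ X)  rewrite weight-binary p q X = lem q (p ^ zeros (toList X)) _
    where
    lem : ∀ a b c → a * (b * c) ≡ b * (a * c)
    lem = solve-∀
  weight-binary p q (false ∷ X) rewrite weight-binary p q X = sym (*-assoc p _ _)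

  -- The binomial expansion of (p + q) ^ b has b + 1 terms, and the largest is at least the average.
  popular-weight : ∀ b p q → ∃[ a ] (p + q) ^ b ≤ suc b * (#binary b a * (p ^ (b ∸ a) * q ^ a))
  popular-weight b p q = a , subst₂ _≤_ total
      (cong₂ _*_ (length-upTo (suc b)) (weight-const _ _ (binary b a) each)) (proj₂ found)
    where
    found = pigeonhole _≟_ onesᵛ (weightᵛ (pick q p)) 0 (upTo (suc b)) (vectors bools b)
      λ {X} _ → ∈-upTo⁺ (s≤s (≤-trans (m≤m+n (onesᵛ X) _) (≤-reflexive
        (trans (ones+zeros (toList X)) (length-toList X)))))
    a = proj₁ found
    total : weight (weightᵛ (pick q p)) (vectors bools b) ≡ (p + q) ^ b
    total = trans (weight-vectors (pick q p) bools b)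
        (cong (_^ b) (trans (cong (q +_) (+-identityʳ p)) (+-comm q p)))
    each : ∀ {X} → X ∈ binary b a → weightᵛ (pick q p) X ≡ p ^ (b ∸ a) * q ^ a
    each {X} X∈ = trans (weight-binary p q X) (cong₂ (λ i j → p ^ i * q ^ j)
      (trans (zeros≡ X) (cong (b ∸_) (∈-binary X∈))) (∈-binary X∈))

  toList-injective : ∀ {A : Set} {b} (X Y : Vec A b) → toList X ≡ toList Y → X ≡ Y
  toList-injective []      []      _  = refl
  toList-injective (x ∷ X) (y ∷ Y) eq = cong₂ _∷_ (List.∷-injectiveˡ eq)
      (toList-injective X Y (List.∷-injectiveʳ eq))

  -- The family of objects behind the lower bound.

  module _ (b a₁ a₂ m t : ℕ) .{{_ : NonZero b}} (0<m : 0 < m) where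

    private
      Index₁ Index₂ Index : Set
      Index₁ = (Vec Bool b × Vec Bool b) × Vec Bool (b ∸ a₁)
      Index₂ = Vec Bool b × Vec Bool b
      Index  = Vec Index₁ m × Vec Index₂ (m * t)

      indices₁ : List Index₁
      indices₁ = cartesianProduct (cartesianProduct (binary b a₁) (binary b a₁)) (vectors bools (b ∸ a₁))

      indices₂ : List Index₂
      indices₂ = cartesianProduct (binary b a₂) (binary b a₂)

      indices : List Index
      indices = cartesianProduct (vectors indices₁ m) (vectors indices₂ (m * t))

      none₁ : Index₁
      none₁ = (replicate b false , replicate b false) , replicate _ false

      none₂ : Index₂
      none₂ = replicate b false , replicate b false

      -- Here ones and zeros of `Y` are both worth 1, for a total rise of b, the cap of the second
      -- row. In `word₂` the ones are worth 0, and the rise is the number of zeros of `Y`.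
      word₁ : Index₁ → Vec (Maybe ℕ) b
      word₁ ((X , Y) , Z) = decodeChunk 1 X (toList Z) (toList Y) 0

      word₂ : Index₂ → Vec (Maybe ℕ) b
      word₂ (X , Y) = decodeChunk 0 X [] (toList Y) 0

      chunks : Index → ℕ → Vec (Maybe ℕ) b
      chunks (V , W) e with e <? m + m
      ... | yes _ = word₁ (nth none₁ V (e ∸ m))
      ... | no _  = word₂ (nth none₂ W (e ∸ (m + m)))

      chunks-row₁ : ∀ VW i → i < m → chunks VW (m + i) ≡ word₁ (nth none₁ (proj₁ VW) i)
      chunks-row₁ (V , W) i i<m with m + i <? m + m
      ... | yes _ = cong (λ j → word₁ (nth none₁ V j)) (m+n∸m≡n m i)
      ... | no ¬p = contradiction (+-monoʳ-< m i<m) ¬p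

      chunks-later : ∀ VW i → chunks VW (m + m + i) ≡ word₂ (nth none₂ (proj₂ VW) i)
      chunks-later (V , W) i with m + m + i <? m + m
      ... | yes p = contradiction p (≤⇒≯ (m≤m+n (m + m) i))
      ... | no _  = cong (λ j → word₂ (nth none₂ W j)) (m+n∸m≡n (m + m) i)

      chunk : Index → ℕ → Chunk
      chunk VW e r = nth nothing (chunks VW e) r

      member₁ : ∀ {I} → I ∈ indices₁ → onesᵛ (proj₁ (proj₁ I)) ≡ a₁ × onesᵛ (proj₂ (proj₁ I)) ≡ a₁
      member₁ I∈ with XY∈ , _ ← ∈-cartesianProduct⁻ (cartesianProduct (binary b a₁) (binary b a₁))
          (vectors bools (b ∸ a₁)) I∈
        with X∈ , Y∈ ← ∈-cartesianProduct⁻ (binary b a₁) (binary b a₁) XY∈ = ∈-binary X∈ , ∈-binary Y∈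

      member₂ : ∀ {I} → I ∈ indices₂ → onesᵛ (proj₁ I) ≡ a₂ × onesᵛ (proj₂ I) ≡ a₂
      member₂ I∈ with X∈ , Y∈ ← ∈-cartesianProduct⁻ (binary b a₂) (binary b a₂) I∈ = ∈-binary X∈ , ∈-binary Y∈

      fits₁ : ∀ {I} → Fits b b (nth nothing (word₁ I))
      fits₁ {(X , Y) , Z} = record
        { increasing = λ r q r<q _ → decode-mono 1 X (toList Z) (toList Y) 0 r q r<q
        ; capped     = λ r _ eq → ≤-trans (decode-≤ 1 X (toList Z) (toList Y) 0 r eq) (≤-reflexive
            (trans (cong (_+ zeros (toList Y)) (+-identityʳ (ones (toList Y))))
                   (trans (ones+zeros (toList Y)) (length-toList Y))))
        }

      -- The reason for giving `X` and `Y` equally many ones: the rise, which is the number of zeros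
      -- of `Y`, then equals the number of zeros of `X`, which is the number of P's in the chunk.
      fits₂ : ∀ {I} → I ∈ indices₂ →
              Fits b (count (is-nothing ∘ nth nothing (word₂ I)) b) (nth nothing (word₂ I))
      fits₂ {X , Y} I∈ with X₁ , Y₁ ← member₂ I∈ = record
        { increasing = λ r q r<q _ → decode-mono 0 X [] (toList Y) 0 r q r<q
        ; capped     = λ r _ eq → ≤-trans (decode-≤ 0 X [] (toList Y) 0 r eq) (≤-reflexive
            (trans (zeros≡ Y) (trans (cong (b ∸_) (trans Y₁ (sym X₁))) (trans (sym (zeros≡ X))
              (sym (count-decode 0 X (toList Y) 0))))))
        }

      word₁-injective : ∀ {I J} → I ∈ indices₁ → J ∈ indices₁ → word₁ I ≡ word₁ J → I ≡ J
      word₁-injective {(X , Y) , Z} {(X′ , Y′) , Z′} I∈ J∈ eq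
        with X₁ , Y₁ ← member₁ I∈ | X₁′ , Y₁′ ← member₁ J∈
        with X≡ , Z≡ , Y≡ ← decode-injective 1 X X′ (toList Z) (toList Z′) (toList Y) (toList Y′) 0
          (inj₁ (refl , trans (length-toList Z) (sym (trans (zeros≡ X) (cong (b ∸_) X₁)))
                      , trans (length-toList Z′) (sym (trans (zeros≡ X′) (cong (b ∸_) X₁′)))))
          (trans Y₁ (sym X₁)) (trans Y₁′ (sym X₁′)) (trans (length-toList Y) (sym (length-toList Y′))) eq =
        cong₂ _,_ (cong₂ _,_ X≡ (toList-injective Y Y′ Y≡)) (toList-injective Z Z′ Z≡)

      word₂-injective : ∀ {I J} → I ∈ indices₂ → J ∈ indices₂ → word₂ I ≡ word₂ J → I ≡ J
      word₂-injective {X , Y} {X′ , Y′} I∈ J∈ eq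
        with X₁ , Y₁ ← member₂ I∈ | X₁′ , Y₁′ ← member₂ J∈
        with X≡ , _ , Y≡ ← decode-injective 0 X X′ [] [] (toList Y) (toList Y′) 0 (inj₂ (refl , refl))
          (trans Y₁ (sym X₁)) (trans Y₁′ (sym X₁′)) (trans (length-toList Y) (sym (length-toList Y′))) eq =
        cong₂ _,_ X≡ (toList-injective Y Y′ Y≡)

      entries : ∀ {VW} → VW ∈ indices → (∀ i → i < m → nth none₁ (proj₁ VW) i ∈ indices₁) ×
                                        (∀ i → i < m * t → nth none₂ (proj₂ VW) i ∈ indices₂)
      entries VW∈ with V∈ , W∈ ← ∈-cartesianProduct⁻ (vectors indices₁ m) (vectors indices₂ (m * t)) VW∈ =
        (λ i i<m → nth-All {P = _∈ indices₁} (∈-vectors⁻ V∈) i i<m) ,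
        (λ i i<mt → nth-All {P = _∈ indices₂} (∈-vectors⁻ W∈) i i<mt)

      split : m * (2 + t) ≡ m + m + m * t
      split = lem m t
        where
        lem : ∀ m t → m * (2 + t) ≡ m + m + m * t
        lem = solve-∀

      later< : ∀ {i} → m + m + i < m * (2 + t) → i < m * t
      later< {i} lt = +-cancelˡ-< (m + m) i (m * t) (subst (m + m + i <_) split lt)

      fits : ∀ {VW} → VW ∈ indices → ∀ e → m ≤ e → e < m * (2 + t) →
             Fits b (Chunked.cap b m (chunk VW) e) (chunk VW e)
      fits {VW} VW∈ e m≤e e<n = go (e <? m + m)
        where
        module C = Chunked b m (chunk VW)
        go : Dec (e < m + m) → Fits b (C.cap e) (chunk VW e)
        go (yes e<2m) = subst₂ (λ c w → Fits b c (nth nothing w)) (sym (C.cap-row₁ e e<2m))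
          (trans (sym (chunks-row₁ VW (e ∸ m) i<m)) (cong (chunks VW) (m+[n∸m]≡n m≤e)))
          (fits₁ {nth none₁ (proj₁ VW) (e ∸ m)})
          where
          i<m : e ∸ m < m
          i<m = +-cancelˡ-< m (e ∸ m) m (subst (_< m + m) (sym (m+[n∸m]≡n m≤e)) e<2m)
        go (no e≮2m) = subst (λ c → Fits b c (chunk VW e)) (sym (C.cap-later e 2m≤e))
          (subst (λ w → Fits b (count (is-nothing ∘ nth nothing w) b) (nth nothing w))
            (trans (sym (chunks-later VW (e ∸ (m + m)))) (cong (chunks VW) (m+[n∸m]≡n 2m≤e)))
            (fits₂ (proj₂ (entries VW∈) (e ∸ (m + m))
                (later< (subst (_< m * (2 + t)) (sym (m+[n∸m]≡n 2m≤e)) e<n)))))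
          where 2m≤e = ≮⇒≥ e≮2m

      chunks-agree : ∀ VW VW′ → (∀ x → x < m * b * (2 + t) →
          Chunked.assembled b m (chunk VW) x ≡ Chunked.assembled b m (chunk VW′) x) →
        ∀ e → m ≤ e → e < m * (2 + t) → chunks VW e ≡ chunks VW′ e
      chunks-agree VW VW′ eq e m≤e e<n = nth-ext nothing _ _ λ r r<b →
        assembled-injective b m (2 + t) (chunk VW) (chunk VW′) eq e r m≤e e<n r<b

      injective : ∀ {VW VW′} → VW ∈ indices → VW′ ∈ indices → (∀ x → x < m * b * (2 + t) →
        Chunked.assembled b m (chunk VW) x ≡ Chunked.assembled b m (chunk VW′) x) → VW ≡ VW′
      injective {VW} {VW′} VW∈ VW′∈ eq = cong₂ _,_
        (nth-ext none₁ _ _ λ i i<m → word₁-injective (proj₁ (entries VW∈) i i<m) (proj₁ (entries VW′∈) i i<m)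
          (trans (sym (chunks-row₁ VW i i<m)) (trans (chunks-agree VW VW′ eq (m + i) (m≤m+n m i)
            (subst (m + i <_) (sym split) (<-≤-trans (+-monoʳ-< m i<m) (m≤m+n (m + m) (m * t)))))
            (chunks-row₁ VW′ i i<m))))
        (nth-ext none₂ _ _ λ i i<mt → word₂-injective (proj₂ (entries VW∈) i i<mt)
            (proj₂ (entries VW′∈) i i<mt)
          (trans (sym (chunks-later VW i)) (trans (chunks-agree VW VW′ eq (m + m + i)
              (≤-trans (m≤m+n m m) (m≤m+n (m + m) i))
            (subst (m + m + i <_) (sym split) (+-monoʳ-< (m + m) i<mt)))
            (chunks-later VW′ i))))

      #indices : length indices ≡ (#binary b a₁ * #binary b a₁ * 2 ^ (b ∸ a₁)) ^ m *
          (#binary b a₂ * #binary b a₂) ^ (m * t)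
      #indices = trans (length-cartesianProductWith _,_ (vectors indices₁ m) (vectors indices₂ (m * t)))
          (cong₂ _*_
        (trans (length-vectors indices₁ m) (cong (_^ m)
          (trans (length-cartesianProductWith _,_ (cartesianProduct (binary b a₁) (binary b a₁))
              (vectors bools (b ∸ a₁)))
            (cong₂ _*_ (length-cartesianProductWith _,_ (binary b a₁) (binary b a₁))
                (length-vectors bools (b ∸ a₁))))))
        (trans (length-vectors indices₂ (m * t)) (cong (_^ (m * t))
          (length-cartesianProductWith _,_ (binary b a₂) (binary b a₂)))))

    -- The assembled objects have slack b, so padding by b + b + 1 columns makes them exact. This
    -- number does not grow with the number `m` of chunks in a row.
    lower-count : (#binary b a₁ * #binary b a₁ * 2 ^ (b ∸ a₁)) ^ m * (#binary b a₂ * #binary b a₂) ^ (m * t) ≤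
                  #extensions (2 + t) (suc (b + b) + m * b)
    lower-count = ≤-trans (≤-reflexive (sym #indices))
      (relaxed-family (m * b) (b + b) b (2 + t) (*-mono-≤ 0<m (>-nonZero⁻¹ b)) ≤-refl indices
        (λ VW → Chunked.assembled b m (chunk VW))
        (cartesianProduct⁺ (unique-vectors (cartesianProduct⁺
            (cartesianProduct⁺ (unique-binary b a₁) (unique-binary b a₁))
          (unique-vectors unique-bools (b ∸ a₁))) m)
              (unique-vectors (cartesianProduct⁺ (unique-binary b a₂) (unique-binary b a₂)) (m * t)))
        (λ {VW} VW∈ → Chunked.assembled-relaxed b m (chunk VW) (2 + t) 0<m (fits VW∈))
        injective)

  -- Exponential estimates in the natural numbers.

  -- The inequality 1 + k / X ≤ (1 + 1 / X) ^ k, cleared of denominators; X < Y gives 1 + 1 / X ≤ Y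
  -- / X.
  bernoulli : ∀ X Y k → X < Y → (X + k) * X ^ k ≤ X * Y ^ k
  bernoulli X Y zero    X<Y = ≤-reflexive (cong (_* 1) (+-identityʳ X))
  bernoulli X Y (suc k) X<Y = begin
    (X + suc k) * (X * X ^ k)     ≡⟨ lem₁ X k (X ^ k) ⟩
    (X * X + X * k + X) * X ^ k   ≤⟨ *-monoˡ-≤ (X ^ k) (m≤m+n (X * X + X * k + X) k) ⟩
    (X * X + X * k + X + k) * X ^ k ≡⟨ lem₂ X k (X ^ k) ⟩
    suc X * ((X + k) * X ^ k)     ≤⟨ *-mono-≤ X<Y (bernoulli X Y k X<Y) ⟩
    Y * (X * Y ^ k)               ≡⟨ lem₃ X Y (Y ^ k) ⟩
    X * (Y * Y ^ k)               ∎
    where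
    open ≤-Reasoning
    lem₁ : ∀ X k Z → (X + suc k) * (X * Z) ≡ (X * X + X * k + X) * Z
    lem₁ = solve-∀
    lem₂ : ∀ X k Z → (X * X + X * k + X + k) * Z ≡ suc X * ((X + k) * Z)
    lem₂ = solve-∀
    lem₃ : ∀ X Y Z → Y * (X * Z) ≡ X * (Y * Z)
    lem₃ = solve-∀

  -- The tool for absorbing constants: however close two bases are, a high enough power of the
  -- larger one has a factor `c` to spare.
  power-gap : ∀ {X Y} c k → 0 < X → X < Y → X * c ≤ k → X ^ k * c ≤ Y ^ k
  power-gap {X} {Y} c k 0<X X<Y big = *-cancelˡ-≤ X {{>-nonZero 0<X}} (begin
    X * (X ^ k * c)    ≡⟨ lem X (X ^ k) c ⟩
    X * c * X ^ k      ≤⟨ *-monoˡ-≤ (X ^ k) (≤-trans big (m≤n+m k X)) ⟩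
    (X + k) * X ^ k    ≤⟨ bernoulli X Y k X<Y ⟩
    X * Y ^ k          ∎)
    where
    open ≤-Reasoning
    lem : ∀ X Z c → X * (Z * c) ≡ X * c * Z
    lem = solve-∀

  n<2^n : ∀ n → n < 2 ^ n
  n<2^n zero    = z<s
  n<2^n (suc n) = begin-strict
    suc n            <⟨ s<s (n<2^n n) ⟩
    suc (2 ^ n)      ≤⟨ +-monoˡ-≤ (2 ^ n) (m^n>0 2 n) ⟩
    2 ^ n + 2 ^ n    ≡⟨ cong (2 ^ n +_) (+-identityʳ (2 ^ n)) ⟨
    2 ^ suc n        ∎
    where open ≤-Reasoning

  ≤-quotient : ∀ {m n} d .{{_ : NonZero d}} → n * d ≤ m → n ≤ m / d
  ≤-quotient {m} {n} d le = ≤-pred (*-cancelʳ-< d n (suc (m / d)) (≤-<-trans le (<-next-multiple m d)))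

  -- Split 2 ^ m into D + 1 factors 2 ^ μ with μ = m / (D + 1): D of them beat the D-th power of μ +
  -- 1, and the last one beats the constant.
  exponential-beats-polynomial : ∀ K D → ∃[ m₀ ] (∀ m → m₀ ≤ m → K * suc m ^ D < 2 ^ m)
  exponential-beats-polynomial K D = G * suc D , λ m m₀≤m → let μ = m / suc D in begin-strict
      K * suc m ^ D                        ≤⟨ *-monoʳ-≤ K (^-monoˡ-≤ D (<-next-multiple m (suc D))) ⟩
      K * (suc μ * suc D) ^ D              ≤⟨ *-monoʳ-≤ K (^-monoˡ-≤ D (*-monoˡ-≤ (suc D) (n<2^n μ))) ⟩
      K * (2 ^ μ * suc D) ^ D              ≡⟨ cong (K *_) (^-distribʳ-* D (2 ^ μ) (suc D)) ⟩
      K * ((2 ^ μ) ^ D * suc D ^ D)        ≡⟨ lem K ((2 ^ μ) ^ D) (suc D ^ D) ⟩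
      (2 ^ μ) ^ D * G                      <⟨ *-monoʳ-< ((2 ^ μ) ^ D) {{m^n≢0 (2 ^ μ) D {{m^n≢0 2 μ}}}}
                                                (≤-<-trans (≤-quotient (suc D) m₀≤m) (n<2^n μ)) ⟩
      (2 ^ μ) ^ D * 2 ^ μ                  ≡⟨ *-comm ((2 ^ μ) ^ D) (2 ^ μ) ⟩
      (2 ^ μ) ^ suc D                      ≡⟨ ^-*-assoc 2 μ (suc D) ⟩
      2 ^ (μ * suc D)                      ≤⟨ ^-monoʳ-≤ 2 (m/n*n≤m m (suc D)) ⟩
      2 ^ m                                ∎
    where
    open ≤-Reasoning
    G = K * suc D ^ D
    lem : ∀ K a d → K * (a * d) ≡ a * (K * d)
    lem = solve-∀

  -- The analogue of Fekete's lemma.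

  module _ (t : ℕ) where

    -- (p/q)^N ≤ A₃₂₁ (Kᵅ N t)
    Below : ℕ → ℕ → ℕ → Set
    Below p q N = p ^ N ≤ #extensions t N * q ^ N

    Frequently Eventually : (ℕ → Set) → Set
    Frequently P = ∀ N₀ → ∃[ N ] (N₀ ≤ N × P N)
    Eventually P = ∃[ N₀ ] (∀ N → N₀ ≤ N → P N)

    module _ (0<t : 0 < t) {p q p′ q′ : ℕ} (0<q : 0 < q) (0<q′ : 0 < q′) (lt : p′ * q < p * q′)
             (often : Frequently (Below p q)) where

      private
        0<p : 0 < p
        0<p = n≢0⇒n>0 λ { refl → contradiction lt λ () }

        classes : ℕ → (b : ℕ) → .{{_ : NonZero b}} → ℕ
        classes s b = suc (suc (s * t)) ^ (s * t / b) * suc (suc (s * t)) ^ (s * t / b)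

        -- For a rate of at most one it suffices that words exist for every large width, which
        -- follows from one width with k = b = 1. The other case relies on q′ ≤ p′ when `M` is
        -- rounded up.
        module Small (p′≤q′ : p′ ≤ q′) where

          eventually : Eventually (Below p′ q′)
          eventually = s + 9 , λ M s+9≤M → begin
              p′ ^ M        ≤⟨ ^-monoˡ-≤ M p′≤q′ ⟩
              q′ ^ M        ≤⟨ m≤m*n (q′ ^ M) (#extensions t M) {{>-nonZero (positive M s+9≤M)}} ⟩
              q′ ^ M * #extensions t M  ≡⟨ *-comm (q′ ^ M) (#extensions t M) ⟩
              #extensions t M * q′ ^ M  ∎
            where
            open ≤-Reasoning
            s = proj₁ (often 1)
            0<s = proj₁ (proj₂ (often 1))
            0<As : 0 < #extensions t s
            0<As = n≢0⇒n>0 λ eq → <⇒≱ (m^n>0 p {{>-nonZero 0<p}} s)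
              (≤-trans (proj₂ (proj₂ (often 1))) (≤-reflexive (cong (_* q ^ s) eq)))
            positive : ∀ M → s + 9 ≤ M → 0 < #extensions t M
            positive M s+9≤M = n≢0⇒n>0 λ eq → <⇒≱ 0<As
                (≤-trans (≤-reflexive (sym (^-identityʳ (#extensions t s))))
              (≤-trans (supermultiplicative s t 1 0<s 0<t 1 M ≤-refl
                  (≤-trans (≤-reflexive (+-identityʳ (s + 9))) s+9≤M))
                (≤-reflexive (trans (cong (classes s 1 ^ 1 *_) eq) (*-zeroʳ (classes s 1 ^ 1))))))

        module Large (q′≤p′ : q′ ≤ p′) where

          open ≤-Reasoning
          0<p′ = <-≤-trans 0<q′ q′≤p′

          -- The conclusion from one s for which the loss (classes and padding) is
          -- smaller than the gain.
          module From (s b : ℕ) .{{_ : NonZero b}} (0<s : 0 < s) (good : Below p q s) where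
            Q = s + 9 * b
            C = classes s b
            -- X < Y says that C (p′/q′) ^ Q < (p/q) ^ s: the gain at width s exceeds the number of
            -- classes together with the cost of widening s to `Q`.
            X = p′ ^ Q * C * q ^ s
            Y = q′ ^ Q * p ^ s

            module _ (X<Y : X < Y) (0<X : 0 < X) where

              module _ (M : ℕ) (big : suc (X * p′ ^ Q) * Q ≤ M) where
                0<Q : 0 < Q
                0<Q = ≤-trans 0<s (m≤m+n s _)
                instance Q≢0 = >-nonZero 0<Q
                k = M / Q
                k≥ : suc (X * p′ ^ Q) ≤ k
                k≥ = ≤-quotient Q big
                -- Only k blocks of width `Q` are used, but `M` may reach almost to the end of one
                -- more. Rounding up to `R` costs one more p′ ^ Q, which `power-gap` supplies
                -- because k is at least X * p′ ^ Q.
                R = suc k * Q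
                e = R ∸ M
                M+e = m+[n∸m]≡n (<⇒≤ (<-next-multiple M Q))
                D = C ^ k * q ^ (s * k)

                chain₁ : p′ ^ M * (q′ ^ R * D) ≤ p′ ^ R * D * q′ ^ M
                chain₁ = begin
                  p′ ^ M * (q′ ^ R * D)            ≡⟨ cong (λ z → p′ ^ M * (q′ ^ z * D)) M+e ⟨
                  p′ ^ M * (q′ ^ (M + e) * D)      ≡⟨ cong (λ z → p′ ^ M * (z * D)) (^-distribˡ-+-* q′ M e) ⟩
                  p′ ^ M * (q′ ^ M * q′ ^ e * D)   ≤⟨ *-monoʳ-≤ (p′ ^ M)
                      (*-monoˡ-≤ D (*-monoʳ-≤ (q′ ^ M) (^-monoˡ-≤ e q′≤p′))) ⟩
                  p′ ^ M * (q′ ^ M * p′ ^ e * D)   ≡⟨ lem (p′ ^ M) (q′ ^ M) (p′ ^ e) D ⟩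
                  p′ ^ M * p′ ^ e * D * q′ ^ M     ≡⟨ cong (λ z → z * D * q′ ^ M) (^-distribˡ-+-* p′ M e) ⟨
                  p′ ^ (M + e) * D * q′ ^ M        ≡⟨ cong (λ z → p′ ^ z * D * q′ ^ M) M+e ⟩
                  p′ ^ R * D * q′ ^ M              ∎
                  where
                  lem : ∀ a b c d → a * (b * c * d) ≡ a * c * d * b
                  lem = solve-∀

                X^k : p′ ^ R * D ≡ X ^ k * p′ ^ Q
                X^k = begin-equality
                  p′ ^ (Q + k * Q) * D                     ≡⟨ cong (_* D) (^-distribˡ-+-* p′ Q (k * Q)) ⟩
                  p′ ^ Q * p′ ^ (k * Q) * (C ^ k * q ^ (s * k)) ≡⟨ cong₂ (λ i j → p′ ^ Q * i * (C ^ k * j))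
                       (trans (cong (p′ ^_) (*-comm k Q)) (sym (^-*-assoc p′ Q k))) (sym (^-*-assoc q s k)) ⟩
                  p′ ^ Q * (p′ ^ Q) ^ k * (C ^ k * (q ^ s) ^ k) ≡⟨ lem (p′ ^ Q) ((p′ ^ Q) ^ k) (C ^ k)
                      ((q ^ s) ^ k) ⟩
                  (p′ ^ Q) ^ k * C ^ k * (q ^ s) ^ k * p′ ^ Q ≡⟨ cong (λ z → z * (q ^ s) ^ k * p′ ^ Q)
                      (^-distribʳ-* k (p′ ^ Q) C) ⟨
                  (p′ ^ Q * C) ^ k * (q ^ s) ^ k * p′ ^ Q  ≡⟨ cong (_* p′ ^ Q)
                      (^-distribʳ-* k (p′ ^ Q * C) (q ^ s)) ⟨
                  X ^ k * p′ ^ Q                           ∎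
                  where
                  lem : ∀ a b c d → a * b * (c * d) ≡ b * c * d * a
                  lem = solve-∀

                chain₂ : Y ^ k ≤ q′ ^ (Q * k) * (C ^ k * #extensions t M * q ^ (s * k))
                chain₂ = begin
                  (q′ ^ Q * p ^ s) ^ k                  ≡⟨ ^-distribʳ-* k (q′ ^ Q) (p ^ s) ⟩
                  (q′ ^ Q) ^ k * (p ^ s) ^ k            ≤⟨ *-mono-≤ (≤-reflexive (^-*-assoc q′ Q k))
                      (^-monoˡ-≤ k good) ⟩
                  q′ ^ (Q * k) * (#extensions t s * q ^ s) ^ k      ≡⟨ cong (q′ ^ (Q * k) *_)
                      (trans (^-distribʳ-* k (#extensions t s) (q ^ s))
                                                             (cong (#extensions t s ^ k *_) (^-*-assoc q s
                                                                 k))) ⟩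
                  q′ ^ (Q * k) * (#extensions t s ^ k * q ^ (s * k)) ≤⟨ *-monoʳ-≤ (q′ ^ (Q * k))
                      (*-monoˡ-≤ (q ^ (s * k))
                       (supermultiplicative s t b 0<s 0<t k M (≤-trans (s≤s z≤n) k≥) (m/n*n≤m M Q))) ⟩
                  q′ ^ (Q * k) * (C ^ k * #extensions t M * q ^ (s * k)) ∎

                conclusion : Below p′ q′ M
                conclusion = *-cancelʳ-≤ (p′ ^ M) (#extensions t M * q′ ^ M) (q′ ^ R * D) {{nz}} (begin
                  p′ ^ M * (q′ ^ R * D)       ≤⟨ chain₁ ⟩
                  p′ ^ R * D * q′ ^ M         ≡⟨ cong (_* q′ ^ M) X^k ⟩
                  X ^ k * p′ ^ Q * q′ ^ M     ≤⟨ *-monoˡ-≤ (q′ ^ M)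
                      (≤-trans (power-gap (p′ ^ Q) k 0<X X<Y (<⇒≤ k≥)) chain₂) ⟩
                  q′ ^ (Q * k) * (C ^ k * #extensions t M * q ^ (s * k)) * q′ ^ M
                    ≤⟨ *-monoˡ-≤ (q′ ^ M) (*-monoˡ-≤ _ (^-monoʳ-≤ q′ {{>-nonZero 0<q′}}
                         (≤-trans (≤-reflexive (*-comm Q k)) (m≤n+m (k * Q) Q)))) ⟩
                  q′ ^ R * (C ^ k * #extensions t M * q ^ (s * k)) * q′ ^ M ≡⟨ lem (q′ ^ R) (C ^ k)
                      (#extensions t M) (q ^ (s * k)) (q′ ^ M) ⟩
                  #extensions t M * q′ ^ M * (q′ ^ R * D) ∎)
                  where
                  lem : ∀ r c a z m → r * (c * a * z) * m ≡ a * m * (r * (c * z))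
                  lem = solve-∀
                  0<C : 0 < C
                  0<C = *-mono-≤ (m^n>0 (suc (suc (s * t))) (s * t / b))
                      (m^n>0 (suc (suc (s * t))) (s * t / b))
                  nz : NonZero (q′ ^ R * D)
                  nz = >-nonZero (*-mono-≤ (m^n>0 q′ {{>-nonZero 0<q′}} R)
                    (*-mono-≤ (m^n>0 C {{>-nonZero 0<C}} k) (m^n>0 q {{>-nonZero 0<q}} (s * k))))

          private
            a = p′ * q
            c = p * q′
            0<a : 0 < a
            0<a = *-mono-≤ 0<p′ 0<q
            -- Each unit of b costs p′ ^ 9 through the 9 * b in `Q`, and the further factor 2 per
            -- unit is there to beat the number of classes. By `power-gap` an exponent h = a * G is
            -- enough for a < c to gain the factor `G`.
            G = p′ ^ 9 * 2
            h = a * G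
            0<h : 0 < h
            0<h = *-mono-≤ 0<a (*-mono-≤ (m^n>0 p′ {{>-nonZero 0<p′}} 9) (s≤s (z≤n {1})))
            instance h≢0 = >-nonZero 0<h
            F = h * t
            beat = exponential-beats-polynomial (p′ ^ 9 * (F + 2) ^ (F + F)) (F + F)
            m₀ = proj₁ beat
            found = often (suc (m₀ * h))
            s = proj₁ found
            s≥ = proj₁ (proj₂ found)
            0<s : 0 < s
            0<s = ≤-trans (s≤s z≤n) s≥
            m = s / h
            m≥m₀ : m₀ ≤ m
            m≥m₀ = ≤-quotient h (<⇒≤ s≥)
            -- With b slightly above s / h for a fixed h, the codes have length at most `F`, so the
            -- number of classes is at most a polynomial in b of degree F + F.
            b = suc m
            n = s * t
            s<hb : s < b * h
            s<hb = <-next-multiple s h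
            n≤ : n ≤ F * b
            n≤ = ≤-trans (*-monoˡ-≤ t (<⇒≤ s<hb)) (≤-reflexive (lem b h t))
              where
              lem : ∀ b h t → b * h * t ≡ h * t * b
              lem = solve-∀
            V≤ : n / b ≤ F
            V≤ = ≤-trans (/-monoˡ-≤ b n≤) (≤-reflexive (m*n/n≡m F b))
            base≤ : suc (suc n) ≤ (F + 2) * b
            base≤ = begin
              2 + n           ≤⟨ +-mono-≤ (*-monoʳ-≤ 2 (s≤s (z≤n {m}))) n≤ ⟩
              2 * b + F * b   ≡⟨ lem F b ⟩
              (F + 2) * b     ∎
              where
              lem : ∀ F b → 2 * b + F * b ≡ (F + 2) * b
              lem = solve-∀
            C≤ : classes s b ≤ (F + 2) ^ (F + F) * b ^ (F + F)
            C≤ = begin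
              suc (suc n) ^ (n / b) * suc (suc n) ^ (n / b) ≡⟨ ^-distribˡ-+-* (suc (suc n)) (n / b) (n / b) ⟨
              suc (suc n) ^ (n / b + n / b)                ≤⟨ ^-monoʳ-≤ (suc (suc n)) (+-mono-≤ V≤ V≤) ⟩
              suc (suc n) ^ (F + F)                        ≤⟨ ^-monoˡ-≤ (F + F) base≤ ⟩
              ((F + 2) * b) ^ (F + F)                      ≡⟨ ^-distribʳ-* (F + F) (F + 2) b ⟩
              (F + 2) ^ (F + F) * b ^ (F + F)              ∎
            r = s % h
            s≡ : h * m + r ≡ s
            s≡ = trans (+-comm (h * m) r) (trans (cong (r +_) (*-comm h m)) (sym (m≡m%n+[m/n]*n s h)))
            c^s≥ : a ^ s * ((p′ ^ 9) ^ m * 2 ^ m) ≤ c ^ s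
            c^s≥ = begin
              a ^ s * ((p′ ^ 9) ^ m * 2 ^ m)              ≡⟨ cong₂ (λ i j → a ^ i * j) (sym s≡)
                  (sym (^-distribʳ-* m (p′ ^ 9) 2)) ⟩
              a ^ (h * m + r) * G ^ m                     ≡⟨ cong (_* G ^ m)
                  (trans (^-distribˡ-+-* a (h * m) r) (cong (_* a ^ r) (sym (^-*-assoc a h m)))) ⟩
              (a ^ h) ^ m * a ^ r * G ^ m                 ≡⟨ lem ((a ^ h) ^ m) (a ^ r) (G ^ m) ⟩
              (a ^ h) ^ m * G ^ m * a ^ r                 ≡⟨ cong (_* a ^ r) (^-distribʳ-* m (a ^ h) G) ⟨
              (a ^ h * G) ^ m * a ^ r                     ≤⟨ *-mono-≤
                  (^-monoˡ-≤ m (power-gap G h 0<a lt ≤-refl)) (^-monoˡ-≤ r (<⇒≤ lt)) ⟩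
              (c ^ h) ^ m * c ^ r                         ≡⟨ cong (_* c ^ r) (^-*-assoc c h m) ⟩
              c ^ (h * m) * c ^ r                         ≡⟨ ^-distribˡ-+-* c (h * m) r ⟨
              c ^ (h * m + r)                             ≡⟨ cong (c ^_) s≡ ⟩
              c ^ s                                       ∎
              where
              lem : ∀ a b c → a * b * c ≡ a * c * b
              lem = solve-∀
            open From s b 0<s (proj₂ (proj₂ found))
            X≡ : X ≡ a ^ s * ((p′ ^ 9) ^ m * (p′ ^ 9 * C))
            X≡ = begin-equality
              p′ ^ (s + 9 * b) * C * q ^ s                 ≡⟨ cong (λ z → z * C * q ^ s)
                  (trans (^-distribˡ-+-* p′ s (9 * b)) (cong (p′ ^ s *_) (sym (^-*-assoc p′ 9 b)))) ⟩
              p′ ^ s * (p′ ^ 9 * (p′ ^ 9) ^ m) * C * q ^ s ≡⟨ lem (p′ ^ s) (p′ ^ 9) ((p′ ^ 9) ^ m) C (q ^ s) ⟩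
              p′ ^ s * q ^ s * ((p′ ^ 9) ^ m * (p′ ^ 9 * C)) ≡⟨ cong (_* ((p′ ^ 9) ^ m * (p′ ^ 9 * C)))
                  (^-distribʳ-* s p′ q) ⟨
              a ^ s * ((p′ ^ 9) ^ m * (p′ ^ 9 * C))        ∎
              where
              lem : ∀ x y z c w → x * (y * z) * c * w ≡ x * w * (z * (y * c))
              lem = solve-∀
            X<Y : X < Y
            X<Y = begin-strict
              X                                       ≡⟨ X≡ ⟩
              a ^ s * ((p′ ^ 9) ^ m * (p′ ^ 9 * C))   <⟨ *-monoʳ-< (a ^ s) {{m^n≢0 a s {{>-nonZero 0<a}}}}
                                                           (*-monoʳ-< ((p′ ^ 9) ^ m) {{m^n≢0 (p′ ^ 9) m
                                                               {{m^n≢0 p′ 9 {{>-nonZero 0<p′}}}}}} small) ⟩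
              a ^ s * ((p′ ^ 9) ^ m * 2 ^ m)          ≤⟨ c^s≥ ⟩
              (p * q′) ^ s                            ≡⟨ ^-distribʳ-* s p q′ ⟩
              p ^ s * q′ ^ s                          ≤⟨ *-monoʳ-≤ (p ^ s)
                  (^-monoʳ-≤ q′ {{>-nonZero 0<q′}} (m≤m+n s (9 * b))) ⟩
              p ^ s * q′ ^ Q                          ≡⟨ *-comm (p ^ s) _ ⟩
              Y                                       ∎
              where
              small : p′ ^ 9 * C < 2 ^ m
              small = begin-strict
                p′ ^ 9 * C                                   ≤⟨ *-monoʳ-≤ (p′ ^ 9) C≤ ⟩
                p′ ^ 9 * ((F + 2) ^ (F + F) * b ^ (F + F))   ≡⟨ *-assoc (p′ ^ 9) _ _ ⟨
                p′ ^ 9 * (F + 2) ^ (F + F) * b ^ (F + F)     <⟨ proj₂ beat m m≥m₀ ⟩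
                2 ^ m                                        ∎
            0<X : 0 < X
            0<X = *-mono-≤ (*-mono-≤ (m^n>0 p′ {{>-nonZero 0<p′}} Q)
              (*-mono-≤ (m^n>0 (suc (suc n)) (n / b)) (m^n>0 (suc (suc n)) (n / b))))
                  (m^n>0 q {{>-nonZero 0<q}} s)

          eventually : Eventually (Below p′ q′)
          eventually = suc (X * p′ ^ Q) * Q , conclusion X<Y 0<X

      -- A rate reached infinitely often forces every smaller rate to be reached eventually, so the
      -- upper and the lower limit of the roots agree.
      fekete : Eventually (Below p′ q′)
      fekete with ≤-total p′ q′
      ... | inj₁ p′≤q′ = Small.eventually p′≤q′
      ... | inj₂ q′≤p′ = Large.eventually q′≤p′

  -- The number of choices for a chunk.

  #binary-empty : ∀ {b a} → b < a → #binary b a ≡ 0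
  #binary-empty {b} {a} b<a with binary b a in eq
  ... | []    = refl
  ... | X ∷ _ = contradiction (≤-trans (≤-reflexive (sym (∈-binary (subst (X ∈_) (sym eq) (here refl)))))
    (≤-trans (m≤m+n (onesᵛ X) _) (≤-reflexive (trans (ones+zeros (toList X)) (length-toList X))))) (<⇒≱ b<a)

  ^2-* : ∀ x b → x ^ b * x ^ b ≡ (x * x) ^ b
  ^2-* x b = sym (^-distribʳ-* b x x)

  -- With √2 for P / Q, the sum over a of C(b,a) √2 ^ (b - a) is (1 + √2) ^ b. Squaring its largest
  -- term turns the powers of √2 into the 2 ^ (b - a) free colours of the second row. Since P / Q ≤
  -- √2, replacing P * P by 2 * (Q * Q) goes in the right direction.
  many-squares : ∀ b P Q → 0 < Q → P * P ≤ 2 * (Q * Q) → ∃[ a ]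
    ((P + Q) * (P + Q)) ^ b ≤ suc b * suc b * (#binary b a * #binary b a * 2 ^ (b ∸ a)) * (Q * Q) ^ b
  many-squares b P Q 0<Q P²≤2Q² = a , (begin
      ((P + Q) * (P + Q)) ^ b                       ≡⟨ ^2-* (P + Q) b ⟨
      (P + Q) ^ b * (P + Q) ^ b                     ≤⟨ *-mono-≤ le le ⟩
      suc b * (B * (P ^ κ * Q ^ a)) * (suc b * (B * (P ^ κ * Q ^ a))) ≡⟨ lem₁ (suc b) B (P ^ κ) (Q ^ a) ⟩
      suc b * suc b * (B * B) * (P ^ κ * P ^ κ) * (Q ^ a * Q ^ a)
        ≤⟨ *-monoˡ-≤ (Q ^ a * Q ^ a) (*-monoʳ-≤ (suc b * suc b * (B * B)) (begin
             P ^ κ * P ^ κ            ≡⟨ ^2-* P κ ⟩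
             (P * P) ^ κ              ≤⟨ ^-monoˡ-≤ κ P²≤2Q² ⟩
             (2 * (Q * Q)) ^ κ        ≡⟨ ^-distribʳ-* κ 2 (Q * Q) ⟩
             2 ^ κ * (Q * Q) ^ κ      ≡⟨ cong (2 ^ κ *_) (^2-* Q κ) ⟨
             2 ^ κ * (Q ^ κ * Q ^ κ)  ∎)) ⟩
      suc b * suc b * (B * B) * (2 ^ κ * (Q ^ κ * Q ^ κ)) * (Q ^ a * Q ^ a)
        ≡⟨ lem₂ (suc b) B (2 ^ κ) (Q ^ κ) (Q ^ a) ⟩
      suc b * suc b * (B * B * 2 ^ κ) * (Q ^ κ * Q ^ a * (Q ^ κ * Q ^ a))
        ≡⟨ cong (λ z → suc b * suc b * (B * B * 2 ^ κ) * (z * z))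
            (trans (sym (^-distribˡ-+-* Q κ a)) (cong (Q ^_) (m∸n+n≡m a≤b))) ⟩
      suc b * suc b * (B * B * 2 ^ κ) * (Q ^ b * Q ^ b) ≡⟨ cong (suc b * suc b * (B * B * 2 ^ κ) *_)
          (^2-* Q b) ⟩
      suc b * suc b * (B * B * 2 ^ κ) * (Q * Q) ^ b ∎)
    where
    open ≤-Reasoning
    a = proj₁ (popular-weight b P Q)
    le = proj₂ (popular-weight b P Q)
    κ = b ∸ a
    B = #binary b a
    lem₁ : ∀ s B x y → s * (B * (x * y)) * (s * (B * (x * y))) ≡ s * s * (B * B) * (x * x) * (y * y)
    lem₁ = solve-∀
    lem₂ : ∀ s B w x y → s * s * (B * B) * (w * (x * x)) * (y * y) ≡ s * s * (B * B * w) * (x * y * (x * y))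
    lem₂ = solve-∀
    -- The subtraction b ∸ a is truncated. For a > b there are no words with a ones, which would
    -- contradict the lower bound on their weight.
    a≤b : a ≤ b
    a≤b = ≮⇒≥ λ b<a → <⇒≱ (m^n>0 (P + Q) {{>-nonZero (<-≤-trans 0<Q (m≤n+m Q P))}} b)
      (≤-trans le (≤-reflexive (trans (cong (λ z → suc b * (z * (P ^ κ * Q ^ a))) (#binary-empty b<a))
          (*-zeroʳ (suc b)))))

  many-pairs : ∀ b → ∃[ a ] 4 ^ b ≤ suc b * suc b * (#binary b a * #binary b a)
  many-pairs b = a , (begin
      4 ^ b                       ≡⟨ ^2-* 2 b ⟨
      2 ^ b * 2 ^ b               ≤⟨ *-mono-≤ le le ⟩
      suc b * (B * (1 ^ (b ∸ a) * 1 ^ a)) * (suc b * (B * (1 ^ (b ∸ a) * 1 ^ a)))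
        ≡⟨ cong (λ z → suc b * (B * z) * (suc b * (B * z))) (cong₂ _*_ (^-zeroˡ (b ∸ a)) (^-zeroˡ a)) ⟩
      suc b * (B * 1) * (suc b * (B * 1)) ≡⟨ lem (suc b) B ⟩
      suc b * suc b * (B * B)     ∎)
    where
    open ≤-Reasoning
    a = proj₁ (popular-weight b 1 1)
    le = proj₂ (popular-weight b 1 1)
    B = #binary b a
    lem : ∀ s B → s * (B * 1) * (s * (B * 1)) ≡ s * s * (B * B)
    lem = solve-∀

  -- Growth rates from below and from above.

  module _ (t p q P Q : ℕ) (0<p : 0 < p) (0<q : 0 < q) (0<Q : 0 < Q) (P²≤2Q² : P * P ≤ 2 * (Q * Q))
           (lt : p * (Q * Q) < q * (4 ^ t * ((P + Q) * (P + Q)))) where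

    private
      open ≤-Reasoning
      W = (P + Q) * (P + Q)
      X₀ = p * (Q * Q)
      Y₀ = q * (4 ^ t * W)
      0<X₀ : 0 < X₀
      0<X₀ = *-mono-≤ 0<p (*-mono-≤ 0<Q 0<Q)
      -- By `power-gap` the h-th powers of `X₀` and `Y₀` differ by a factor of at least 2. For b = h
      -- * μ this yields 2 ^ μ, which exceeds the loss `E`, a power of b + 1 with fixed exponent.
      h = X₀ * 2
      0<h : 0 < h
      0<h = *-mono-≤ 0<X₀ (s≤s (z≤n {1}))
      D = suc t + suc t
      beat = exponential-beats-polynomial (h ^ D) D
      μ = suc (proj₁ beat)
      b = h * μ
      0<b : 0 < b
      0<b = *-mono-≤ 0<h (s≤s z≤n)
      instance b≢0 = >-nonZero 0<b
      S = suc b * suc b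
      E = S ^ suc t

      E<2^μ : E < 2 ^ μ
      E<2^μ = begin-strict
        (suc b * suc b) ^ suc t         ≡⟨ ^2-* (suc b) (suc t) ⟨
        suc b ^ suc t * suc b ^ suc t   ≡⟨ ^-distribˡ-+-* (suc b) (suc t) (suc t) ⟨
        suc b ^ D                       ≤⟨ ^-monoˡ-≤ D
            (≤-trans (+-monoˡ-≤ b 0<h) (≤-reflexive (sym (*-suc h μ)))) ⟩
        (h * suc μ) ^ D                 ≡⟨ ^-distribʳ-* D h (suc μ) ⟩
        h ^ D * suc μ ^ D               <⟨ proj₂ beat μ (n≤1+n _) ⟩
        2 ^ μ                           ∎

      a₁ = proj₁ (many-squares b P Q 0<Q P²≤2Q²)
      a₂ = proj₁ (many-pairs b)
      Φ₁ = #binary b a₁ * #binary b a₁ * 2 ^ (b ∸ a₁)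
      Φ₂ = #binary b a₂ * #binary b a₂
      Φ = Φ₁ * Φ₂ ^ t

      Y^b≤ : (4 ^ t * W) ^ b ≤ E * (Φ * (Q * Q) ^ b)
      Y^b≤ = begin
        (4 ^ t * W) ^ b                      ≡⟨ ^-distribʳ-* b (4 ^ t) W ⟩
        (4 ^ t) ^ b * W ^ b                  ≡⟨ cong (_* W ^ b)
            (trans (^-*-assoc 4 t b) (trans (cong (4 ^_) (*-comm t b)) (sym (^-*-assoc 4 b t)))) ⟩
        (4 ^ b) ^ t * W ^ b                  ≤⟨ *-mono-≤ (^-monoˡ-≤ t (proj₂ (many-pairs b)))
            (proj₂ (many-squares b P Q 0<Q P²≤2Q²)) ⟩
        (S * Φ₂) ^ t * (S * Φ₁ * (Q * Q) ^ b) ≡⟨ cong (_* (S * Φ₁ * (Q * Q) ^ b)) (^-distribʳ-* t S Φ₂) ⟩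
        S ^ t * Φ₂ ^ t * (S * Φ₁ * (Q * Q) ^ b) ≡⟨ lem (S ^ t) (Φ₂ ^ t) S Φ₁ ((Q * Q) ^ b) ⟩
        E * (Φ * (Q * Q) ^ b)                ∎
        where
        lem : ∀ x y s f z → x * y * (s * f * z) ≡ s * x * (f * y * z)
        lem = solve-∀

      gap : p ^ b < q ^ b * Φ
      gap = *-cancelʳ-< (E * (Q * Q) ^ b) (p ^ b) (q ^ b * Φ) (begin-strict
        p ^ b * (E * (Q * Q) ^ b)          ≡⟨ lem₁ (p ^ b) E ((Q * Q) ^ b) ⟩
        p ^ b * (Q * Q) ^ b * E            ≡⟨ cong (_* E) (^-distribʳ-* b p (Q * Q)) ⟨
        X₀ ^ b * E                         <⟨ *-monoʳ-< (X₀ ^ b) {{m^n≢0 X₀ b {{>-nonZero 0<X₀}}}} E<2^μ ⟩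
        X₀ ^ (h * μ) * 2 ^ μ               ≡⟨ cong (_* 2 ^ μ) (^-*-assoc X₀ h μ) ⟨
        (X₀ ^ h) ^ μ * 2 ^ μ               ≡⟨ ^-distribʳ-* μ (X₀ ^ h) 2 ⟨
        (X₀ ^ h * 2) ^ μ                   ≤⟨ ^-monoˡ-≤ μ (power-gap 2 h 0<X₀ lt ≤-refl) ⟩
        (Y₀ ^ h) ^ μ                       ≡⟨ ^-*-assoc Y₀ h μ ⟩
        Y₀ ^ b                             ≡⟨ ^-distribʳ-* b q (4 ^ t * W) ⟩
        q ^ b * (4 ^ t * W) ^ b            ≤⟨ *-monoʳ-≤ (q ^ b) Y^b≤ ⟩
        q ^ b * (E * (Φ * (Q * Q) ^ b))    ≡⟨ lem₂ (q ^ b) E Φ ((Q * Q) ^ b) ⟩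
        q ^ b * Φ * (E * (Q * Q) ^ b)      ∎)
        where
        lem₁ : ∀ x e z → x * (e * z) ≡ x * z * e
        lem₁ = solve-∀
        lem₂ : ∀ x e f z → x * (e * (f * z)) ≡ x * f * (e * z)
        lem₂ = solve-∀

    -- `gap` compares one chunk position, taken over all rows, with p / q and is strict. Hence with
    -- enough chunks per row the excess outweighs `c`, the cost of the fixed number of padded
    -- columns.
    lower-growth : Frequently (2 + t) (Below (2 + t) p q)
    lower-growth N₀ = N , N₀≤N , (begin
        p ^ (suc (b + b) + m * b)          ≡⟨ trans (^-distribˡ-+-* p (suc (b + b)) (m * b))
            (*-comm c (p ^ (m * b))) ⟩
        p ^ (m * b) * c                    ≡⟨ cong (_* c)
            (trans (cong (p ^_) (*-comm m b)) (sym (^-*-assoc p b m))) ⟩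
        (p ^ b) ^ m * c                    ≤⟨ power-gap c m (m^n>0 p {{>-nonZero 0<p}} b) gap
            (≤-trans (n≤1+n _) (m≤m+n _ N₀)) ⟩
        (q ^ b * Φ) ^ m                    ≡⟨ ^-distribʳ-* m (q ^ b) Φ ⟩
        (q ^ b) ^ m * Φ ^ m                ≤⟨ *-mono-≤ (begin
            (q ^ b) ^ m                       ≡⟨ ^-*-assoc q b m ⟩
            q ^ (b * m)                       ≤⟨ ^-monoʳ-≤ q {{>-nonZero 0<q}}
                (≤-trans (≤-reflexive (*-comm b m)) (m≤n+m (m * b) (suc (b + b)))) ⟩
            q ^ N                             ∎) (begin
            Φ ^ m                             ≡⟨ ^-distribʳ-* m Φ₁ (Φ₂ ^ t) ⟩
            Φ₁ ^ m * (Φ₂ ^ t) ^ m             ≡⟨ cong (Φ₁ ^ m *_)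
                (trans (^-*-assoc Φ₂ t m) (cong (Φ₂ ^_) (*-comm t m))) ⟩
            Φ₁ ^ m * Φ₂ ^ (m * t)             ≤⟨ lower-count b a₁ a₂ m t (s≤s z≤n) ⟩
            #extensions (2 + t) N             ∎) ⟩
        q ^ N * #extensions (2 + t) N      ≡⟨ *-comm (q ^ N) _ ⟩
        #extensions (2 + t) N * q ^ N      ∎)
      where
      c = p ^ suc (b + b)
      m = suc (p ^ b * c) + N₀
      N = suc (b + b) + m * b
      N₀≤N : N₀ ≤ N
      N₀≤N = ≤-trans (m≤n+m N₀ (suc (p ^ b * c))) (≤-trans (m≤m*n m b) (m≤n+m (m * b) (suc (b + b))))

  -- Nothing is lost here at exponential scale: pairs of colourings with equally many N's number Σ
  -- C(sp,i) C(st,i) = C(s(p + t), sp) by Vandermonde's identity, and the growth rate of this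
  -- binomial coefficient is the same quotient.
  upper-growth : ∀ p s → #extensions (suc p) s * (p ^ p * suc p ^ suc p) ^ s ≤ ((p + suc p) ^ (p + suc p)) ^ s
  upper-growth p s = begin
    #extensions t s * (p ^ p * t ^ t) ^ s                ≡⟨ cong (#extensions t s *_)
        (trans (^-distribʳ-* s (p ^ p) (t ^ t))
                                                (cong₂ _*_ (swap p p) (swap t t))) ⟩
    #extensions t s * (p ^ (s * p) * t ^ (s * t))        ≤⟨ upper-bound s p ⟩
    (t + p) ^ (s * p) * (p + t) ^ (s * t)  ≡⟨ cong (λ z → z ^ (s * p) * (p + t) ^ (s * t)) (+-comm t p) ⟩
    (p + t) ^ (s * p) * (p + t) ^ (s * t)  ≡⟨ ^-distribˡ-+-* (p + t) (s * p) (s * t) ⟨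
    (p + t) ^ (s * p + s * t)              ≡⟨ cong ((p + t) ^_) (*-distribˡ-+ s p t) ⟨
    (p + t) ^ (s * (p + t))                ≡⟨ swap (p + t) (p + t) ⟨
    ((p + t) ^ (p + t)) ^ s                ∎
    where
    open ≤-Reasoning
    t = suc p
    swap : ∀ x e → (x ^ e) ^ s ≡ x ^ (s * e)
    swap x e = trans (^-*-assoc x e s) (cong (x ^_) (*-comm e s))

  -- Rational approximation of √2.

  -- Starting from 1 + √2, of norm -1, each step multiplies P + Q √2 by the unit 3 + 2 √2 of norm 1.
  -- Norm -1 means that P / Q lies below √2.
  pell : ∀ n → ∃[ P ] ∃[ Q ] (n < Q × P * P + 1 ≡ 2 * (Q * Q))
  pell zero    = 1 , 1 , z<s , refl
  pell (suc n) with P , Q , n<Q , eq ← pell n =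
    3 * P + 4 * Q , 2 * P + 3 * Q , (begin
      2 + n                ≤⟨ s≤s n<Q ⟩
      1 + Q                ≤⟨ +-monoˡ-≤ Q (≤-trans (s≤s z≤n) n<Q) ⟩
      Q + Q                ≤⟨ m≤m+n (Q + Q) (2 * P + Q) ⟩
      Q + Q + (2 * P + Q)  ≡⟨ lem₁ P Q ⟩
      2 * P + 3 * Q        ∎) , (begin-equality
      (3 * P + 4 * Q) * (3 * P + 4 * Q) + 1               ≡⟨ lem₂ P Q ⟩
      (P * P + 1) + (8 * (P * P) + 24 * (P * Q) + 16 * (Q * Q)) ≡⟨ cong
          (_+ (8 * (P * P) + 24 * (P * Q) + 16 * (Q * Q))) eq ⟩
      2 * (Q * Q) + (8 * (P * P) + 24 * (P * Q) + 16 * (Q * Q)) ≡⟨ lem₃ P Q ⟩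
      2 * ((2 * P + 3 * Q) * (2 * P + 3 * Q))             ∎)
    where
    open ≤-Reasoning
    lem₁ : ∀ P Q → Q + Q + (2 * P + Q) ≡ 2 * P + 3 * Q
    lem₁ = solve-∀
    lem₂ : ∀ P Q → (3 * P + 4 * Q) * (3 * P + 4 * Q) + 1 ≡ (P * P + 1) +
        (8 * (P * P) + 24 * (P * Q) + 16 * (Q * Q))
    lem₂ = solve-∀
    lem₃ : ∀ P Q → 2 * (Q * Q) + (8 * (P * P) + 24 * (P * Q) + 16 * (Q * Q)) ≡ 2 *
        ((2 * P + 3 * Q) * (2 * P + 3 * Q))
    lem₃ = solve-∀

  square-cancel-≤ : ∀ x y → x * x ≤ y * y → x ≤ y
  square-cancel-≤ x y le = ≮⇒≥ λ y<x → <⇒≱ (*-mono-< y<x y<x) le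

  -- If x/d < k (3 + 2 a/c) with (a/c)² ≤ 2, then already x/d < k (1 + P/Q)² for a
  -- convergent P/Q of √2: here (P + Q)² + 1 = 3 Q² + 2 P Q, and a/c ≤ (P + 1)/Q.
  approximate : ∀ a c x d k → 0 < c → a * a ≤ 2 * (c * c) → x * c < k * (3 * c + 2 * a) * d →
    ∃[ P ] ∃[ Q ] (0 < Q × P * P ≤ 2 * (Q * Q) × x * (Q * Q) < d * (k * ((P + Q) * (P + Q))))
  approximate a c x d k 0<c a²≤2c² lt
    with P , Q , big , eq ← pell (d * k * (3 * c)) =
    P , Q , 0<Q , ≤-trans (m≤m+n (P * P) 1) (≤-reflexive eq) ,
    *-cancelˡ-< c _ _ (+-cancelʳ-< (m * (2 * c * Q + c)) _ _ (begin-strict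
      c * (x * (Q * Q)) + m * (2 * c * Q + c)  <⟨ +-monoʳ-< (c * (x * (Q * Q))) small ⟩
      c * (x * (Q * Q)) + Q * Q                ≡⟨ lem₁ c x Q ⟩
      suc (x * c) * (Q * Q)                    ≤⟨ *-monoˡ-≤ (Q * Q) lt ⟩
      k * (3 * c + 2 * a) * d * (Q * Q)        ≡⟨ lem₂ k c a d Q ⟩
      m * (3 * c * (Q * Q) + 2 * Q * (a * Q))  ≤⟨ *-monoʳ-≤ m
          (+-monoʳ-≤ (3 * c * (Q * Q)) (*-monoʳ-≤ (2 * Q) aQ≤)) ⟩
      m * (3 * c * (Q * Q) + 2 * Q * (c * (P + 1)))
        ≡⟨ lem₃ m c P Q ⟩
      m * (c * (Q * Q + 2 * (Q * Q) + 2 * P * Q) + 2 * c * Q)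
        ≡⟨ cong (λ z → m * (c * (Q * Q + z + 2 * P * Q) + 2 * c * Q)) eq ⟨
      m * (c * (Q * Q + (P * P + 1) + 2 * P * Q) + 2 * c * Q)
        ≡⟨ lem₄ d k c P Q ⟩
      c * (d * (k * ((P + Q) * (P + Q)))) + m * (2 * c * Q + c) ∎))
    where
    open ≤-Reasoning
    m = d * k
    0<Q : 0 < Q
    0<Q = ≤-<-trans z≤n big
    small : m * (2 * c * Q + c) < Q * Q
    small = begin-strict
      m * (2 * c * Q + c)      ≤⟨ *-monoʳ-≤ m (+-monoʳ-≤ (2 * c * Q) (m≤m*n c Q {{>-nonZero 0<Q}})) ⟩
      m * (2 * c * Q + c * Q)  ≡⟨ lem m c Q ⟩
      m * (3 * c) * Q          <⟨ *-monoˡ-< Q {{>-nonZero 0<Q}} big ⟩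
      Q * Q                    ∎
      where
      lem : ∀ m c Q → m * (2 * c * Q + c * Q) ≡ m * (3 * c) * Q
      lem = solve-∀
    aQ≤ : a * Q ≤ c * (P + 1)
    aQ≤ = square-cancel-≤ _ _ (begin
      a * Q * (a * Q)             ≡⟨ lem a Q ⟩
      a * a * (Q * Q)             ≤⟨ *-monoˡ-≤ (Q * Q) a²≤2c² ⟩
      2 * (c * c) * (Q * Q)       ≡⟨ lem′ c Q ⟩
      c * c * (2 * (Q * Q))       ≡⟨ cong (c * c *_) eq ⟨
      c * c * (P * P + 1)         ≤⟨ *-monoʳ-≤ (c * c) (m≤m+n (P * P + 1) (2 * P)) ⟩
      c * c * (P * P + 1 + 2 * P) ≡⟨ lem″ c P ⟩
      c * (P + 1) * (c * (P + 1)) ∎)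
      where
      lem : ∀ a Q → a * Q * (a * Q) ≡ a * a * (Q * Q)
      lem = solve-∀
      lem′ : ∀ c Q → 2 * (c * c) * (Q * Q) ≡ c * c * (2 * (Q * Q))
      lem′ = solve-∀
      lem″ : ∀ c P → c * c * (P * P + 1 + 2 * P) ≡ c * (P + 1) * (c * (P + 1))
      lem″ = solve-∀
    lem₁ : ∀ c x Q → c * (x * (Q * Q)) + Q * Q ≡ suc (x * c) * (Q * Q)
    lem₁ = solve-∀
    lem₂ : ∀ k c a d Q → k * (3 * c + 2 * a) * d * (Q * Q) ≡ d * k * (3 * c * (Q * Q) + 2 * Q * (a * Q))
    lem₂ = solve-∀
    lem₃ : ∀ m c P Q → m * (3 * c * (Q * Q) + 2 * Q * (c * (P + 1))) ≡ m *
        (c * (Q * Q + 2 * (Q * Q) + 2 * P * Q) + 2 * c * Q)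
    lem₃ = solve-∀
    lem₄ : ∀ d k c P Q → d * k * (c * (Q * Q + (P * P + 1) + 2 * P * Q) + 2 * c * Q) ≡
                         c * (d * (k * ((P + Q) * (P + Q)))) + d * k * (2 * c * Q + c)
    lem₄ = solve-∀

-- Nonnegative rationals as pairs of natural numbers.

module Fractions where

  import Algebra.Definitions.RawSemiring as RawSemiringOps
  open import Data.Integer as ℤ using (+_; -[1+_])
  import Data.Integer.Properties as ℤ
  open import Data.Nat as ℕ using (ℕ; zero; suc)
  import Data.Nat.Properties as ℕ
  open import Data.Product using (∃-syntax; _,_)
  open import Data.Rational as ℚ using (ℚ; 0ℚ; mkℚ; toℚᵘ)
  import Data.Rational.Properties as ℚ
  open import Data.Rational.Unnormalised as ℚᵘ using (mkℚᵘ; *≡*; *≤*; *<*)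
  import Data.Rational.Unnormalised.Properties as ℚᵘ
  open import Relation.Binary.PropositionalEquality
  open RawSemiringOps ℚ.+-*-rawSemiring using (_^_)

  infix 7 _÷_

  -- The denominator is suc b.
  _÷_ : ℕ → ℕ → ℚ
  a ÷ b = + a ℚ./ suc b

  toℚᵘ-÷ : ∀ a b → toℚᵘ (a ÷ b) ℚᵘ.≃ mkℚᵘ (+ a) b
  toℚᵘ-÷ a b = ℚ.toℚᵘ-fromℚᵘ (mkℚᵘ (+ a) b)

  ÷-≤ : ∀ a b c d → a ℕ.* suc d ℕ.≤ c ℕ.* suc b → a ÷ b ℚ.≤ c ÷ d
  ÷-≤ a b c d le = ℚ.toℚᵘ-cancel-≤ (ℚᵘ.≤-respˡ-≃ (ℚᵘ.≃-sym (toℚᵘ-÷ a b)) (ℚᵘ.≤-respʳ-≃ (ℚᵘ.≃-sym (toℚᵘ-÷ c d))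
    (*≤* (subst₂ ℤ._≤_ (ℤ.pos-* a (suc d)) (ℤ.pos-* c (suc b)) (ℤ.+≤+ le)))))

  ÷-< : ∀ a b c d → a ℕ.* suc d ℕ.< c ℕ.* suc b → a ÷ b ℚ.< c ÷ d
  ÷-< a b c d lt = ℚ.toℚᵘ-cancel-< (ℚᵘ.<-respˡ-≃ (ℚᵘ.≃-sym (toℚᵘ-÷ a b)) (ℚᵘ.<-respʳ-≃ (ℚᵘ.≃-sym (toℚᵘ-÷ c d))
    (*<* (subst₂ ℤ._<_ (ℤ.pos-* a (suc d)) (ℤ.pos-* c (suc b)) (ℤ.+<+ lt)))))

  ÷-≤⁻¹ : ∀ a b c d → a ÷ b ℚ.≤ c ÷ d → a ℕ.* suc d ℕ.≤ c ℕ.* suc b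
  ÷-≤⁻¹ a b c d le = ℕ.≮⇒≥ λ lt → ℚ.<-irrefl refl (ℚ.<-≤-trans (÷-< c d a b lt) le)

  ÷-<⁻¹ : ∀ a b c d → a ÷ b ℚ.< c ÷ d → a ℕ.* suc d ℕ.< c ℕ.* suc b
  ÷-<⁻¹ a b c d lt = ℕ.≰⇒> λ le → ℚ.<-irrefl refl (ℚ.<-≤-trans lt (÷-≤ c d a b le))

  ÷-≡ : ∀ a b c d → a ℕ.* suc d ≡ c ℕ.* suc b → a ÷ b ≡ c ÷ d
  ÷-≡ a b c d eq = ℚ.≤-antisym (÷-≤ a b c d (ℕ.≤-reflexive eq)) (÷-≤ c d a b (ℕ.≤-reflexive (sym eq)))

  ÷-* : ∀ a b c d → (a ÷ b) ℚ.* (c ÷ d) ≡ (a ℕ.* c) ÷ ℕ.pred (suc b ℕ.* suc d)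
  ÷-* a b c d = ℚ.toℚᵘ-injective (ℚᵘ.≃-trans (ℚ.toℚᵘ-homo-* (a ÷ b) (c ÷ d))
    (ℚᵘ.≃-trans (ℚᵘ.*-cong (toℚᵘ-÷ a b) (toℚᵘ-÷ c d)) (ℚᵘ.≃-trans
      (*≡* (cong (ℤ._* + suc (d ℕ.+ b ℕ.* suc d)) (sym (ℤ.pos-* a c))))
      (ℚᵘ.≃-sym (toℚᵘ-÷ (a ℕ.* c) (ℕ.pred (suc b ℕ.* suc d)))))))

  ÷-+ : ∀ a b c d → (a ÷ b) ℚ.+ (c ÷ d) ≡ (a ℕ.* suc d ℕ.+ c ℕ.* suc b) ÷ ℕ.pred (suc b ℕ.* suc d)
  ÷-+ a b c d = ℚ.toℚᵘ-injective (ℚᵘ.≃-trans (ℚ.toℚᵘ-homo-+ (a ÷ b) (c ÷ d))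
    (ℚᵘ.≃-trans (ℚᵘ.+-cong (toℚᵘ-÷ a b) (toℚᵘ-÷ c d)) (ℚᵘ.≃-trans
      (*≡* (cong (ℤ._* + suc (d ℕ.+ b ℕ.* suc d))
          (trans (cong₂ ℤ._+_ (sym (ℤ.pos-* a (suc d))) (sym (ℤ.pos-* c (suc b))))
        (sym (ℤ.pos-+ (a ℕ.* suc d) (c ℕ.* suc b))))))
      (ℚᵘ.≃-sym (toℚᵘ-÷ (a ℕ.* suc d ℕ.+ c ℕ.* suc b) (ℕ.pred (suc b ℕ.* suc d)))))))

  ÷-^ : ∀ a b N → (a ÷ b) ^ N ≡ (a ℕ.^ N) ÷ ℕ.pred (suc b ℕ.^ N)
  ÷-^ a b zero    = refl
  ÷-^ a b (suc N) = trans (cong ((a ÷ b) ℚ.*_) (÷-^ a b N)) (trans (÷-* a b (a ℕ.^ N) _)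
    (cong (λ z → (a ℕ.* a ℕ.^ N) ÷ ℕ.pred (suc b ℕ.* z)) (ℕ.suc-pred (suc b ℕ.^ N) {{ℕ.m^n≢0 (suc b) N}})))

  ÷-^-≤ : ∀ a b N m → a ℕ.^ N ℕ.≤ m ℕ.* suc b ℕ.^ N → (a ÷ b) ^ N ℚ.≤ + m ℚ./ 1
  ÷-^-≤ a b N m le = subst (ℚ._≤ m ÷ 0) (sym (÷-^ a b N))
      (÷-≤ (a ℕ.^ N) (ℕ.pred (suc b ℕ.^ N)) m 0 (subst₂ ℕ._≤_ (sym (ℕ.*-identityʳ _))
    (cong (m ℕ.*_) (sym (ℕ.suc-pred (suc b ℕ.^ N) {{ℕ.m^n≢0 (suc b) N}}))) le))

  ÷-^-≤⁻¹ : ∀ a b N m → (a ÷ b) ^ N ℚ.≤ + m ℚ./ 1 → a ℕ.^ N ℕ.≤ m ℕ.* suc b ℕ.^ N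
  ÷-^-≤⁻¹ a b N m le = subst₂ ℕ._≤_ (ℕ.*-identityʳ _)
    (cong (m ℕ.*_) (ℕ.suc-pred (suc b ℕ.^ N) {{ℕ.m^n≢0 (suc b) N}}))
    (÷-≤⁻¹ (a ℕ.^ N) (ℕ.pred (suc b ℕ.^ N)) m 0 (subst (ℚ._≤ m ÷ 0) (÷-^ a b N) le))

  nonneg-÷ : ∀ r → 0ℚ ℚ.≤ r → ∃[ a ] ∃[ b ] r ≡ a ÷ b
  nonneg-÷ r@(mkℚ (+ a) b _)     0≤r = a , b , sym (ℚ.↥p/↧p≡p r)
  nonneg-÷ (mkℚ -[1+ a ] b _) 0≤r with ℚ.drop-*≤* 0≤r
  ... | ()

  0≤÷ : ∀ a b → 0ℚ ℚ.≤ a ÷ b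
  0≤÷ a b = ÷-≤ 0 0 a b ℕ.z≤n

-- The limit as a Dedekind cut.

module Limit where

  open import Axiom.ExcludedMiddle using (ExcludedMiddle)
  open import Data.Integer using (+_)
  open import Data.Nat as ℕ using (ℕ; zero; suc; NonZero; z≤n; s≤s)
  import Data.Nat.Properties as ℕ
  open import Data.Nat.Tactic.RingSolver using (solve-∀)
  open import Data.Product using (∃-syntax; _×_; _,_; proj₁; proj₂)
  open import Data.Rational as ℚ using (ℚ; 0ℚ; 1ℚ)
  import Data.Rational.Properties as ℚ
  open import Data.Sum using (inj₁; inj₂; [_,_]′)
  open import Level using (0ℓ)
  open import Relation.Binary.PropositionalEquality
  open import Relation.Nullary using (¬_; yes; no; contradiction)
  open import Relation.Unary using (_∈_; _∉_)
  import Algebra.Definitions.RawSemiring as RawSemiringOps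
  open import Defs
  open Combinatorics
  open Fractions
  open RawSemiringOps ℚ.+-*-rawSemiring using (_^_)
  open ℝ

  ^-cancel-≤ : ∀ {x y} N → 1 ℕ.≤ N → x ℕ.^ N ℕ.≤ y ℕ.^ N → x ℕ.≤ y
  ^-cancel-≤ N 1≤N le = ℕ.≮⇒≥ λ y<x → ℕ.<⇒≱ (ℕ.^-monoˡ-< N {{ℕ.>-nonZero 1≤N}} y<x) le

  Below-mono : ∀ t a b p q N → 0 ℕ.< q → a ℕ.* q ℕ.≤ p ℕ.* b → Below t p q N → Below t a b N
  Below-mono t a b p q N 0<q le below = ℕ.*-cancelʳ-≤ _ _ (q ℕ.^ N) {{ℕ.m^n≢0 q N {{ℕ.>-nonZero 0<q}}}} (begin
    a ℕ.^ N ℕ.* q ℕ.^ N             ≡⟨ ^-distribʳ-* N a q ⟨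
    (a ℕ.* q) ℕ.^ N                 ≤⟨ ℕ.^-monoˡ-≤ N le ⟩
    (p ℕ.* b) ℕ.^ N                 ≡⟨ ^-distribʳ-* N p b ⟩
    p ℕ.^ N ℕ.* b ℕ.^ N             ≤⟨ ℕ.*-monoˡ-≤ (b ℕ.^ N) below ⟩
    #extensions t N ℕ.* q ℕ.^ N ℕ.* b ℕ.^ N ≡⟨ lem (#extensions t N) (q ℕ.^ N) (b ℕ.^ N) ⟩
    #extensions t N ℕ.* b ℕ.^ N ℕ.* q ℕ.^ N ∎)
    where
    open ℕ.≤-Reasoning
    lem : ∀ x y z → x ℕ.* y ℕ.* z ≡ x ℕ.* z ℕ.* y
    lem = solve-∀

  crossing : ExcludedMiddle 0ℓ → (P : ℕ → Set) → ∀ K → P 0 → ¬ P K → ∃[ k ] (P k × ¬ P (suc k))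
  crossing em P zero    p0 ¬pK = contradiction p0 ¬pK
  crossing em P (suc K) p0 ¬pK with em {P K}
  ... | yes pK = K , pK , ¬pK
  ... | no ¬p  = crossing em P K p0 ¬p

  ÷-suc : ∀ k D → (k ÷ D) ℚ.+ (1 ÷ D) ≡ suc k ÷ D
  ÷-suc k D = trans (÷-+ k D 1 D) (÷-≡ (k ℕ.* suc D ℕ.+ 1 ℕ.* suc D) _ (suc k) D (lem k (suc D)))
    where
    lem : ∀ k d → (k ℕ.* d ℕ.+ 1 ℕ.* d) ℕ.* d ≡ suc k ℕ.* (d ℕ.* d)
    lem = solve-∀

  times : ℕ → ℚ → ℚ
  times zero    e = 0ℚ
  times (suc k) e = e ℚ.+ times k e

  times-mono : ∀ k {e f} → e ℚ.≤ f → times k e ℚ.≤ times k f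
  times-mono zero    le = ℚ.≤-refl
  times-mono (suc k) le = ℚ.+-mono-≤ le (times-mono k le)

  times-÷ : ∀ k a b → times k (a ÷ b) ≡ (k ℕ.* a) ÷ b
  times-÷ zero    a b = ÷-≡ 0 0 0 b refl
  times-÷ (suc k) a b = trans (cong ((a ÷ b) ℚ.+_) (times-÷ k a b)) (trans (÷-+ a b (k ℕ.* a) b)
    (÷-≡ (a ℕ.* suc b ℕ.+ k ℕ.* a ℕ.* suc b) _ (suc k ℕ.* a) b (lem k a (suc b))))
    where
    lem : ∀ k a d → (a ℕ.* d ℕ.+ k ℕ.* a ℕ.* d) ℕ.* d ≡ suc k ℕ.* a ℕ.* (d ℕ.* d)
    lem = solve-∀

  -- The largest of the summands serves for all of them. The final summand comes from `0ℝ`, is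
  -- negative and may be dropped.
  ∈-multiple : ∀ k x {z} → z ∈ lower (suc k · x) → ∃[ e ] (e ∈ lower x × z ℚ.≤ times (suc k) e)
  ∈-multiple zero    x (p , q , p∈x , q<0 , refl) = p , p∈x , ℚ.+-monoʳ-≤ p (ℚ.<⇒≤ q<0)
  ∈-multiple (suc k) x (p , q , p∈x , q∈ , refl) with e , e∈x , q≤ ← ∈-multiple k x q∈ with ℚ.≤-total p e
  ... | inj₁ p≤e = e , e∈x , ℚ.+-mono-≤ p≤e q≤
  ... | inj₂ e≤p = p , p∈x , ℚ.+-monoʳ-≤ p (ℚ.≤-trans q≤ (times-mono (suc k) e≤p))

  fraction : ∀ x y .{{_ : NonZero y}} → + x ℚ./ y ≡ x ÷ ℕ.pred y
  fraction x (suc y) = refl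

  upperBound-÷ : ∀ p → upperBound (suc p) ≡
    ((p ℕ.+ suc p) ℕ.^ (p ℕ.+ suc p)) ÷ ℕ.pred (p ℕ.^ p ℕ.* suc p ℕ.^ suc p)
  upperBound-÷ p = trans
    (fraction ((p ℕ.+ (suc p ℕ.+ 0)) ℕ.^ (p ℕ.+ (suc p ℕ.+ 0))) (p ℕ.^ p ℕ.* suc p ℕ.^ suc p)
        {{ℕ.m*n≢0 _ _ {{m^m≢0 p}} {{m^m≢0 (suc p)}}}})
    (cong (λ z → ((p ℕ.+ z) ℕ.^ (p ℕ.+ z)) ÷ ℕ.pred (p ℕ.^ p ℕ.* suc p ℕ.^ suc p)) (ℕ.+-identityʳ (suc p)))

  root≤ : ∀ m a b v w .{{_ : NonZero w}} N → 1 ℕ.≤ N →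
    a ℕ.^ N ℕ.≤ m ℕ.* suc b ℕ.^ N → m ℕ.* w ℕ.^ N ℕ.≤ v ℕ.^ N → a ÷ b ℚ.≤ v ÷ ℕ.pred w
  root≤ m a b v w N 1≤N le le′ = ÷-≤ a b v (ℕ.pred w)
      (subst (λ z → a ℕ.* z ℕ.≤ v ℕ.* suc b) (sym (ℕ.suc-pred w))
    (^-cancel-≤ N 1≤N (begin
      (a ℕ.* w) ℕ.^ N                   ≡⟨ ^-distribʳ-* N a w ⟩
      a ℕ.^ N ℕ.* w ℕ.^ N               ≤⟨ ℕ.*-monoˡ-≤ (w ℕ.^ N) le ⟩
      m ℕ.* suc b ℕ.^ N ℕ.* w ℕ.^ N     ≡⟨ lem m (suc b ℕ.^ N) (w ℕ.^ N) ⟩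
      m ℕ.* w ℕ.^ N ℕ.* suc b ℕ.^ N     ≤⟨ ℕ.*-monoˡ-≤ (suc b ℕ.^ N) le′ ⟩
      v ℕ.^ N ℕ.* suc b ℕ.^ N           ≡⟨ ^-distribʳ-* N v (suc b) ⟨
      (v ℕ.* suc b) ℕ.^ N               ∎)))
    where
    open ℕ.≤-Reasoning
    lem : ∀ x y z → x ℕ.* y ℕ.* z ≡ x ℕ.* z ℕ.* y
    lem = solve-∀

  EventualRoot : ℕ → ℚ → Set
  EventualRoot t r = 0ℚ ℚ.≤ r × ∃[ N₀ ] (∀ N → N₀ ℕ.≤ N → r ^ N ℚ.≤ + #extensions t N ℚ./ 1)

  eventualRoot : ∀ t a b → Eventually t (Below t a (suc b)) → EventualRoot t (a ÷ b)
  eventualRoot t a b (N₀ , h) = 0≤÷ a b , N₀ , λ N N₀≤N → ÷-^-≤ a b N (#extensions t N) (h N N₀≤N)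

  eventualRoot≤ : ∀ p r → EventualRoot (suc p) r → r ℚ.≤ upperBound (suc p)
  eventualRoot≤ p r (0≤r , N₀ , h) = subst₂ ℚ._≤_ (sym r≡) (sym (upperBound-÷ p))
    (root≤ (#extensions (suc p) N) a b ((p ℕ.+ suc p) ℕ.^ (p ℕ.+ suc p)) (p ℕ.^ p ℕ.* suc p ℕ.^ suc p)
      {{ℕ.m*n≢0 _ _ {{m^m≢0 p}} {{m^m≢0 (suc p)}}}} N (s≤s z≤n)
      (÷-^-≤⁻¹ a b N (#extensions (suc p) N)
        (subst (λ r → r ^ N ℚ.≤ + #extensions (suc p) N ℚ./ 1) r≡ (h N (ℕ.n≤1+n N₀))))
      (upper-growth p N))
    where
    N = suc N₀
    a = proj₁ (nonneg-÷ r 0≤r)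
    b = proj₁ (proj₂ (nonneg-÷ r 0≤r))
    r≡ = proj₂ (proj₂ (nonneg-÷ r 0≤r))

  -- The lower limit of the roots as a cut. Asking for some r strictly above q makes it rounded, and
  -- the upper bound of the theorem makes it proper.
  limit : ℕ → ℝ
  limit p = record
    { lower     = λ q → ∃[ r ] (q ℚ.< r × EventualRoot (suc p) r)
    ; inhabited = ℚ.- 1ℚ , 0 ÷ 0 , ℚ.negative⁻¹ (ℚ.- 1ℚ) , eventualRoot (suc p) 0 0 (1 , zero-below)
    ; proper    = upperBound (suc p) , λ (r , U<r , root) → ℚ.<-irrefl refl
        (ℚ.<-≤-trans U<r (eventualRoot≤ p r root))
    ; closed    = λ p<q (r , q<r , root) → r , ℚ.<-trans p<q q<r , root
    ; rounded   = λ (r , p<r , root) → let q , p<q , q<r = ℚ.<-dense p<r in q , p<q , r , q<r , root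
    }
    where
    zero-below : ∀ N → 1 ℕ.≤ N → Below (suc p) 0 1 N
    zero-below (suc N) _ = z≤n

  limit≤ : ∀ p → limit p ≤ fromℚ (upperBound (suc p))
  limit≤ p (r , q<r , root) = ℚ.<-≤-trans q<r (eventualRoot≤ p r root)

  -- A rational in the cut `√ 2` comes with a larger nonnegative one whose square is at most 2;
  -- taking it as a / (b + 1) reduces the comparison of reals to one of natural numbers.
  ∈-silver : ∀ k {z} → z ∈ lower (suc k · (fromℕ 3 + 2 · √ 2)) → ∃[ a ] ∃[ b ]
    (a ℕ.* a ℕ.≤ 2 ℕ.* (suc b ℕ.* suc b) × z ℚ.< (suc k ℕ.* (3 ℕ.* suc b ℕ.+ 2 ℕ.* a)) ÷ b)
  ∈-silver k {z} z∈ =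
    let e , (p₁ , p₂ , p₁<3 , p₂∈ , e≡) , z≤ = ∈-multiple k (fromℕ 3 + 2 · √ 2) z∈
        g , (r , g<r , 0≤r , r²≤2) , p₂≤     = ∈-multiple 1 (√ 2) p₂∈
        a , b , r≡                           = nonneg-÷ r 0≤r
        e<f = subst (ℚ._< f a b) (sym e≡) (begin-strict
          p₁ ℚ.+ p₂                    <⟨ ℚ.+-mono-<-≤ p₁<3 (ℚ.≤-trans p₂≤ (times-mono 2 (ℚ.<⇒≤ g<r))) ⟩
          (3 ÷ 0) ℚ.+ times 2 r        ≡⟨ cong (λ x → (3 ÷ 0) ℚ.+ times 2 x) r≡ ⟩
          (3 ÷ 0) ℚ.+ times 2 (a ÷ b)  ≡⟨ cong ((3 ÷ 0) ℚ.+_) (times-÷ 2 a b) ⟩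
          (3 ÷ 0) ℚ.+ (2 ℕ.* a) ÷ b    ≡⟨ ÷-+ 3 0 (2 ℕ.* a) b ⟩
          (3 ℕ.* suc b ℕ.+ 2 ℕ.* a ℕ.* 1) ÷ ℕ.pred (1 ℕ.* suc b)
                                       ≡⟨ ÷-≡ (3 ℕ.* suc b ℕ.+ 2 ℕ.* a ℕ.* 1) _ (3 ℕ.* suc b ℕ.+ 2 ℕ.* a) b
                                           (lem a (suc b)) ⟩
          f a b                        ∎)
    in a , b ,
       subst₂ (λ i j → a ℕ.* i ℕ.≤ 2 ℕ.* (suc b ℕ.* j)) (ℕ.*-identityʳ a) (ℕ.*-identityʳ (suc b))
         (÷-^-≤⁻¹ a b 2 2 (subst (λ x → x ^ 2 ℚ.≤ + 2 ℚ./ 1) r≡ r²≤2)) ,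
       (begin-strict
         z                                            ≤⟨ z≤ ⟩
         e ℚ.+ times k e                              <⟨ ℚ.+-mono-<-≤ e<f (times-mono k (ℚ.<⇒≤ e<f)) ⟩
         f a b ℚ.+ times k (f a b)                    ≡⟨ times-÷ (suc k) (3 ℕ.* suc b ℕ.+ 2 ℕ.* a) b ⟩
         (suc k ℕ.* (3 ℕ.* suc b ℕ.+ 2 ℕ.* a)) ÷ b    ∎)
    where
    open ℚ.≤-Reasoning
    f : ℕ → ℕ → ℚ
    f a b = (3 ℕ.* suc b ℕ.+ 2 ℕ.* a) ÷ b
    lem : ∀ a d → (3 ℕ.* d ℕ.+ 2 ℕ.* a ℕ.* 1) ℕ.* d ≡ (3 ℕ.* d ℕ.+ 2 ℕ.* a) ℕ.* (1 ℕ.* d)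
    lem = solve-∀

  module _ (u : ℕ) where

    private
      t = suc (suc u)
      A = #extensions t
      L = limit (suc u)

    fekete-÷ : ∀ a b c d → c ÷ d ℚ.< a ÷ b → Frequently t (Below t a (suc b)) → EventualRoot t (c ÷ d)
    fekete-÷ a b c d lt often = eventualRoot t c d
        (fekete t (s≤s z≤n) (s≤s z≤n) (s≤s z≤n) (÷-<⁻¹ c d a b lt) often)

    below-convergent : ∀ P Q x d → 0 ℕ.< Q → P ℕ.* P ℕ.≤ 2 ℕ.* (Q ℕ.* Q) →
      x ℕ.* (Q ℕ.* Q) ℕ.< suc d ℕ.* (4 ℕ.^ u ℕ.* ((P ℕ.+ Q) ℕ.* (P ℕ.+ Q))) → x ÷ d ∈ lower L
    below-convergent P Q x d 0<Q P²≤2Q² lt =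
      -- Two intermediate rationals are needed: `lower-growth` reaches `r` infinitely often,
      -- `fekete` gives up the distance from `r` to `r′`, and the cut asks for `r′` strictly above x
      -- ÷ d.
      let r , z<r , r<bound = ℚ.<-dense (÷-< x d W (ℕ.pred (Q ℕ.* Q))
              (subst₂ ℕ._<_ (cong (x ℕ.*_) (sym Q²)) (ℕ.*-comm (suc d) W) lt))
          r′ , z<r′ , r′<r  = ℚ.<-dense z<r
          p , q , r≡        = nonneg-÷ r (ℚ.≤-trans (0≤÷ x d) (ℚ.<⇒≤ z<r))
          p′ , q′ , r′≡     = nonneg-÷ r′ (ℚ.≤-trans (0≤÷ x d) (ℚ.<⇒≤ z<r′))
          0<p               = ℕ.≤-trans (÷-<⁻¹ 0 0 p q (subst (0ℚ ℚ.<_) r≡ (ℚ.≤-<-trans (0≤÷ x d) z<r)))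
              (ℕ.≤-reflexive (ℕ.*-identityʳ p))
      in p′ ÷ q′ , subst (x ÷ d ℚ.<_) r′≡ z<r′ , fekete-÷ p q p′ q′ (subst₂ ℚ._<_ r′≡ r≡ r′<r)
           (lower-growth u p (suc q) P Q 0<p (s≤s z≤n) 0<Q P²≤2Q²
             (subst₂ ℕ._<_ (cong (p ℕ.*_) Q²) (ℕ.*-comm W (suc q))
               (÷-<⁻¹ p q W (ℕ.pred (Q ℕ.* Q)) (subst (ℚ._< W ÷ ℕ.pred (Q ℕ.* Q)) r≡ r<bound))))
      where
      W = 4 ℕ.^ u ℕ.* ((P ℕ.+ Q) ℕ.* (P ℕ.+ Q))
      Q² : suc (ℕ.pred (Q ℕ.* Q)) ≡ Q ℕ.* Q
      Q² = ℕ.suc-pred (Q ℕ.* Q) {{ℕ.>-nonZero (ℕ.*-mono-≤ 0<Q 0<Q)}}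

    -- The crude fraction 0 / 1 for √2 already gives a positive rate. This settles the nonpositive
    -- rationals and is the starting point for `locate`.
    0∈limit : 0 ÷ 0 ∈ lower L
    0∈limit = below-convergent 0 1 0 0 (s≤s z≤n) z≤n (ℕ.≤-trans (ℕ.m^n>0 4 u)
      (ℕ.≤-reflexive (sym (trans (ℕ.*-identityˡ _) (ℕ.*-identityʳ (4 ℕ.^ u))))))

    private
      nonneg∈limit : ∀ {z} a b → a ℕ.* a ℕ.≤ 2 ℕ.* (suc b ℕ.* suc b) →
        z ℚ.< (4 ℕ.^ u ℕ.* (3 ℕ.* suc b ℕ.+ 2 ℕ.* a)) ÷ b → 0ℚ ℚ.≤ z → z ∈ lower L
      nonneg∈limit {z} a b a²≤ z< 0≤z =
        let x , d , z≡ = nonneg-÷ z 0≤z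
            P , Q , 0<Q , P²≤ , lt = approximate a (suc b) x (suc d) (4 ℕ.^ u) (s≤s z≤n) a²≤
              (÷-<⁻¹ x d (4 ℕ.^ u ℕ.* (3 ℕ.* suc b ℕ.+ 2 ℕ.* a)) b
                (subst (ℚ._< (4 ℕ.^ u ℕ.* (3 ℕ.* suc b ℕ.+ 2 ℕ.* a)) ÷ b) z≡ z<))
        in subst (_∈ lower L) (sym z≡) (below-convergent P Q x d 0<Q P²≤ lt)

      nonpos∈limit : ∀ {z} → z ℚ.≤ 0ℚ → z ∈ lower L
      nonpos∈limit z≤0 = let r , 0<r , root = 0∈limit in r , ℚ.≤-<-trans z≤0 0<r , root

      4^u : suc (ℕ.pred (4 ℕ.^ u)) ≡ 4 ℕ.^ u
      4^u = ℕ.suc-pred (4 ℕ.^ u) {{ℕ.m^n≢0 4 u}}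

    lower≤limit : (4 ℕ.^ u) · (fromℕ 3 + 2 · √ 2) ≤ L
    lower≤limit {z} z∈ =
      let a , b , a²≤ , z< = ∈-silver (ℕ.pred (4 ℕ.^ u))
              (subst (λ k → z ∈ lower (k · (fromℕ 3 + 2 · √ 2))) (sym 4^u) z∈)
      in [ nonneg∈limit a b a²≤ (subst (λ k → z ℚ.< (k ℕ.* (3 ℕ.* suc b ℕ.+ 2 ℕ.* a)) ÷ b) 4^u z<) ,
              nonpos∈limit ]′
         (ℚ.≤-total 0ℚ z)

    module Convergence (em : ExcludedMiddle 0ℓ) where

      locate : ∀ D → ∃[ k ] (k ÷ D ∈ lower L × suc k ÷ D ∉ lower L)
      locate D = crossing em (λ k → k ÷ D ∈ lower L) K (subst (_∈ lower L) (÷-≡ 0 0 0 D refl) 0∈limit)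
        λ (r , K<r , root) → ℚ.<-irrefl refl (ℚ.<-≤-trans K<r (ℚ.≤-trans (eventualRoot≤ (suc u) r root) U≤K))
        where
        U = upperBound t
        0≤U : 0ℚ ℚ.≤ U
        0≤U = subst (0ℚ ℚ.≤_) (sym (upperBound-÷ (suc u)))
            (0≤÷ ((suc u ℕ.+ t) ℕ.^ (suc u ℕ.+ t)) (ℕ.pred (suc u ℕ.^ suc u ℕ.* t ℕ.^ t)))
        v = proj₁ (nonneg-÷ U 0≤U)
        w = proj₁ (proj₂ (nonneg-÷ U 0≤U))
        K = v ℕ.* suc D
        U≤K : U ℚ.≤ K ÷ D
        U≤K = subst (ℚ._≤ K ÷ D) (sym (proj₂ (proj₂ (nonneg-÷ U 0≤U)))) (÷-≤ v w K D (ℕ.m≤m*n _ _))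

      not-above : ∀ c d n .{{_ : NonZero n}} → ¬ Below t c (suc d) n → c ÷ d ∉ lower (root n (A n))
      not-above c d n ¬below (r , q<r , 0≤r , rⁿ≤) =
        let a , b , r≡ = nonneg-÷ r 0≤r
        in ¬below (Below-mono t c (suc d) a (suc b) n (s≤s z≤n)
                (ℕ.<⇒≤ (÷-<⁻¹ c d a b (subst (c ÷ d ℚ.<_) r≡ q<r)))
             (÷-^-≤⁻¹ a b n (A n) (subst (λ x → x ^ n ℚ.≤ + A n ℚ./ 1) r≡ rⁿ≤)))

      private
        frequently : ∀ (P : ℕ → Set) → ¬ (∃[ N ] (∀ n → N ℕ.≤ n → ¬ P n)) → Frequently t P
        frequently P ¬rare N with em {∃[ n ] (N ℕ.≤ n × P n)}
        ... | yes found = found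
        ... | no ¬found = contradiction (N , λ n N≤n below → ¬found (n , N≤n , below)) ¬rare

        decide : ∀ (P : Set) {Q : Set} → (P → Q) → (¬ P → Q) → Q
        decide P f g with em {P}
        ... | yes p = f p
        ... | no ¬p = g ¬p

        step : ∀ a b k → 0ℚ ℚ.< a ÷ b → suc k ÷ suc b ℚ.< k ÷ suc b ℚ.+ a ÷ b
        step a b k 0<e = subst (ℚ._< k ÷ suc b ℚ.+ a ÷ b) (÷-suc k (suc b))
          (ℚ.+-monoʳ-< (k ÷ suc b) (÷-< 1 (suc b) a b (begin-strict
            1 ℕ.* suc b            ≡⟨ ℕ.+-identityʳ (suc b) ⟩
            suc b                  <⟨ ℕ.n<1+n (suc b) ⟩
            suc (suc b)            ≤⟨ ℕ.m≤n*m (suc (suc b)) a {{ℕ.>-nonZero 0<a}} ⟩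
            a ℕ.* suc (suc b)      ∎)))
          where
          open ℕ.≤-Reasoning
          0<a : 0 ℕ.< a
          0<a = ℕ.≤-trans (÷-<⁻¹ 0 0 a b 0<e) (ℕ.≤-reflexive (ℕ.*-identityʳ a))

      -- Otherwise the rate c ÷ d would be reached infinitely often, and `fekete` would put q into
      -- the cut by way of a rational between q and c ÷ d.
      rarely-above : ∀ {q} c d → q ∉ lower L → 0ℚ ℚ.≤ q → q ℚ.< c ÷ d →
                     ∃[ N ] (∀ n → N ℕ.≤ n → ¬ Below t c (suc d) n)
      rarely-above {q} c d q∉ 0≤q q<c = decide (∃[ N ] (∀ n → N ℕ.≤ n → ¬ Below t c (suc d) n))
          (λ rare → rare) λ ¬rare →
        let r , q<r , r<c = ℚ.<-dense q<c
            x , y , r≡    = nonneg-÷ r (ℚ.≤-trans 0≤q (ℚ.<⇒≤ q<r))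
        in contradiction (x ÷ y , subst (q ℚ.<_) r≡ q<r ,
             fekete-÷ c d x y (subst (ℚ._< c ÷ d) r≡ r<c) (frequently (Below t c (suc d)) ¬rare)) q∉

      converges : (λ s → root s (A₃₂₁ (Kᵅ s t))) ⟶ L
      converges ε (e₀ , e₀∈ε , e₀≮0) =
        -- `0ℝ < ε` only yields e₀ ≥ 0; moving up inside the cut of ε makes it positive.
        let e , e₀<e , e∈ε = rounded ε e₀∈ε
            0<e            = ℚ.≤-<-trans (ℚ.≮⇒≥ e₀≮0) e₀<e
            a , b , e≡     = nonneg-÷ e (ℚ.<⇒≤ 0<e)
            -- The grid has width 1 / (b + 2), less than e because e is a positive multiple of 1 /
            -- (b + 1).
            k , ℓ∈ , ℓ⁺∉   = locate (suc b)
            r , ℓ<r , 0≤r , N₀ , roots = ℓ∈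
            ℓ              = k ÷ suc b
            ℓ⁺<q           = subst (λ x → suc k ÷ suc b ℚ.< ℓ ℚ.+ x) (sym e≡)
                (step a b k (subst (0ℚ ℚ.<_) e≡ 0<e))
            c , d , q≡     = nonneg-÷ (ℓ ℚ.+ e) (ℚ.≤-trans (0≤÷ (suc k) (suc b)) (ℚ.<⇒≤ ℓ⁺<q))
            N₁ , rare      = rarely-above c d ℓ⁺∉ (0≤÷ (suc k) (suc b)) (subst (suc k ÷ suc b ℚ.<_) q≡ ℓ⁺<q)
        in N₀ ℕ.+ N₁ , λ n N≤n →
             -- The rational ℓ + e witnesses both inequalities: it lies in L + ε but not below the
             -- n-th root, and it lies in the n-th root plus ε but not below L.
             (ℓ ℚ.+ e , (ℓ , e , ℓ∈ , e∈ε , refl) , λ q∈ → not-above c d n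
                 (rare n (ℕ.≤-trans (ℕ.m≤n+m N₁ N₀) N≤n))
                (subst (_∈ lower (root n (A n))) q≡ q∈)) ,
             (ℓ ℚ.+ e , (ℓ , e , (r , ℓ<r , 0≤r , roots n (ℕ.≤-trans (ℕ.m≤m+n N₀ N₁) N≤n)) , e∈ε , refl) ,
               λ q∈ → ℓ⁺∉ (closed L ℓ⁺<q q∈))

open import Axiom.ExcludedMiddle using (ExcludedMiddle)
open import Data.Nat as ℕ using (ℕ; _^_; _∸_)
open import Data.Product using (∃-syntax; _×_; _,_)
open import Level using (0ℓ)
open import Defs
open Limit

theorem4 : ExcludedMiddle 0ℓ → (t : ℕ) → 2 ℕ.≤ t →
    ∃[ L ] (((λ s → root s (A₃₂₁ (Kᵅ s t))) ⟶ L) ×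
    (4 ^ (t ∸ 2)) · (fromℕ 3 + 2 · √ 2) ≤ L ×
    L ≤ fromℚ (upperBound t))
theorem4 em (ℕ.suc (ℕ.suc u)) (ℕ.s≤s (ℕ.s≤s _)) =
  limit (ℕ.suc u) , Convergence.converges u em , lower≤limit u , limit≤ (ℕ.suc u)
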